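{- For a permutation $w\in S_n$, the Newton polytope $\mathrm{Newton}(\mathfrak{G}_w)$ of the Grothendieck polynomial is lattice-free if and only if $w$ avoids the patterns $1432$, $1423$, $13254$.
   Context: Grothendieck polynomials: with $\partial_i f=(f-s_if)/(x_i-x_{i+1})$ ($s_i$ swaps $x_i,x_{i+1}$), $\mathfrak{G}_{w_0}=x_1^{n-1}\cdots x_{n-1}$ for $w_0=n(n-1)\cdots1$, and $\mathfrak{G}_w=\partial_i((1-x_{i+1})\mathfrak{G}_{ws_i})$ whenever $w(i)<w(i+1)$ ($ws_i$ swaps the values in positions $i,i+1$). $\mathrm{Newton}(f)=\mathrm{conv}\{\alpha:c_\alpha\ne0\}$ for $f=\sum c_\alpha x^\alpha$. A polytope $P\subset\mathbb{R}^n$ is lattice-free if $P\cap\mathbb{Z}^n$ equals its vertex set. Pattern avoidance: $w$ contains $\tau\in S_k$ if some subsequence $w(i_1),\ldots,w(i_k)$ with $i_1<\cdots<i_k$ is order-isomorphic to $\tau$; otherwise it avoids $\tau$.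
   Formalization: The Newton polytope is taken in rational n-space, with rational convex weights and extremality tested among rational points, instead of in real n-space; its lattice points and vertices are the same. -}

module Defs where

open import Data.Nat as ℕ using (ℕ; zero; suc; _∸_)
import Data.Nat.Properties as NP
open import Data.Integer as ℤ using (ℤ; +_; -_; 0ℤ)
open import Data.Rational as ℚ using (ℚ; 0ℚ; 1ℚ; _/_)
open import Data.Fin as Fin using (Fin; toℕ; fromℕ<)
open import Data.Fin.Permutation using (Permutation′; _⟨$⟩ʳ_; transpose; _∘ₚ_)
open import Data.Vec as Vec using (Vec; []; _∷_)
open import Data.Vec.Relation.Unary.All as VAll using ()
open import Data.Vec.Properties using (≡-dec)
open import Data.List as List using (List; []; _∷_; _++_; upTo)
open import Data.List.Relation.Unary.All using (All)
open import Data.Maybe using (Maybe; just; nothing)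
open import Data.Product using (Σ; ∃; _×_; _,_)
open import Relation.Nullary using (¬_; yes; no)
open import Relation.Binary.PropositionalEquality using (_≡_; _≢_)

-- Polynomials in x_1..x_n with integer coefficients, as (unnormalised)
-- finite lists of terms  c · x^α  (α ∈ ℕ^n an exponent vector).
-- The polynomial denoted is the sum of its terms; coefficients are
-- extracted by `coeff`, which collects like terms.

Poly : ℕ → Set
Poly n = List (ℤ × Vec ℕ n)

coeff : ∀ {n} → Poly n → Vec ℕ n → ℤ
coeff [] α = 0ℤ
coeff ((c , β) ∷ p) α with ≡-dec ℕ._≟_ β α
... | yes _ = c ℤ.+ coeff p α
... | no  _ = coeff p α

getE : ∀ {n} → Vec ℕ n → ℕ → ℕ
getE [] _ = 0
getE (a ∷ α) zero = a
getE (a ∷ α) (suc k) = getE α k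

setE : ∀ {n} → Vec ℕ n → ℕ → ℕ → Vec ℕ n
setE [] _ _ = []
setE (a ∷ α) zero v = v ∷ α
setE (a ∷ α) (suc k) v = a ∷ setE α k v

oneMinusX : ∀ {n} → ℕ → Poly n → Poly n
oneMinusX j p = p ++ List.map (λ { (c , α) → (- c , setE α j (suc (getE α j))) }) p

-- Divided difference ∂_i f = (f - s_i f)/(x_i - x_{i+1}), with i 0-based
-- (so it acts on the variables numbered i and i+1).  It is linear, and on
-- a monomial with exponents a = α_i, b = α_{i+1} the exact quotient is
--   (x^a y^b - x^b y^a)/(x - y)
--      =  Σ_{k<a-b} x^{a-1-k} y^{b+k}        if a > b
--      = -Σ_{k<b-a} x^{b-1-k} y^{a+k}        if a < b
--      =  0                                  if a = b.
-- (Exactly one of the two lists below is nonempty unless a = b.)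
∂term : ∀ {n} → ℕ → ℤ × Vec ℕ n → Poly n
∂term i (c , α) =
  List.map (λ k → (c , setE (setE α i (a ∸ 1 ∸ k)) (suc i) (b ℕ.+ k))) (upTo (a ∸ b))
  ++ List.map (λ k → (- c , setE (setE α i (b ∸ 1 ∸ k)) (suc i) (a ℕ.+ k))) (upTo (b ∸ a))
  where
  a = getE α i
  b = getE α (suc i)

∂ : ∀ {n} → ℕ → Poly n → Poly n
∂ i p = List.concatMap (∂term i) p

-- Permutations w ∈ S_n are stdlib `Permutation′ n` (bijections Fin n ↔ Fin n),
-- w(i) = w ⟨$⟩ʳ i, positions/values 0-based.

adjPairs : (n : ℕ) → List (Fin n × Fin n)
adjPairs n = List.mapMaybe pair (upTo n)
  where
  pair : ℕ → Maybe (Fin n × Fin n)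
  pair i with suc i ℕ.<? n
  ... | yes p = just (fromℕ< (NP.<-trans (NP.n<1+n i) p) , fromℕ< p)
  ... | no _ = nothing

-- first ascent (i , i+1) of w, i.e. w(i) < w(i+1); nothing iff w = w₀
firstAscent : ∀ {n} → Permutation′ n → Maybe (Fin n × Fin n)
firstAscent {n} w = go (adjPairs n)
  where
  go : List (Fin n × Fin n) → Maybe (Fin n × Fin n)
  go [] = nothing
  go ((i , j) ∷ ps) with (w ⟨$⟩ʳ i) Fin.<? (w ⟨$⟩ʳ j)
  ... | yes _ = just (i , j)
  ... | no  _ = go ps

grothTop : (n : ℕ) → Poly n
grothTop n = (+ 1 , Vec.tabulate (λ j → n ∸ 1 ∸ toℕ j)) ∷ []

-- 𝔊_w = ∂_i((1 - x_{i+1}) 𝔊_{w s_i}) at the first ascent i of w, where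
-- w s_i = transpose i (i+1) ∘ₚ w (apply s_i first, then w: positions swapped).
-- Fuel bounds the recursion depth (ℓ(w₀) - ℓ(w) < 1 + n·n steps suffice).
grothF : ∀ {n} → ℕ → Permutation′ n → Poly n
grothF {n} zero w = []
grothF {n} (suc f) w with firstAscent w
... | nothing = grothTop n
... | just (i , j) = ∂ (toℕ i) (oneMinusX (toℕ j) (grothF f (transpose i j ∘ₚ w)))

groth : ∀ {n} → Permutation′ n → Poly n
groth {n} w = grothF (suc (n ℕ.* n)) w

toℚv : ∀ {n} → Vec ℕ n → Vec ℚ n
toℚv = Vec.map (λ m → + m / 1)

combo : ∀ {n} → List (ℚ × Vec ℕ n) → Vec ℚ n
combo [] = Vec.replicate _ 0ℚ
combo ((t , β) ∷ cs) = Vec.zipWith ℚ._+_ (Vec.map (t ℚ.*_) (toℚv β)) (combo cs)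

sumW : ∀ {n} → List (ℚ × Vec ℕ n) → ℚ
sumW [] = 0ℚ
sumW ((t , _) ∷ cs) = t ℚ.+ sumW cs

Newton : ∀ {n} → Poly n → Vec ℚ n → Set
Newton {n} f x = ∃ λ (cs : List (ℚ × Vec ℕ n)) →
  All (λ { (t , β) → (0ℚ ℚ.≤ t) × (coeff f β ≢ 0ℤ) }) cs
  × sumW cs ≡ 1ℚ
  × combo cs ≡ x

IsVertex : ∀ {n} → (Vec ℚ n → Set) → Vec ℚ n → Set
IsVertex P x = P x × (∀ y z t → P y → P z → 0ℚ ℚ.< t → t ℚ.< 1ℚ →
  x ≡ Vec.zipWith ℚ._+_ (Vec.map (t ℚ.*_) y) (Vec.map ((1ℚ ℚ.- t) ℚ.*_) z) → y ≡ z)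

IsIntegral : ∀ {n} → Vec ℚ n → Set
IsIntegral x = VAll.All (λ q → ∃ λ (z : ℤ) → q ≡ z / 1) x

LatticeFree : ∀ {n} → (Vec ℚ n → Set) → Set
LatticeFree P = ∀ x → ((P x × IsIntegral x) → IsVertex P x) × (IsVertex P x → (P x × IsIntegral x))

Contains : ∀ {n k} → Permutation′ n → (Fin k → Fin k) → Set
Contains {n} {k} w τ = ∃ λ (ι : Fin k → Fin n) →
  (∀ a b → a Fin.< b → ι a Fin.< ι b)
  × (∀ a b → ((w ⟨$⟩ʳ ι a) Fin.< (w ⟨$⟩ʳ ι b) → τ a Fin.< τ b)
           × (τ a Fin.< τ b → (w ⟨$⟩ʳ ι a) Fin.< (w ⟨$⟩ʳ ι b)))

pat : ∀ {k} → Vec (Fin k) k → Fin k → Fin k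
pat v = Vec.lookup v

p1432 : Fin 4 → Fin 4
p1432 = pat (Fin.# 0 ∷ Fin.# 3 ∷ Fin.# 2 ∷ Fin.# 1 ∷ [])

p1423 : Fin 4 → Fin 4
p1423 = pat (Fin.# 0 ∷ Fin.# 3 ∷ Fin.# 1 ∷ Fin.# 2 ∷ [])

p13254 : Fin 5 → Fin 5
p13254 = pat (Fin.# 0 ∷ Fin.# 2 ∷ Fin.# 1 ∷ Fin.# 4 ∷ Fin.# 3 ∷ [])

{-# OPTIONS --safe #-}
-- (⇒) Let v be the one-line notation of w. The lowest degree part of 𝔊_w is the
-- Schubert polynomial 𝔖_w. By the braid relation it satisfies
-- 𝔖_w = ∂ᵢ 𝔖_{w sᵢ} at every ascent i, not only the first one, so it is symmetric
-- in the variables i, i+1 at each ascent. If α is an exponent with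
-- αᵢ₊₁ ≥ αᵢ + 2 at an ascent i, the segment from α to its transpose contains the
-- lattice point α + eᵢ − eᵢ₊₁, which is not a vertex. Such an α is either the
-- Lehmer code c, always an exponent, or it agrees with c before position i+1 and
-- exceeds it there; the latter exists whenever w has a 132 pattern starting at
-- position i+1. Walking from the entry 1 of a forbidden pattern to the next one
-- finds such an ascent.
-- (⇐) If w avoids the patterns, induction along first ascents shows that all
-- exponents of 𝔊_w lie in m + {0,1}ⁿ where m_k = min (v₀, …, v_k), and every
-- lattice point of a polytope inside a unit box is a vertex.
module Submission where

open import Defs
open import Data.Nat as ℕ using (ℕ; zero; suc)
import Data.Nat.Properties as ℕP
import Data.Nat.Coprimality as Coprime
open import Data.Integer as ℤ using (ℤ; 0ℤ; 1ℤ)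
import Data.Integer.Properties as ℤP
open import Data.Integer.Tactic.RingSolver using (solve-∀)
open import Data.Rational as ℚ using (ℚ; 0ℚ; 1ℚ; mkℚ; _/_)
import Data.Rational.Properties as ℚP
open import Data.Rational.Solver using (module +-*-Solver)
open import Data.Bool using (true; false; _∧_; if_then_else_)
open import Data.Bool.Properties using (∧-comm; ∧-zeroʳ)
open import Data.Fin as Fin using (Fin; zero; suc; toℕ; fromℕ<; #_)
import Data.Fin.Properties as FinP
open import Data.Fin.Permutation using (Permutation′; _⟨$⟩ʳ_; _⟨$⟩ˡ_; transpose; _∘ₚ_; inverseʳ; inverseˡ)
import Data.Fin.Permutation.Components as PC
open import Data.Maybe using (Maybe; just; nothing)
open import Data.Vec as Vec using (Vec; []; _∷_; tabulate)
import Data.Vec.Properties as VecP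
open import Data.Vec.Properties using (≡-dec; ∷-injectiveˡ; ∷-injectiveʳ; tabulate-cong)
open import Data.Vec.Membership.Propositional using (_∈_)
open import Data.Vec.Membership.Propositional.Properties using (∈-tabulate⁺)
import Data.Vec.Relation.Unary.Any as VAny
open import Data.Vec.Relation.Unary.All as VAll using ([]; _∷_)
import Data.Vec.Relation.Unary.All.Properties as VAllP
open import Data.Vec.Relation.Unary.AllPairs using ([]; _∷_)
open import Data.Vec.Relation.Unary.Linked using (Linked; [-]; _∷_)
open import Data.Vec.Relation.Unary.Linked.Properties using (lookup⁺)
open import Data.Vec.Relation.Unary.Unique.Propositional using (Unique)
open import Data.Vec.Relation.Unary.Unique.Propositional.Properties using (tabulate⁺)
open import Data.List as List using (List; []; _∷_; _++_; upTo; applyUpTo)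
import Data.List.Properties as ListP
open import Data.List.Relation.Unary.All as LAll using (All; []; _∷_)
import Data.List.Relation.Unary.All.Properties as LAllP
open import Data.Product using (∃-syntax; _×_; _,_; proj₁; proj₂; map₂)
open import Data.Sum using (_⊎_; inj₁; inj₂)
open import Data.Unit using (⊤; tt)
open import Data.Empty using (⊥; ⊥-elim)
open import Function using (_∘_; id)
open import Relation.Binary.Definitions using (tri<; tri≈; tri>)
open import Relation.Nullary
open import Relation.Nullary.Decidable using (dec-true; dec-false; toWitness)
open import Relation.Binary.PropositionalEquality

-- The recursion for 𝔊_w fixes the first ascent, but the code is visibly the extreme exponent of 𝔖_w
-- only at the last ascent, and symmetry is wanted at all of them. Schubert polynomials are
-- therefore a relation that admits any ascent at each step, with uniqueness proved afterwards. They
-- are coefficient functions ℕⁿ → ℤ instead of term lists: like terms are already collected, and the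
-- braid relation becomes an identity of functions. They meet the term lists only in lowest degree,
-- where the factor 1 - xᵢ₊₁ has no effect. That an exponent really occurs has to survive
-- cancellation. Two tools secure this: symmetry, and the fact that among all exponents of 𝔖_w the
-- code has the largest tail sums. The other direction only bounds exponents, so it can treat every
-- listed term, cancelled or not. The unit box alone does not pass through ∂ᵢ: where the running
-- minimum drops by two, an exponent at the upper face would leave the new box. Hence the induction
-- also records when the upper face can be reached.

module DividedDifferences where

  open import Data.Integer using (-_; _+_; _-_)

  -- Divided differences on coefficient functions

  δ : (ℕ → ℕ → ℤ) → ℕ → ℕ → ℤ
  δ f p q = f p q - f q p

  -- The coefficient of x^(p+1) y^q in (x - y) · `d f` = f - s f gives this recursion. It lowers the
  -- exponent of y, so it ends for every coefficient function, finitely supported or not.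
  d : (ℕ → ℕ → ℤ) → ℕ → ℕ → ℤ
  d f p zero    = δ f (suc p) 0
  d f p (suc q) = δ f (suc p) (suc q) + d f (suc p) q

  δ-cong : ∀ {f g} → (∀ p q → f p q ≡ g p q) → ∀ p q → δ f p q ≡ δ g p q
  δ-cong e p q = cong₂ _-_ (e p q) (e q p)

  d-cong : ∀ {f g} → (∀ p q → f p q ≡ g p q) → ∀ p q → d f p q ≡ d g p q
  d-cong e p zero    = δ-cong e (suc p) 0
  d-cong e p (suc q) = cong₂ _+_ (δ-cong e (suc p) (suc q)) (d-cong e (suc p) q)

  d-zero : ∀ p q → d (λ _ _ → 0ℤ) p q ≡ 0ℤ
  d-zero p zero    = refl
  d-zero p (suc q) = cong (0ℤ +_) (d-zero (suc p) q)

  d-+ : ∀ f g p q → d (λ a b → f a b + g a b) p q ≡ d f p q + d g p q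
  d-+ f g p zero    = lem (f (suc p) 0) (g (suc p) 0) (f 0 (suc p)) (g 0 (suc p))
    where lem : ∀ a b c e → (a + b) - (c + e) ≡ (a - c) + (b - e)
          lem = solve-∀
  d-+ f g p (suc q) = trans (cong (δ (λ a b → f a b + g a b) (suc p) (suc q) +_) (d-+ f g (suc p) q))
    (lem (f (suc p) (suc q)) (g (suc p) (suc q)) (f (suc q) (suc p)) (g (suc q) (suc p)) (d f (suc p) q) (d g (suc p) q))
    where lem : ∀ a b c e x y → ((a + b) - (c + e)) + (x + y) ≡ ((a - c) + x) + ((b - e) + y)
          lem = solve-∀

  d-neg : ∀ f p q → d (λ a b → - f a b) p q ≡ - d f p q
  d-neg f p zero    = lem (f (suc p) 0) (f 0 (suc p))
    where lem : ∀ a b → - a - - b ≡ - (a - b)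
          lem = solve-∀
  d-neg f p (suc q) = trans (cong (δ (λ a b → - f a b) (suc p) (suc q) +_) (d-neg f (suc p) q))
    (lem (f (suc p) (suc q)) (f (suc q) (suc p)) (d f (suc p) q))
    where lem : ∀ a b c → (- a - - b) + - c ≡ - ((a - b) + c)
          lem = solve-∀

  private
    skew : (ℕ → ℕ → ℤ) → ℕ → ℕ → ℤ
    skew f p q = d f p q - d f q p

    skew-shift : ∀ f p q → skew f p (suc q) ≡ skew f (suc p) q
    skew-shift f p q = lem (f (suc p) (suc q)) (f (suc q) (suc p)) (d f (suc p) q) (d f (suc q) p)
      where lem : ∀ a b x y → (a - b) + x - y ≡ x - ((b - a) + y)
            lem = solve-∀

    skew-shift* : ∀ f p q → skew f p q ≡ skew f (q ℕ.+ p) 0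
    skew-shift* f p zero    = refl
    skew-shift* f p (suc q) = trans (skew-shift f p q) (trans (skew-shift* f (suc p) q) (cong (λ m → skew f m 0) (+-suc q p)))
      where open import Data.Nat.Properties using (+-suc)

    skew-const : ∀ f p q → skew f p q ≡ skew f q p
    skew-const f p q = trans (skew-shift* f p q) (trans (cong (λ m → skew f m 0) (+-comm q p)) (sym (skew-shift* f q p)))
      where open import Data.Nat.Properties using (+-comm)

    double-zero : ∀ x → x ≡ - x → x ≡ 0ℤ
    double-zero (ℤ.+ zero)  _ = refl
    double-zero (ℤ.+ suc n) ()
    double-zero (ℤ.-[1+ n ]) ()

  -- `skew f p q` depends only on p + q, so it equals `skew f q p`, which is its own negative; ℤ has
  -- no 2-torsion.
  d-sym : ∀ f p q → d f p q ≡ d f q p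
  d-sym f p q = ℤP.i-j≡0⇒i≡j _ _ (double-zero _ (trans (skew-const f p q) (lem (d f q p) (d f p q))))
    where lem : ∀ x y → x - y ≡ - (y - x)
          lem = solve-∀

  -- Adjacent swaps of words and divided differences in n variables

  swp : ∀ {n} → ℕ → Vec ℕ n → Vec ℕ n
  swp i       []          = []
  swp zero    (x ∷ [])    = x ∷ []
  swp zero    (x ∷ y ∷ v) = y ∷ x ∷ v
  swp (suc i) (x ∷ v)     = x ∷ swp i v

  swp-invol : ∀ {n} i (v : Vec ℕ n) → swp i (swp i v) ≡ v
  swp-invol i       []          = refl
  swp-invol zero    (x ∷ [])    = refl
  swp-invol zero    (x ∷ y ∷ v) = refl
  swp-invol (suc i) (x ∷ v)     = cong (x ∷_) (swp-invol i v)

  swp-comm : ∀ {n} i k (v : Vec ℕ n) → swp i (swp (suc (suc (i ℕ.+ k))) v) ≡ swp (suc (suc (i ℕ.+ k))) (swp i v)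
  swp-comm i       k []          = refl
  swp-comm zero    k (x ∷ [])    = refl
  swp-comm zero    k (x ∷ y ∷ v) = refl
  swp-comm (suc i) k (x ∷ v)     = cong (x ∷_) (swp-comm i k v)

  data Asc : ∀ {n} → ℕ → Vec ℕ n → Set where
    here  : ∀ {n x y} {v : Vec ℕ n} → x ℕ.< y → Asc 0 (x ∷ y ∷ v)
    there : ∀ {n i x} {v : Vec ℕ n} → Asc i v → Asc (suc i) (x ∷ v)

  -- The ascent guarantees three entries from position i on. Out of range `swp` is the identity, and
  -- with two entries the sides would differ.
  swp-braid : ∀ {n i} {v : Vec ℕ n} → Asc (suc i) v →
              swp i (swp (suc i) (swp i v)) ≡ swp (suc i) (swp i (swp (suc i) v))
  swp-braid {i = zero}  (there (here _)) = refl
  swp-braid {i = suc i} (there {x = x} a) = cong (x ∷_) (swp-braid a)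

  Ser : ℕ → Set
  Ser n = Vec ℕ n → ℤ

  -- The value out of range is 0, which lets `D-comm` and `D-braid` hold without a range condition.
  D : ∀ {n} → ℕ → Ser n → Ser n
  D i       f []          = 0ℤ
  D zero    f (x ∷ [])    = 0ℤ
  D zero    f (x ∷ y ∷ v) = d (λ p q → f (p ∷ q ∷ v)) x y
  D (suc i) f (x ∷ v)     = D i (λ u → f (x ∷ u)) v

  D-cong : ∀ {n} i {f g : Ser n} → f ≗ g → D i f ≗ D i g
  D-cong i       e []          = refl
  D-cong zero    e (x ∷ [])    = refl
  D-cong zero    e (x ∷ y ∷ v) = d-cong (λ p q → e (p ∷ q ∷ v)) x y
  D-cong (suc i) e (x ∷ v)     = D-cong i (λ u → e (x ∷ u)) v

  D-+ : ∀ {n} i (f g : Ser n) v → D i (λ u → f u + g u) v ≡ D i f v + D i g v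
  D-+ i       f g []          = refl
  D-+ zero    f g (x ∷ [])    = refl
  D-+ zero    f g (x ∷ y ∷ v) = d-+ _ _ x y
  D-+ (suc i) f g (x ∷ v)     = D-+ i _ _ v

  D-neg : ∀ {n} i (f : Ser n) v → D i (λ u → - f u) v ≡ - D i f v
  D-neg i       f []          = refl
  D-neg zero    f (x ∷ [])    = refl
  D-neg zero    f (x ∷ y ∷ v) = d-neg _ x y
  D-neg (suc i) f (x ∷ v)     = D-neg i _ v

  D-zero : ∀ {n} i (v : Vec ℕ n) → D i (λ _ → 0ℤ) v ≡ 0ℤ
  D-zero i       []          = refl
  D-zero zero    (x ∷ [])    = refl
  D-zero zero    (x ∷ y ∷ v) = d-zero x y
  D-zero (suc i) (x ∷ v)     = D-zero i v

  D-- : ∀ {n} i (f g : Ser n) v → D i (λ u → f u - g u) v ≡ D i f v - D i g v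
  D-- i f g v = trans (D-+ i f (λ u → - g u) v) (cong (λ z → D i f v + z) (D-neg i g v))

  D-swp : ∀ {n} i (f : Ser n) v → D i f (swp i v) ≡ D i f v
  D-swp i       f []          = refl
  D-swp zero    f (x ∷ [])    = refl
  D-swp zero    f (x ∷ y ∷ v) = d-sym _ y x
  D-swp (suc i) f (x ∷ v)     = D-swp i _ v

  D-d : ∀ {n} i (f : ℕ → ℕ → Ser n) p q v → D i (λ u → d (λ a b → f a b u) p q) v ≡ d (λ a b → D i (f a b) v) p q
  D-d i f p zero    v = D-- i _ _ v
  D-d i f p (suc q) v = trans (D-+ i _ _ v) (cong₂ _+_ (D-- i _ _ v) (D-d i f (suc p) q v))

  D-comm : ∀ {n} i k (f : Ser n) → D i (D (suc (suc (i ℕ.+ k))) f) ≗ D (suc (suc (i ℕ.+ k))) (D i f)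
  D-comm i       k f []          = refl
  D-comm zero    k f (x ∷ [])    = sym (D-zero (suc k) [])
  D-comm zero    k f (x ∷ y ∷ v) = sym (D-d k (λ p q u → f (p ∷ q ∷ u)) x y v)
  D-comm (suc i) k f (x ∷ v)     = D-comm i k (λ u → f (x ∷ u)) v

  -- The braid relation: both sides become the antisymmetrization of F after
  -- multiplication by the Vandermonde product of three variables, which is
  -- injective.
  private
    F3 : Set
    F3 = ℕ → ℕ → ℕ → ℤ

    x₁ x₂ x₃ : F3 → F3
    x₁ F zero    q r = 0ℤ
    x₁ F (suc p) q r = F p q r
    x₂ F p zero    r = 0ℤ
    x₂ F p (suc q) r = F p q r
    x₃ F p q zero    = 0ℤ
    x₃ F p q (suc r) = F p q r

    infix 4 _≐_
    _≐_ : F3 → F3 → Set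
    F ≐ G = ∀ p q r → F p q r ≡ G p q r

    A B C d₁ d₂ s₁ s₂ : F3 → F3
    A F p q r = x₁ F p q r - x₂ F p q r
    B F p q r = x₂ F p q r - x₃ F p q r
    C F p q r = x₁ F p q r - x₃ F p q r
    d₁ F p q r = d (λ a b → F a b r) p q
    d₂ F p q r = d (λ a b → F p a b) q r
    s₁ F p q r = F q p r
    s₂ F p q r = F p r q

    _⊖_ : F3 → F3 → F3
    (F ⊖ G) p q r = F p q r - G p q r

    x₁-cong : ∀ {F G} → F ≐ G → x₁ F ≐ x₁ G
    x₁-cong e zero    q r = refl
    x₁-cong e (suc p) q r = e p q r
    x₂-cong : ∀ {F G} → F ≐ G → x₂ F ≐ x₂ G
    x₂-cong e p zero    r = refl
    x₂-cong e p (suc q) r = e p q r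
    x₃-cong : ∀ {F G} → F ≐ G → x₃ F ≐ x₃ G
    x₃-cong e p q zero    = refl
    x₃-cong e p q (suc r) = e p q r

    A-cong : ∀ {F G} → F ≐ G → A F ≐ A G
    A-cong e p q r = cong₂ _-_ (x₁-cong e p q r) (x₂-cong e p q r)
    B-cong : ∀ {F G} → F ≐ G → B F ≐ B G
    B-cong e p q r = cong₂ _-_ (x₂-cong e p q r) (x₃-cong e p q r)
    C-cong : ∀ {F G} → F ≐ G → C F ≐ C G
    C-cong e p q r = cong₂ _-_ (x₁-cong e p q r) (x₃-cong e p q r)

    x₁-⊖ : ∀ F G → x₁ (F ⊖ G) ≐ x₁ F ⊖ x₁ G
    x₁-⊖ F G zero    q r = refl
    x₁-⊖ F G (suc p) q r = refl
    x₂-⊖ : ∀ F G → x₂ (F ⊖ G) ≐ x₂ F ⊖ x₂ G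
    x₂-⊖ F G p zero    r = refl
    x₂-⊖ F G p (suc q) r = refl
    x₃-⊖ : ∀ F G → x₃ (F ⊖ G) ≐ x₃ F ⊖ x₃ G
    x₃-⊖ F G p q zero    = refl
    x₃-⊖ F G p q (suc r) = refl

    exch : ∀ a b c e → (a - b) - (c - e) ≡ (a - c) - (b - e)
    exch = solve-∀

    A-⊖ : ∀ F G → A (F ⊖ G) ≐ A F ⊖ A G
    A-⊖ F G p q r = trans (cong₂ _-_ (x₁-⊖ F G p q r) (x₂-⊖ F G p q r))
                              (exch (x₁ F p q r) (x₁ G p q r) (x₂ F p q r) (x₂ G p q r))
    B-⊖ : ∀ F G → B (F ⊖ G) ≐ B F ⊖ B G
    B-⊖ F G p q r = trans (cong₂ _-_ (x₂-⊖ F G p q r) (x₃-⊖ F G p q r))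
                              (exch (x₂ F p q r) (x₂ G p q r) (x₃ F p q r) (x₃ G p q r))
    C-⊖ : ∀ F G → C (F ⊖ G) ≐ C F ⊖ C G
    C-⊖ F G p q r = trans (cong₂ _-_ (x₁-⊖ F G p q r) (x₃-⊖ F G p q r))
                              (exch (x₁ F p q r) (x₁ G p q r) (x₃ F p q r) (x₃ G p q r))

    x₁x₂ : ∀ F → x₁ (x₂ F) ≐ x₂ (x₁ F)
    x₁x₂ F zero zero r = refl
    x₁x₂ F zero (suc q) r = refl
    x₁x₂ F (suc p) zero r = refl
    x₁x₂ F (suc p) (suc q) r = refl
    x₁x₃ : ∀ F → x₁ (x₃ F) ≐ x₃ (x₁ F)
    x₁x₃ F zero q zero = refl
    x₁x₃ F zero q (suc r) = refl
    x₁x₃ F (suc p) q zero = refl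
    x₁x₃ F (suc p) q (suc r) = refl
    x₂x₃ : ∀ F → x₂ (x₃ F) ≐ x₃ (x₂ F)
    x₂x₃ F p zero zero = refl
    x₂x₃ F p zero (suc r) = refl
    x₂x₃ F p (suc q) zero = refl
    x₂x₃ F p (suc q) (suc r) = refl

    AB : ∀ F → A (B F) ≐ B (A F)
    AB F p q r = begin
      A (B F) p q r
        ≡⟨ cong₂ _-_ (x₁-⊖ (x₂ F) (x₃ F) p q r) (x₂-⊖ (x₂ F) (x₃ F) p q r) ⟩
      (x₁ (x₂ F) p q r - x₁ (x₃ F) p q r) - (x₂ (x₂ F) p q r - x₂ (x₃ F) p q r)
        ≡⟨ cong₂ _-_ (cong₂ _-_ (x₁x₂ F p q r) (x₁x₃ F p q r)) (cong (λ z → x₂ (x₂ F) p q r - z) (x₂x₃ F p q r)) ⟩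
      (x₂ (x₁ F) p q r - x₃ (x₁ F) p q r) - (x₂ (x₂ F) p q r - x₃ (x₂ F) p q r)
        ≡⟨ exch (x₂ (x₁ F) p q r) _ _ _ ⟩
      (x₂ (x₁ F) p q r - x₂ (x₂ F) p q r) - (x₃ (x₁ F) p q r - x₃ (x₂ F) p q r)
        ≡⟨ cong₂ _-_ (x₂-⊖ (x₁ F) (x₂ F) p q r) (x₃-⊖ (x₁ F) (x₂ F) p q r) ⟨
      B (A F) p q r ∎
      where open ≡-Reasoning
    BC : ∀ F → B (C F) ≐ C (B F)
    BC F p q r = begin
      B (C F) p q r
        ≡⟨ cong₂ _-_ (x₂-⊖ (x₁ F) (x₃ F) p q r) (x₃-⊖ (x₁ F) (x₃ F) p q r) ⟩
      (x₂ (x₁ F) p q r - x₂ (x₃ F) p q r) - (x₃ (x₁ F) p q r - x₃ (x₃ F) p q r)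
        ≡⟨ cong₂ _-_ (cong₂ _-_ (sym (x₁x₂ F p q r)) (x₂x₃ F p q r)) (cong (_- x₃ (x₃ F) p q r) (sym (x₁x₃ F p q r))) ⟩
      (x₁ (x₂ F) p q r - x₃ (x₂ F) p q r) - (x₁ (x₃ F) p q r - x₃ (x₃ F) p q r)
        ≡⟨ exch (x₁ (x₂ F) p q r) _ _ _ ⟩
      (x₁ (x₂ F) p q r - x₁ (x₃ F) p q r) - (x₃ (x₂ F) p q r - x₃ (x₃ F) p q r)
        ≡⟨ cong₂ _-_ (x₁-⊖ (x₂ F) (x₃ F) p q r) (x₃-⊖ (x₂ F) (x₃ F) p q r) ⟨
      C (B F) p q r ∎
      where open ≡-Reasoning
    AC : ∀ F → A (C F) ≐ C (A F)
    AC F p q r = begin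
      A (C F) p q r
        ≡⟨ cong₂ _-_ (x₁-⊖ (x₁ F) (x₃ F) p q r) (x₂-⊖ (x₁ F) (x₃ F) p q r) ⟩
      (x₁ (x₁ F) p q r - x₁ (x₃ F) p q r) - (x₂ (x₁ F) p q r - x₂ (x₃ F) p q r)
        ≡⟨ cong₂ _-_ (cong (λ z → x₁ (x₁ F) p q r - z) (x₁x₃ F p q r)) (cong₂ _-_ (sym (x₁x₂ F p q r)) (x₂x₃ F p q r)) ⟩
      (x₁ (x₁ F) p q r - x₃ (x₁ F) p q r) - (x₁ (x₂ F) p q r - x₃ (x₂ F) p q r)
        ≡⟨ exch (x₁ (x₁ F) p q r) _ _ _ ⟩
      (x₁ (x₁ F) p q r - x₁ (x₂ F) p q r) - (x₃ (x₁ F) p q r - x₃ (x₂ F) p q r)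
        ≡⟨ cong₂ _-_ (x₁-⊖ (x₁ F) (x₂ F) p q r) (x₃-⊖ (x₁ F) (x₂ F) p q r) ⟨
      C (A F) p q r ∎
      where open ≡-Reasoning

    A-d₁ : ∀ F → A (d₁ F) ≐ F ⊖ s₁ F
    A-d₁ F zero    zero    r = sym (ℤP.+-inverseʳ (F 0 0 r))
    A-d₁ F zero    (suc q) r = trans (cong (λ z → 0ℤ - z) (d-sym (λ a b → F a b r) 0 q)) (lem (F (suc q) 0 r) (F 0 (suc q) r))
      where lem : ∀ x y → 0ℤ - (x - y) ≡ y - x
            lem = solve-∀
    A-d₁ F (suc p) zero    r = ℤP.+-identityʳ _
    A-d₁ F (suc p) (suc q) r = lem (F (suc p) (suc q) r - F (suc q) (suc p) r) (d (λ a b → F a b r) (suc p) q)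
      where lem : ∀ x y → (x + y) - y ≡ x
            lem = solve-∀

    B-d₂ : ∀ F → B (d₂ F) ≐ F ⊖ s₂ F
    B-d₂ F p q r = trans (flip q r) (A-d₁ (λ a b _ → F p a b) q r 0)
      where
      flip : ∀ q r → B (d₂ F) p q r ≡ A (d₁ (λ a b _ → F p a b)) q r 0
      flip zero    zero    = refl
      flip zero    (suc r) = refl
      flip (suc q) zero    = refl
      flip (suc q) (suc r) = refl

    -- Comparing coefficients gives F p (q+1) r = F (p+1) q r, which descends to q = 0, where F p 0
    -- r = 0. Finite support is not assumed.
    A-inj : ∀ F → A F ≐ (λ _ _ _ → 0ℤ) → F ≐ (λ _ _ _ → 0ℤ)
    A-inj F e p zero    r = trans (sym (ℤP.+-identityʳ _)) (e (suc p) 0 r)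
    A-inj F e p (suc q) r = trans (ℤP.i-j≡0⇒i≡j _ _ (e (suc p) (suc q) r)) (A-inj F e (suc p) q r)
    B-inj : ∀ F → B F ≐ (λ _ _ _ → 0ℤ) → F ≐ (λ _ _ _ → 0ℤ)
    B-inj F e p q zero    = trans (sym (ℤP.+-identityʳ _)) (e p (suc q) 0)
    B-inj F e p q (suc r) = trans (ℤP.i-j≡0⇒i≡j _ _ (e p (suc q) (suc r))) (B-inj F e p (suc q) r)
    C-inj : ∀ F → C F ≐ (λ _ _ _ → 0ℤ) → F ≐ (λ _ _ _ → 0ℤ)
    C-inj F e p q zero    = trans (sym (ℤP.+-identityʳ _)) (e (suc p) q 0)
    C-inj F e p q (suc r) = trans (ℤP.i-j≡0⇒i≡j _ _ (e (suc p) q (suc r))) (C-inj F e (suc p) q r)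

    B-s₁ : ∀ F → B (s₁ F) ≐ s₁ (C F)
    B-s₁ F p zero    zero    = refl
    B-s₁ F p zero    (suc r) = refl
    B-s₁ F p (suc q) zero    = refl
    B-s₁ F p (suc q) (suc r) = refl
    C-s₁ : ∀ F → C (s₁ F) ≐ s₁ (B F)
    C-s₁ F zero    q zero    = refl
    C-s₁ F zero    q (suc r) = refl
    C-s₁ F (suc p) q zero    = refl
    C-s₁ F (suc p) q (suc r) = refl
    C-s₂ : ∀ F → C (s₂ F) ≐ s₂ (A F)
    C-s₂ F zero    q zero    = refl
    C-s₂ F zero    q (suc r) = refl
    C-s₂ F (suc p) q zero    = refl
    C-s₂ F (suc p) q (suc r) = refl
    A-s₂ : ∀ F → A (s₂ F) ≐ s₂ (C F)
    A-s₂ F zero    zero    r = refl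
    A-s₂ F zero    (suc q) r = refl
    A-s₂ F (suc p) zero    r = refl
    A-s₂ F (suc p) (suc q) r = refl

    -- A cancels the outer `d₁` and B the `d₂`. By symmetry of the inner `d₁ F`, what remains in
    -- front of it is (x₁ - x₃) - (x₂ - x₃) = x₁ - x₂, which cancels it too.
    CBA-left : ∀ F → C (B (A (d₁ (d₂ (d₁ F))))) ≐ λ p q r → ((F p q r - F q p r) - (F p r q - F r p q)) + (F q r p - F r q p)
    CBA-left F p q r = begin
      C (B (A (d₁ h))) p q r
        ≡⟨ C-cong (λ a b c → trans (B-cong (A-d₁ h) a b c) (B-⊖ h (s₁ h) a b c)) p q r ⟩
      C (B h ⊖ B (s₁ h)) p q r
        ≡⟨ C-⊖ (B h) (B (s₁ h)) p q r ⟩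
      C (B h) p q r - C (B (s₁ h)) p q r
        ≡⟨ cong₂ _-_ (step h≡ p q r) (trans (C-cong (B-s₁ h) p q r) (trans (C-s₁ (C h) p q r) (trans (BC h q p r) (step h≡ q p r)))) ⟩
      (C k p q r - C (s₂ k) p q r) - (C k q p r - C (s₂ k) q p r)
        ≡⟨ cong₂ _-_ (cong (λ z → C k p q r - z) (trans (C-s₂ k p q r) (A-d₁ F p r q))) (cong₂ _-_ C≡B (trans (C-s₂ k q p r) (A-d₁ F q r p))) ⟩
      (C k p q r - (F p r q - F r p q)) - (B k p q r - (F q r p - F r q p))
        ≡⟨ regroup (x₁ k p q r) (x₂ k p q r) (x₃ k p q r) _ _ ⟩
      (A k p q r - (F p r q - F r p q)) + (F q r p - F r q p)
        ≡⟨ cong (λ z → (z - (F p r q - F r p q)) + (F q r p - F r q p)) (A-d₁ F p q r) ⟩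
      ((F p q r - F q p r) - (F p r q - F r p q)) + (F q r p - F r q p) ∎
      where
      open ≡-Reasoning
      k = d₁ F
      h = d₂ k
      h≡ : B h ≐ k ⊖ s₂ k
      h≡ = B-d₂ k
      step : ∀ {G} → G ≐ k ⊖ s₂ k → C G ≐ C k ⊖ C (s₂ k)
      step e a b c = trans (C-cong e a b c) (C-⊖ k (s₂ k) a b c)
      C≡B : C k q p r ≡ B k p q r
      C≡B = trans (sym (B-s₁ k p q r)) (B-cong (λ a b c → d-sym (λ x y → F x y c) b a) p q r)
      regroup : ∀ a b c u v → ((a - c) - u) - ((b - c) - v) ≡ ((a - b) - u) + v
      regroup = solve-∀

    CAB-right : ∀ F → C (A (B (d₂ (d₁ (d₂ F))))) ≐ λ p q r → ((F p q r - F p r q) - (F q p r - F q r p)) + (F r p q - F r q p)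
    CAB-right F p q r = begin
      C (A (B (d₂ h))) p q r
        ≡⟨ C-cong (λ a b c → trans (A-cong (B-d₂ h) a b c) (A-⊖ h (s₂ h) a b c)) p q r ⟩
      C (A h ⊖ A (s₂ h)) p q r
        ≡⟨ C-⊖ (A h) (A (s₂ h)) p q r ⟩
      C (A h) p q r - C (A (s₂ h)) p q r
        ≡⟨ cong₂ _-_ (step h≡ p q r) (trans (C-cong (A-s₂ h) p q r) (trans (C-s₂ (C h) p q r) (trans (AC h p r q) (step h≡ p r q)))) ⟩
      (C k p q r - C (s₁ k) p q r) - (C k p r q - C (s₁ k) p r q)
        ≡⟨ cong₂ _-_ (cong (λ z → C k p q r - z) (trans (C-s₁ k p q r) (B-d₂ F q p r))) (cong₂ _-_ C≡A (trans (C-s₁ k p r q) (B-d₂ F r p q))) ⟩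
      (C k p q r - (F q p r - F q r p)) - (A k p q r - (F r p q - F r q p))
        ≡⟨ regroup (x₁ k p q r) (x₂ k p q r) (x₃ k p q r) _ _ ⟩
      (B k p q r - (F q p r - F q r p)) + (F r p q - F r q p)
        ≡⟨ cong (λ z → (z - (F q p r - F q r p)) + (F r p q - F r q p)) (B-d₂ F p q r) ⟩
      ((F p q r - F p r q) - (F q p r - F q r p)) + (F r p q - F r q p) ∎
      where
      open ≡-Reasoning
      k = d₂ F
      h = d₁ k
      h≡ : A h ≐ k ⊖ s₁ k
      h≡ = A-d₁ k
      step : ∀ {G} → G ≐ k ⊖ s₁ k → C G ≐ C k ⊖ C (s₁ k)
      step e a b c = trans (C-cong e a b c) (C-⊖ k (s₁ k) a b c)
      C≡A : C k p r q ≡ A k p q r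
      C≡A = trans (sym (A-s₂ k p q r)) (A-cong (λ a b c → d-sym (λ x y → F a x y) c b) p q r)
      regroup : ∀ a b c u v → ((a - c) - u) - ((a - b) - v) ≡ ((b - c) - u) + v
      regroup = solve-∀

  d-braid : ∀ F → d₁ (d₂ (d₁ F)) ≐ d₂ (d₁ (d₂ F))
  d-braid F p q r = ℤP.i-j≡0⇒i≡j _ _ (A-inj K (B-inj (A K) (C-inj (B (A K)) vanish)) p q r)
    where
    open ≡-Reasoning
    K₁ K₂ K : F3
    K₁ = d₁ (d₂ (d₁ F))
    K₂ = d₂ (d₁ (d₂ F))
    K  = K₁ ⊖ K₂
    expand : C (B (A K)) ≐ C (B (A K₁)) ⊖ C (B (A K₂))
    expand a b c = trans (C-cong (λ x y z → trans (B-cong (A-⊖ K₁ K₂) x y z) (B-⊖ (A K₁) (A K₂) x y z)) a b c)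
                         (C-⊖ (B (A K₁)) (B (A K₂)) a b c)
    cancel : ∀ a b c e f g → (((a - b) - (c - e)) + (f - g)) - (((a - c) - (b - f)) + (e - g)) ≡ 0ℤ
    cancel = solve-∀
    vanish : C (B (A K)) ≐ λ _ _ _ → 0ℤ
    vanish a b c = begin
      C (B (A K)) a b c
        ≡⟨ expand a b c ⟩
      C (B (A K₁)) a b c - C (B (A K₂)) a b c
        ≡⟨ cong₂ _-_ (CBA-left F a b c) (trans (C-cong (λ x y z → sym (AB K₂ x y z)) a b c) (CAB-right F a b c)) ⟩
      _
        ≡⟨ cancel (F a b c) _ _ _ _ _ ⟩
      0ℤ ∎

  D-braid : ∀ {n} i (f : Ser n) → D i (D (suc i) (D i f)) ≗ D (suc i) (D i (D (suc i) f))
  D-braid i       f []              = refl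
  D-braid zero    f (x ∷ [])        = refl
  D-braid zero    f (x ∷ y ∷ [])    = d-zero x y
  D-braid zero    f (x ∷ y ∷ z ∷ v) = d-braid (λ p q r → f (p ∷ q ∷ r ∷ v)) x y z
  D-braid (suc i) f (x ∷ v)         = D-braid i (λ u → f (x ∷ u)) v

open DividedDifferences
open import Data.Nat using (_+_; _*_; _∸_; _⊓_; _≤_; _<_; z≤n; s≤s; s≤s⁻¹; _≡ᵇ_)

-- Non-inversions, Lehmer code and ascents of a word

ind : ℕ → ℕ → ℕ
ind x y with x ℕ.<? y
... | yes _ = 1
... | no  _ = 0

ind-yes : ∀ {x y} → x < y → ind x y ≡ 1
ind-yes {x} {y} h with x ℕ.<? y
... | yes _ = refl
... | no ¬h = contradiction h ¬h

ind-no : ∀ {x y} → ¬ x < y → ind x y ≡ 0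
ind-no {x} {y} ¬h with x ℕ.<? y
... | yes h = contradiction h ¬h
... | no _ = refl

below above : ∀ {n} → ℕ → Vec ℕ n → ℕ
below a []      = 0
below a (x ∷ v) = ind x a ℕ.+ below a v
above a []      = 0
above a (x ∷ v) = ind a x ℕ.+ above a v

below-swp : ∀ {n} a i (v : Vec ℕ n) → below a (swp i v) ≡ below a v
below-swp a i       []          = refl
below-swp a zero    (x ∷ [])    = refl
below-swp a zero    (x ∷ y ∷ v) = begin
  ind y a + (ind x a + below a v) ≡⟨ ℕP.+-assoc (ind y a) _ _ ⟨
  ind y a + ind x a + below a v   ≡⟨ cong (_+ below a v) (ℕP.+-comm (ind y a) _) ⟩
  ind x a + ind y a + below a v   ≡⟨ ℕP.+-assoc (ind x a) _ _ ⟩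
  ind x a + (ind y a + below a v) ∎
  where open ≡-Reasoning
below-swp a (suc i) (x ∷ v)     = cong (ind x a ℕ.+_) (below-swp a i v)

above-swp : ∀ {n} a i (v : Vec ℕ n) → above a (swp i v) ≡ above a v
above-swp a i       []          = refl
above-swp a zero    (x ∷ [])    = refl
above-swp a zero    (x ∷ y ∷ v) = begin
  ind a y + (ind a x + above a v) ≡⟨ ℕP.+-assoc (ind a y) _ _ ⟨
  ind a y + ind a x + above a v   ≡⟨ cong (_+ above a v) (ℕP.+-comm (ind a y) _) ⟩
  ind a x + ind a y + above a v   ≡⟨ ℕP.+-assoc (ind a x) _ _ ⟩
  ind a x + (ind a y + above a v) ∎
  where open ≡-Reasoning
above-swp a (suc i) (x ∷ v)     = cong (ind a x ℕ.+_) (above-swp a i v)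

-- Counts all non-inversions, not only the ascents. A swap at an ascent removes exactly one, so this
-- is the distance to w₀ and the measure for every induction along ascents.
nasc : ∀ {n} → Vec ℕ n → ℕ
nasc []      = 0
nasc (x ∷ v) = above x v ℕ.+ nasc v

nasc-swp : ∀ {n i} {v : Vec ℕ n} → Asc i v → nasc v ≡ suc (nasc (swp i v))
nasc-swp (here {x = x} {y} {v} x<y) = begin
  (ind x y + above x v) + (above y v + nasc v)
    ≡⟨ cong (λ t → (t + above x v) + (above y v + nasc v)) (ind-yes x<y) ⟩
  suc (above x v + (above y v + nasc v))
    ≡⟨ cong suc (swap-left (above x v) (above y v) (nasc v)) ⟩
  suc (above y v + (above x v + nasc v))
    ≡⟨ cong (λ t → suc ((t + above y v) + (above x v + nasc v))) (ind-no (ℕP.<-asym x<y)) ⟨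
  suc ((ind y x + above y v) + (above x v + nasc v)) ∎
  where open ≡-Reasoning
        swap-left : ∀ a b c → a + (b + c) ≡ b + (a + c)
        swap-left a b c = trans (sym (ℕP.+-assoc a b c)) (trans (cong (_+ c) (ℕP.+-comm a b)) (ℕP.+-assoc b a c))
nasc-swp (there {i = i} {x} {v} a) =
  trans (cong₂ ℕ._+_ (sym (above-swp x i v)) (nasc-swp a)) (ℕP.+-suc (above x (swp i v)) _)

-- The Lehmer code.
code : ∀ {n} → Vec ℕ n → Vec ℕ n
code []      = []
code (x ∷ v) = below x v ∷ code v

rho : ∀ n → Vec ℕ n
rho zero    = []
rho (suc n) = n ∷ rho n

All-swp : ∀ {n} {P : ℕ → Set} i {v : Vec ℕ n} → VAll.All P v → VAll.All P (swp i v)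
All-swp i       []            = []
All-swp zero    (p ∷ [])      = p ∷ []
All-swp zero    (p ∷ q ∷ ps)  = q ∷ p ∷ ps
All-swp (suc i) (p ∷ ps)      = p ∷ All-swp i ps

Unique-swp : ∀ {n} i {v : Vec ℕ n} → Unique v → Unique (swp i v)
Unique-swp i       []                          = []
Unique-swp zero    (p ∷ [])                    = p ∷ []
Unique-swp zero    ((x≢y ∷ x∉) ∷ (y∉ ∷ u))     = ((λ e → x≢y (sym e)) ∷ y∉) ∷ (x∉ ∷ u)
Unique-swp (suc i) (p ∷ u)                     = All-swp i p ∷ Unique-swp i u

NoAscFrom : ∀ {n} → ℕ → Vec ℕ n → Set
NoAscFrom j v = ∀ i → j ≤ i → ¬ Asc i v

lastAsc : ∀ {n} (v : Vec ℕ n) → (∃[ i ] Asc i v × NoAscFrom (suc i) v) ⊎ NoAscFrom 0 v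
lastAsc []          = inj₂ λ { _ _ () }
lastAsc (x ∷ [])    = inj₂ λ { zero _ () ; (suc i) _ (there ()) }
lastAsc (x ∷ y ∷ v) with lastAsc (y ∷ v)
... | inj₁ (i , a , na) = inj₁ (suc i , there a , λ { (suc k) (s≤s h) (there b) → na k h b })
... | inj₂ na with x ℕ.<? y
...   | yes x<y = inj₁ (0 , here x<y , λ { (suc k) (s≤s _) (there b) → na k z≤n b })
...   | no  x≮y = inj₂ λ { zero _ (here x<y) → x≮y x<y ; (suc k) _ (there b) → na k z≤n b }

noAsc-below : ∀ {n x} {v : Vec ℕ n} → NoAscFrom 0 (x ∷ v) → Unique (x ∷ v) → VAll.All (_< x) v
noAsc-below {v = []}    na u = []
noAsc-below {x = x} {v = y ∷ v} na ((x≢y ∷ _) ∷ u) =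
  y<x ∷ VAll.map (λ z<y → ℕP.<-trans z<y y<x) (noAsc-below (λ i _ a → na (suc i) z≤n (there a)) u)
  where y<x = ℕP.≤∧≢⇒< (ℕP.≮⇒≥ (λ h → na 0 z≤n (here h))) (λ e → x≢y (sym e))

below-all : ∀ {n x} {v : Vec ℕ n} → VAll.All (_< x) v → below x v ≡ n
below-all []       = refl
below-all (p ∷ ps) = cong₂ ℕ._+_ (ind-yes p) (below-all ps)

code-noAsc : ∀ {n} {v : Vec ℕ n} → NoAscFrom 0 v → Unique v → code v ≡ rho n
code-noAsc {v = []}    na u = refl
code-noAsc {v = x ∷ v} na u@(_ ∷ u′) =
  cong₂ _∷_ (below-all (noAsc-below na u)) (code-noAsc (λ i _ a → na (suc i) z≤n (there a)) u′)

-- Schubert series, generated by divided differences along arbitrary ascents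

data IsS {n} : Vec ℕ n → Ser n → Set where
  top  : ∀ {v} → NoAscFrom 0 v → IsS v (coeff ((1ℤ , rho n) ∷ []))
  step : ∀ {v i f} → Asc i v → IsS (swp i v) f → IsS v (D i f)

schubert-bounded : ∀ {n} k (v : Vec ℕ n) → nasc v ≤ k → ∃[ f ] IsS v f
schubert-bounded k v h with lastAsc v
... | inj₂ na = _ , top na
schubert-bounded zero v h | inj₁ (i , a , _) with () ← ℕP.≤-trans (ℕP.≤-reflexive (sym (nasc-swp a))) h
schubert-bounded (suc k) v h | inj₁ (i , a , _)
  with f , s ← schubert-bounded k (swp i v) (s≤s⁻¹ (ℕP.≤-trans (ℕP.≤-reflexive (sym (nasc-swp a))) h))
  = D i f , step a s

schubert : ∀ {n} (v : Vec ℕ n) → ∃[ f ] IsS v f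
schubert v = schubert-bounded (nasc v) v ℕP.≤-refl

asc-far₁ : ∀ {n i k} {v : Vec ℕ n} → Asc i v → Asc (suc (suc (i ℕ.+ k))) v → Asc (suc (suc (i ℕ.+ k))) (swp i v)
asc-far₁ (here _)  (there (there b)) = there (there b)
asc-far₁ (there a) (there b)         = there (asc-far₁ a b)

asc-far₂ : ∀ {n i k} {v : Vec ℕ n} → Asc i v → Asc (suc (suc (i ℕ.+ k))) v → Asc i (swp (suc (suc (i ℕ.+ k))) v)
asc-far₂ (here p)  (there (there b)) = here p
asc-far₂ (there a) (there b)         = there (asc-far₂ a b)

asc-near₁ : ∀ {n i} {v : Vec ℕ n} → Asc i v → Asc (suc i) v →
            Asc (suc i) (swp i v) × Asc i (swp (suc i) (swp i v))
asc-near₁ (here p)  (there (here q)) = there (here (ℕP.<-trans p q)) , here q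
asc-near₁ (there a) (there b) with c , e ← asc-near₁ a b = there c , there e

asc-near₂ : ∀ {n i} {v : Vec ℕ n} → Asc i v → Asc (suc i) v →
            Asc i (swp (suc i) v) × Asc (suc i) (swp i (swp (suc i) v))
asc-near₂ (here p)  (there (here q)) = here (ℕP.<-trans p q) , there (here p)
asc-near₂ (there a) (there b) with c , e ← asc-near₂ a b = there c , there e

data Apart : ℕ → ℕ → Set where
  same  : ∀ {i} → Apart i i
  near  : ∀ {i} → Apart i (suc i)
  near′ : ∀ {i} → Apart (suc i) i
  far   : ∀ {i} k → Apart i (suc (suc (i ℕ.+ k)))
  far′  : ∀ {i} k → Apart (suc (suc (i ℕ.+ k))) i

apart : ∀ i j → Apart i j
apart zero          zero          = same
apart zero          (suc zero)    = near
apart zero          (suc (suc j)) = far j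
apart (suc zero)    zero          = near′
apart (suc (suc i)) zero          = far′ i
apart (suc i)       (suc j) with apart i j
... | same   = same
... | near   = near
... | near′  = near′
... | far k  = far k
... | far′ k = far′ k

-- A diamond argument: two ascents of v lead to a common word, after one further swap each if they
-- are far apart and two if they are neighbours. `schubert` supplies a series there, the induction
-- hypothesis identifies both branches with its images, and `D-comm` or `D-braid` closes the
-- diamond.
IsS-unique-bounded : ∀ {n} k {v : Vec ℕ n} {f g} → nasc v ≤ k → IsS v f → IsS v g → f ≗ g
IsS-unique-bounded k h (top _)    (top _)    α = refl
IsS-unique-bounded k h (top na)   (step a _) α = contradiction a (na _ z≤n)
IsS-unique-bounded k h (step a _) (top na)   α = contradiction a (na _ z≤n)
IsS-unique-bounded zero h (step a _) (step _ _) α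
  with () ← ℕP.≤-trans (ℕP.≤-reflexive (sym (nasc-swp a))) h
IsS-unique-bounded {n} (suc k) {v} h (step {i = i} {f} a p) (step {i = j} {g} b q) = cases (apart i j) a p b q
  where
  less : ∀ {i} → Asc i v → nasc (swp i v) ≤ k
  less a = s≤s⁻¹ (ℕP.≤-trans (ℕP.≤-reflexive (sym (nasc-swp a))) h)
  farCase : ∀ {i} l {f g} → Asc i v → IsS (swp i v) f → Asc (suc (suc (i ℕ.+ l))) v →
            IsS (swp (suc (suc (i ℕ.+ l))) v) g → D i f ≗ D (suc (suc (i ℕ.+ l))) g
  farCase {i} l {f} {g} a p b q α with e , s ← schubert (swp (suc (suc (i ℕ.+ l))) (swp i v))
    = trans (D-cong i (IsS-unique-bounded k (less a) p (step (asc-far₁ a b) s)) α)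
     (trans (D-comm i l e α)
       (sym (D-cong (suc (suc (i ℕ.+ l))) (IsS-unique-bounded k (less b) q
         (step (asc-far₂ a b) (subst (λ u → IsS u e) (sym (swp-comm i l v)) s))) α)))
  nearCase : ∀ {i f g} → Asc i v → IsS (swp i v) f → Asc (suc i) v →
             IsS (swp (suc i) v) g → D i f ≗ D (suc i) g
  nearCase {i} a p b q α with e , s ← schubert (swp i (swp (suc i) (swp i v)))
    with a₁ , a₂ ← asc-near₁ a b | b₁ , b₂ ← asc-near₂ a b
    = trans (D-cong i (IsS-unique-bounded k (less a) p (step a₁ (step a₂ s))) α)
     (trans (D-braid i e α)
       (sym (D-cong (suc i) (IsS-unique-bounded k (less b) q
         (step b₁ (step b₂ (subst (λ u → IsS u e) (swp-braid b) s)))) α)))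
  cases : ∀ {i j f g} → Apart i j → Asc i v → IsS (swp i v) f → Asc j v → IsS (swp j v) g → D i f ≗ D j g
  cases {i} same a p b q α = D-cong i (IsS-unique-bounded k (less a) p q) α
  cases near     a p b q α = nearCase a p b q α
  cases near′    a p b q α = sym (nearCase b q a p α)
  cases (far l)  a p b q α = farCase l a p b q α
  cases (far′ l) a p b q α = sym (farCase l b q a p α)

IsS-unique : ∀ {n} {v : Vec ℕ n} {f g} → IsS v f → IsS v g → f ≗ g
IsS-unique {v = v} = IsS-unique-bounded (nasc v) ℕP.≤-refl

IsS-ascent : ∀ {n} {v : Vec ℕ n} {f i} → IsS v f → Asc i v → ∃[ g ] IsS (swp i v) g × f ≗ D i g
IsS-ascent {v = v} {i = i} s a with g , s′ ← schubert (swp i v) = g , s′ , IsS-unique s (step a s′)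

IsS-symmetric : ∀ {n} {v : Vec ℕ n} {f i} → IsS v f → Asc i v → ∀ α → f (swp i α) ≡ f α
IsS-symmetric {i = i} s a α with g , _ , e ← IsS-ascent s a =
  trans (e (swp i α)) (trans (D-swp i g α) (sym (e α)))

-- Supports

-- The exponents β′ that can contribute to the coefficient at β of a divided difference. The
-- inequality records that each summand of `d f p q` has an exponent at least p + 1.
data Line : ∀ {n} → ℕ → Vec ℕ n → Vec ℕ n → Set where
  here  : ∀ {n p q p′ q′} {γ : Vec ℕ n} → p′ ℕ.+ q′ ≡ suc (p ℕ.+ q) → p < p′ ⊎ p < q′ →
          Line 0 (p ∷ q ∷ γ) (p′ ∷ q′ ∷ γ)
  there : ∀ {n i a} {β β′ : Vec ℕ n} → Line i β β′ → Line (suc i) (a ∷ β) (a ∷ β′)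

private
  sum-nonzero : ∀ x y → x ℤ.+ y ≢ 0ℤ → x ≢ 0ℤ ⊎ y ≢ 0ℤ
  sum-nonzero x y h with x ℤ.≟ 0ℤ
  ... | no x≢0 = inj₁ x≢0
  ... | yes refl = inj₂ λ e → h (trans (ℤP.+-identityˡ y) e)

  δ-supp : ∀ f p q → δ f p q ≢ 0ℤ → f p q ≢ 0ℤ ⊎ f q p ≢ 0ℤ
  δ-supp f p q h with sum-nonzero (f p q) (ℤ.- f q p) h
  ... | inj₁ k = inj₁ k
  ... | inj₂ k = inj₂ λ e → k (cong ℤ.-_ e)

d-supp : ∀ f p q → d f p q ≢ 0ℤ →
         ∃[ p′ ] ∃[ q′ ] f p′ q′ ≢ 0ℤ × p′ ℕ.+ q′ ≡ suc (p ℕ.+ q) × (p < p′ ⊎ p < q′)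
d-supp f p zero h with δ-supp f (suc p) 0 h
... | inj₁ k = suc p , 0 , k , refl , inj₁ ℕP.≤-refl
... | inj₂ k = 0 , suc p , k , cong suc (sym (ℕP.+-identityʳ p)) , inj₂ ℕP.≤-refl
d-supp f p (suc q) h with sum-nonzero (δ f (suc p) (suc q)) (d f (suc p) q) h
... | inj₁ k with δ-supp f (suc p) (suc q) k
...   | inj₁ l = suc p , suc q , l , refl , inj₁ ℕP.≤-refl
...   | inj₂ l = suc q , suc p , l , cong suc (trans (ℕP.+-suc q p) (trans (cong suc (ℕP.+-comm q p)) (sym (ℕP.+-suc p q)))) , inj₂ ℕP.≤-refl
d-supp f p (suc q) h | inj₂ k with d-supp f (suc p) q k
... | p′ , q′ , l , e , o = p′ , q′ , l , trans e (cong suc (sym (ℕP.+-suc p q))) , weaken o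
  where weaken : suc p < p′ ⊎ suc p < q′ → p < p′ ⊎ p < q′
        weaken (inj₁ x) = inj₁ (ℕP.<⇒≤ x)
        weaken (inj₂ x) = inj₂ (ℕP.<⇒≤ x)

D-supp : ∀ {n} i (f : Ser n) β → D i f β ≢ 0ℤ → ∃[ β′ ] Line i β β′ × f β′ ≢ 0ℤ
D-supp i       f []          h = contradiction refl h
D-supp zero    f (x ∷ [])    h = contradiction refl h
D-supp zero    f (x ∷ y ∷ v) h with d-supp _ x y h
... | p , q , k , e , o = p ∷ q ∷ v , here e o , k
D-supp (suc i) f (x ∷ v)     h with D-supp i _ v h
... | β′ , l , k = x ∷ β′ , there l , k

-- The coefficient is the same at the transpose of β, so the inequality of `Line` becomes available
-- for the exponent at i + 1.
D-supp′ : ∀ {n} i (f : Ser n) β → D i f β ≢ 0ℤ → ∃[ β′ ] Line i (swp i β) β′ × f β′ ≢ 0ℤ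
D-supp′ i f β h = D-supp i f (swp i β) λ e → h (trans (sym (D-swp i f β)) e)

coeff-single : ∀ {n} (β α : Vec ℕ n) → coeff ((1ℤ , β) ∷ []) α ≢ 0ℤ → α ≡ β
coeff-single β α h with ≡-dec ℕ._≟_ β α
... | yes e = sym e
... | no _  = contradiction refl h

coeff-single-self : ∀ {n} (β : Vec ℕ n) → coeff ((1ℤ , β) ∷ []) β ≢ 0ℤ
coeff-single-self β h with ≡-dec ℕ._≟_ β β
coeff-single-self β () | yes _
... | no β≢β = β≢β refl

-- The code as extreme exponent of the Schubert polynomial

Bd : ∀ {n} → Vec ℕ n → Set
Bd []              = ⊤
Bd {suc n} (a ∷ v) = a ≤ n × Bd v

Bd-rho : ∀ n → Bd (rho n)
Bd-rho zero    = tt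
Bd-rho (suc n) = ℕP.≤-refl , Bd-rho n

-- β₁ bounds the exponent of β at i, and β₂, which comes from the transpose, the one at i + 1. Both
-- stay within the smaller of the two bounds.
Bd-line : ∀ {n i} {β β₁ β₂ : Vec ℕ n} → Line i β β₁ → Line i (swp i β) β₂ → Bd β₁ → Bd β₂ → Bd β
Bd-line (here _ o) (here _ o′) (b₁ , b₂ , b) (b₃ , b₄ , _) =
  ℕP.m≤n⇒m≤1+n (bound o b₁ b₂) , bound o′ b₃ b₄ , b
  where bound : ∀ {p p′ q′ m} → p < p′ ⊎ p < q′ → p′ ≤ suc m → q′ ≤ m → p ≤ m
        bound (inj₁ h) k _ = s≤s⁻¹ (ℕP.≤-trans h k)
        bound (inj₂ h) _ k = ℕP.≤-trans (ℕP.<⇒≤ h) k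
Bd-line (there l) (there l′) (b , bs) (_ , bs′) = b , Bd-line l l′ bs bs′

IsS-Bd : ∀ {n} {v : Vec ℕ n} {f} → IsS v f → ∀ β → f β ≢ 0ℤ → Bd β
IsS-Bd {n} (top _) β h = subst Bd (sym (coeff-single (rho n) β h)) (Bd-rho n)
IsS-Bd (step {i = i} {f} a s) β h
  with β₁ , l₁ , h₁ ← D-supp i f β h | β₂ , l₂ , h₂ ← D-supp′ i f β h
  = Bd-line l₁ l₂ (IsS-Bd s β₁ h₁) (IsS-Bd s β₂ h₂)

tailSum : ∀ {n} → ℕ → Vec ℕ n → ℕ
tailSum j       []      = 0
tailSum zero    (x ∷ v) = x ℕ.+ tailSum 0 v
tailSum (suc j) (x ∷ v) = tailSum j v

tailSum-line : ∀ {n i j} {β β′ : Vec ℕ n} → Line i β β′ → j ≤ i → tailSum j β′ ≡ suc (tailSum j β)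
tailSum-line (here {p = p} {q} {p′} {q′} {γ} e _) z≤n =
  trans (sym (ℕP.+-assoc p′ q′ _)) (trans (cong (ℕ._+ tailSum 0 γ) e) (cong suc (ℕP.+-assoc p q _)))
tailSum-line (there {a = a} l) z≤n     = trans (cong (a ℕ.+_) (tailSum-line l z≤n)) (ℕP.+-suc a _)
tailSum-line (there l)         (s≤s h) = tailSum-line l h

code-swp-here : ∀ {n x y} (v : Vec ℕ n) → x < y →
  code (x ∷ y ∷ v) ≡ below x v ∷ below y v ∷ code v × code (y ∷ x ∷ v) ≡ suc (below y v) ∷ below x v ∷ code v
code-swp-here {x = x} {y} v x<y =
  cong (λ t → t ℕ.+ below x v ∷ below y v ∷ code v) (ind-no (ℕP.<-asym x<y)) ,
  cong (λ t → t ℕ.+ below y v ∷ below x v ∷ code v) (ind-yes x<y)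

tailSum-code : ∀ {n i j} {v : Vec ℕ n} → Asc i v → j ≤ i → tailSum j (code (swp i v)) ≡ suc (tailSum j (code v))
tailSum-code (here {x = x} {y} {v} x<y) z≤n with e , e′ ← code-swp-here v x<y = begin
  tailSum 0 (code (y ∷ x ∷ v)) ≡⟨ cong (tailSum 0) e′ ⟩
  suc (below y v + (below x v + tailSum 0 (code v))) ≡⟨ cong suc (ℕP.+-assoc (below y v) _ _) ⟨
  suc (below y v + below x v + tailSum 0 (code v)) ≡⟨ cong (λ t → suc (t + tailSum 0 (code v))) (ℕP.+-comm (below y v) _) ⟩
  suc (below x v + below y v + tailSum 0 (code v)) ≡⟨ cong suc (ℕP.+-assoc (below x v) _ _) ⟩
  suc (tailSum 0 (below x v ∷ below y v ∷ code v)) ≡⟨ cong (λ t → suc (tailSum 0 t)) e ⟨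
  suc (tailSum 0 (code (x ∷ y ∷ v))) ∎
  where open ≡-Reasoning
tailSum-code (there {i = i} {x} {v} a) z≤n =
  trans (cong₂ ℕ._+_ (below-swp x i v) (tailSum-code a z≤n)) (ℕP.+-suc (below x v) _)
tailSum-code (there a) (s≤s h) = tailSum-code a h

tailSum-Bd : ∀ {n} j {β : Vec ℕ n} → Bd β → tailSum j β ≤ tailSum j (rho n)
tailSum-Bd j       {[]}    b        = z≤n
tailSum-Bd zero    {x ∷ β} (b , bs) = ℕP.+-mono-≤ b (tailSum-Bd 0 bs)
tailSum-Bd (suc j) {x ∷ β} (b , bs) = tailSum-Bd j bs

tailSum-noAsc : ∀ {n} j {v : Vec ℕ n} → NoAscFrom j v → Unique v → tailSum j (code v) ≡ tailSum j (rho n)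
tailSum-noAsc zero    na u = cong (tailSum 0) (code-noAsc na u)
tailSum-noAsc (suc j) {[]} na u = refl
tailSum-noAsc (suc j) {x ∷ v} na (_ ∷ u) = tailSum-noAsc j (λ i h a → na (suc i) (s≤s h) (there a)) u

IsS-homogeneous : ∀ {n} {v : Vec ℕ n} {f} → IsS v f → Unique v → ∀ β → f β ≢ 0ℤ → tailSum 0 β ≡ tailSum 0 (code v)
IsS-homogeneous {n} (top na) u β h = cong (tailSum 0) (trans (coeff-single (rho n) β h) (sym (code-noAsc na u)))
IsS-homogeneous (step {i = i} {f} a s) u β h with β′ , l , h′ ← D-supp i f β h =
  ℕP.suc-injective (trans (sym (tailSum-line l z≤n))
    (trans (IsS-homogeneous s (Unique-swp i u) β′ h′) (tailSum-code a z≤n)))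

-- Take the last ascent i. If j ≤ i, both tail sums are one less than for `swp i v`, and induction
-- applies. If j > i, the word decreases from j on, so its code agrees there with `rho`, the bound
-- on all exponents.
IsS-dominance-bounded : ∀ {n} k {v : Vec ℕ n} {f} → nasc v ≤ k → IsS v f → Unique v →
                        ∀ j β → f β ≢ 0ℤ → tailSum j β ≤ tailSum j (code v)
IsS-dominance-bounded k {v} hk s u j β h with lastAsc v
... | inj₂ na = ℕP.≤-trans (tailSum-Bd j (IsS-Bd s β h))
                  (ℕP.≤-reflexive (sym (tailSum-noAsc j (λ i _ → na i z≤n) u)))
... | inj₁ (i , a , na) with j ℕ.≤? i
...   | no j≰i = ℕP.≤-trans (tailSum-Bd j (IsS-Bd s β h))
                  (ℕP.≤-reflexive (sym (tailSum-noAsc j (λ l j≤l → na l (ℕP.<-≤-trans (ℕP.≰⇒> j≰i) j≤l)) u)))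
IsS-dominance-bounded zero hk s u j β h | inj₁ (i , a , na) | yes j≤i
  with () ← ℕP.≤-trans (ℕP.≤-reflexive (sym (nasc-swp a))) hk
IsS-dominance-bounded (suc k) hk s u j β h | inj₁ (i , a , na) | yes j≤i
  with g , s′ , e ← IsS-ascent s a
  with β′ , l , h′ ← D-supp i g β (λ z → h (trans (e β) z))
  = s≤s⁻¹ (subst₂ _≤_ (tailSum-line l j≤i) (tailSum-code a j≤i)
      (IsS-dominance-bounded k (s≤s⁻¹ (ℕP.≤-trans (ℕP.≤-reflexive (sym (nasc-swp a))) hk)) s′ (Unique-swp i u) j β′ h′))

IsS-dominance : ∀ {n} {v : Vec ℕ n} {f} → IsS v f → Unique v → ∀ j β → f β ≢ 0ℤ → tailSum j β ≤ tailSum j (code v)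
IsS-dominance {v = v} = IsS-dominance-bounded (nasc v) ℕP.≤-refl

-- At the last ascent all but one term of the divided difference vanish for degree reasons.
private
  d-vanish : ∀ {m} G → (∀ p q → suc m < p ⊎ m < q → G p q ≡ 0ℤ) → ∀ p c → m < p → d G p c ≡ 0ℤ
  d-vanish G z p zero    h = cong₂ ℤ._-_ (z (suc p) 0 (inj₁ (s≤s h))) (z 0 (suc p) (inj₂ (ℕP.m≤n⇒m≤1+n h)))
  d-vanish G z p (suc c) h = cong₂ ℤ._+_
    (cong₂ ℤ._-_ (z (suc p) (suc c) (inj₁ (s≤s h))) (z (suc c) (suc p) (inj₂ (ℕP.m≤n⇒m≤1+n h))))
    (d-vanish G z (suc p) c (ℕP.m≤n⇒m≤1+n h))

  d-lead : ∀ {m} G → (∀ p q → suc m < p ⊎ m < q → G p q ≡ 0ℤ) → ∀ c → d G m c ≡ G (suc m) c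
  d-lead {m} G z zero    = trans (cong (λ t → G (suc m) 0 ℤ.- t) (z 0 (suc m) (inj₂ ℕP.≤-refl))) (ℤP.+-identityʳ _)
  d-lead {m} G z (suc c) = trans
    (cong₂ ℤ._+_ (trans (cong (λ t → G (suc m) (suc c) ℤ.- t) (z (suc c) (suc m) (inj₂ ℕP.≤-refl))) (ℤP.+-identityʳ (G (suc m) (suc c))))
                 (d-vanish G z (suc m) c ℕP.≤-refl))
    (ℤP.+-identityʳ (G (suc m) (suc c)))

D-lead : ∀ {n i} {v : Vec ℕ n} (g : Ser n) → (∀ β → ¬ Bd β → g β ≡ 0ℤ) → Asc i v → NoAscFrom (suc i) v → Unique v →
         D i g (code v) ≡ g (code (swp i v))
D-lead {suc (suc m)} g z (here {x = x} {y} {v} x<y) na (_ ∷ u) with e , e′ ← code-swp-here v x<y = begin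
  D 0 g (code (x ∷ y ∷ v))        ≡⟨ cong (D 0 g) e ⟩
  d G (below x v) (below y v)     ≡⟨ cong (d G (below x v)) full ⟩
  -- Symmetry puts the maximal exponent m first; every summand except G (m + 1) (`below x v`) then
  -- violates `Bd`.
  d G (below x v) m               ≡⟨ d-sym G (below x v) m ⟩
  d G m (below x v)               ≡⟨ d-lead G out (below x v) ⟩
  g (suc m ∷ below x v ∷ code v)  ≡⟨ cong (λ t → g (suc t ∷ below x v ∷ code v)) full ⟨
  g (suc (below y v) ∷ below x v ∷ code v) ≡⟨ cong g e′ ⟨
  g (code (y ∷ x ∷ v)) ∎
  where
  open ≡-Reasoning
  G : ℕ → ℕ → ℤ
  G p q = g (p ∷ q ∷ code v)
  full : below y v ≡ m
  full = below-all (noAsc-below (λ i _ a → na (suc i) (s≤s z≤n) (there a)) u)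
  out : ∀ p q → suc m < p ⊎ m < q → G p q ≡ 0ℤ
  out p q (inj₁ h) = z _ λ { (b , _) → ℕP.<⇒≱ h b }
  out p q (inj₂ h) = z _ λ { (_ , b , _) → ℕP.<⇒≱ h b }
D-lead {suc n} g z (there {i = i} {x} {v} a) na (_ ∷ u) = trans
  (D-lead (λ w → g (below x v ∷ w)) (λ β ¬b → z _ λ { (_ , b) → ¬b b }) a (λ k h b → na (suc k) (s≤s h) (there b)) u)
  (cong (λ t → g (t ∷ code (swp i v))) (sym (below-swp x i v)))

-- Along last ascents `D-lead` carries the coefficient of the code unchanged from the staircase
-- monomial.
IsS-code-bounded : ∀ {n} k {v : Vec ℕ n} {f} → nasc v ≤ k → IsS v f → Unique v → f (code v) ≢ 0ℤ
IsS-code-bounded k {v} hk s u with lastAsc v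
IsS-code-bounded {n} k hk (top na) u | inj₂ _ =
  subst (λ c → coeff ((1ℤ , rho n) ∷ []) c ≢ 0ℤ) (sym (code-noAsc na u)) (coeff-single-self (rho n))
IsS-code-bounded k hk (step a s) u | inj₂ na = contradiction a (na _ z≤n)
IsS-code-bounded zero hk s u | inj₁ (i , a , na)
  with () ← ℕP.≤-trans (ℕP.≤-reflexive (sym (nasc-swp a))) hk
IsS-code-bounded (suc k) {v} hk s u | inj₁ (i , a , na) with g , s′ , e ← IsS-ascent s a =
  λ z → IsS-code-bounded k (s≤s⁻¹ (ℕP.≤-trans (ℕP.≤-reflexive (sym (nasc-swp a))) hk)) s′ (Unique-swp i u)
    (trans (sym (D-lead g vanish a na u)) (trans (sym (e (code v))) z))
  where
  vanish : ∀ β → ¬ Bd β → g β ≡ 0ℤ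
  vanish β ¬b with g β ℤ.≟ 0ℤ
  ... | yes z = z
  ... | no nz = contradiction (IsS-Bd s′ β nz) ¬b

IsS-code : ∀ {n} {v : Vec ℕ n} {f} → IsS v f → Unique v → f (code v) ≢ 0ℤ
IsS-code {v = v} = IsS-code-bounded (nasc v) ℕP.≤-refl

-- Subsequences, 132 patterns and the exponents they force

data Sub : ∀ {n} → List ℕ → Vec ℕ n → Set where
  done : ∀ {n} {v : Vec ℕ n} → Sub [] v
  take : ∀ {n x xs} {v : Vec ℕ n} → Sub xs v → Sub (x ∷ xs) (x ∷ v)
  skip : ∀ {n x xs} {v : Vec ℕ n} → Sub xs v → Sub xs (x ∷ v)

sub-tail : ∀ {n x xs} {v : Vec ℕ n} → Sub (x ∷ xs) v → Sub xs v
sub-tail (take s) = skip s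
sub-tail (skip s) = skip (sub-tail s)

sub-keep : ∀ {n x y xs} {v : Vec ℕ n} → Sub (x ∷ y ∷ xs) v → Sub (x ∷ xs) v
sub-keep (take s) = take (sub-tail s)
sub-keep (skip s) = skip (sub-keep s)

sub-init : ∀ {n x xs} {v : Vec ℕ n} → Sub (x ∷ xs) v → Sub (x ∷ []) v
sub-init (take s) = take done
sub-init (skip s) = skip (sub-init s)

sub-init₂ : ∀ {n x y xs} {v : Vec ℕ n} → Sub (x ∷ y ∷ xs) v → Sub (x ∷ y ∷ []) v
sub-init₂ (take s) = take (sub-init s)
sub-init₂ (skip s) = skip (sub-init₂ s)

sub-fresh : ∀ {n x y} {v : Vec ℕ n} → Sub (y ∷ []) v → VAll.All (x ≢_) v → x ≢ y
sub-fresh (take _) (p ∷ _)  = p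
sub-fresh (skip s) (_ ∷ ps) = sub-fresh s ps

ind-mono : ∀ z {x y} → x ≤ y → ind z x ≤ ind z y
ind-mono z {x} {y} h with z ℕ.<? x | z ℕ.<? y
... | no _  | _     = z≤n
... | yes _ | yes _ = ℕP.≤-refl
... | yes p | no ¬q = contradiction (ℕP.<-≤-trans p h) ¬q

below-mono : ∀ {n x y} (v : Vec ℕ n) → x ≤ y → below x v ≤ below y v
below-mono []      h = z≤n
below-mono (z ∷ v) h = ℕP.+-mono-≤ (ind-mono z h) (below-mono v h)

below-gap₁ : ∀ {n x y c} {v : Vec ℕ n} → Sub (c ∷ []) v → x < c → c < y → below x v < below y v
below-gap₁ {x = x} {y} {c} {_ ∷ v} (take s) h k
  rewrite ind-no (ℕP.<-asym h) | ind-yes k = s≤s (below-mono v (ℕP.<⇒≤ (ℕP.<-trans h k)))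
below-gap₁ {v = z ∷ v} (skip s) h k =
  ℕP.+-mono-≤-< (ind-mono z (ℕP.<⇒≤ (ℕP.<-trans h k))) (below-gap₁ s h k)

below-gap₂ : ∀ {n x y c e} {v : Vec ℕ n} → Sub (c ∷ e ∷ []) v → x < c → c < y → x < e → e < y →
             suc (suc (below x v)) ≤ below y v
below-gap₂ {x = x} {y} {c} {_} {_ ∷ v} (take s) h k h′ k′
  rewrite ind-no (ℕP.<-asym h) | ind-yes k = s≤s (below-gap₁ s h′ k′)
below-gap₂ {x = x} {y} {v = z ∷ v} (skip s) h k h′ k′ = ℕP.≤-trans
  (ℕP.≤-reflexive (sym (trans (ℕP.+-suc (ind z x) _) (cong suc (ℕP.+-suc (ind z x) _)))))
  (ℕP.+-mono-≤ (ind-mono z (ℕP.<⇒≤ (ℕP.<-trans h k))) (below-gap₂ s h k h′ k′))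

-- The condition that a, placed before v, starts a 132 pattern.
Inv21 : ∀ {n} → ℕ → Vec ℕ n → Set
Inv21 a v = ∃[ b ] ∃[ c ] Sub (b ∷ c ∷ []) v × a < c × c < b

data Pat132 : ∀ {n} → ℕ → Vec ℕ n → Set where
  here  : ∀ {n a} {v : Vec ℕ n} → Inv21 a v → Pat132 0 (a ∷ v)
  there : ∀ {n j x} {v : Vec ℕ n} → Pat132 j v → Pat132 (suc j) (x ∷ v)

Pat132-bound : ∀ {n j} {v : Vec ℕ n} → Pat132 j v → j < n
Pat132-bound (here _)  = s≤s z≤n
Pat132-bound (there t) = s≤s (Pat132-bound t)

data Gt : ∀ {n} → ℕ → Vec ℕ n → Vec ℕ n → Set where
  here  : ∀ {n c a} {γ α : Vec ℕ n} → c < a → Gt 0 (c ∷ γ) (a ∷ α)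
  there : ∀ {n j c} {γ α : Vec ℕ n} → Gt j γ α → Gt (suc j) (c ∷ γ) (c ∷ α)

data Lt : ∀ {n} → ℕ → Vec ℕ n → Vec ℕ n → Set where
  here  : ∀ {n c a} {γ α : Vec ℕ n} → a < c → Lt 0 (c ∷ γ) (a ∷ α)
  there : ∀ {n j c} {γ α : Vec ℕ n} → Lt j γ α → Lt (suc j) (c ∷ γ) (c ∷ α)

-- In fixed degree, a smaller entry at j forces a larger sum after j.
Lt-absurd : ∀ {n j} {c α : Vec ℕ n} → Lt j c α → tailSum 0 α ≡ tailSum 0 c → ¬ tailSum (suc j) α ≤ tailSum (suc j) c
Lt-absurd (here h)  e k = ℕP.<⇒≢ (ℕP.+-mono-<-≤ h k) e
Lt-absurd (there {c = c} l) e k = Lt-absurd l (ℕP.+-cancelˡ-≡ c _ _ e) k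

-- Compare a with the next entry x. If x < a, the swap moves a to the right with its pattern intact.
-- If a < x, either c lies between them, so the code rises from j to j + 1 and its transpose exceeds
-- it at j, or x < c and x takes over the role of a.
132-step : ∀ {n j} {v : Vec ℕ n} → Pat132 j v → Unique v →
           (Asc j v × Gt j (code v) (swp j (code v))) ⊎ (Asc j v × Pat132 (suc j) v)
           ⊎ (Asc j (swp j v) × Pat132 (suc j) (swp j v))
132-step (there t) (_ ∷ u) with 132-step t u
... | inj₁ (a , g)        = inj₁ (there a , there g)
... | inj₂ (inj₁ (a , p)) = inj₂ (inj₁ (there a , there p))
... | inj₂ (inj₂ (a , p)) = inj₂ (inj₂ (there a , there p))
132-step {v = a ∷ x ∷ w} (here (b , c , s , a<c , c<b)) ((a≢x ∷ _) ∷ x∉ ∷ _) with ℕP.<-cmp a x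
... | tri≈ _ a≡x _ = contradiction a≡x a≢x
... | tri> _ _ x<a = inj₂ (inj₂ (here x<a , there (here (tailSub s))))
  where
  tailSub : Sub (b ∷ c ∷ []) (x ∷ w) → Inv21 a w
  tailSub (take s) = contradiction (ℕP.<-trans (ℕP.<-trans a<c c<b) x<a) (ℕP.<-irrefl refl)
  tailSub (skip s) = b , c , s , a<c , c<b
132-step {v = a ∷ x ∷ w} (here (b , c , take s , a<c , c<b)) _ | tri< a<x _ _ =
  inj₁ (here a<x , here (subst (_< below x w) (cong (_+ below a w) (sym (ind-no (ℕP.<-asym a<x)))) (below-gap₁ s a<c c<b)))
132-step {v = a ∷ x ∷ w} (here (b , c , skip s , a<c , c<b)) (_ ∷ x∉ ∷ _) | tri< a<x _ _ with ℕP.<-cmp c x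
... | tri< c<x _ _ = inj₁ (here a<x , here (subst (_< below x w) (cong (_+ below a w) (sym (ind-no (ℕP.<-asym a<x)))) (below-gap₁ (sub-tail s) a<c c<x)))
... | tri≈ _ c≡x _ = contradiction (sym c≡x) (sub-fresh (sub-tail s) x∉)
... | tri> _ _ x<c = inj₂ (inj₁ (here a<x , there (here (b , c , s , x<c , c<b))))

Gt-swp : ∀ {n j} {v α : Vec ℕ n} → Asc j v → Gt (suc j) (code v) α → Gt j (code v) (swp j α)
Gt-swp (here {x = x} {y} {v} x<y) (there (here h)) = here
  (ℕP.≤-<-trans (ℕP.≤-trans (ℕP.≤-reflexive (cong (_+ below x v) (ind-no (ℕP.<-asym x<y)))) (below-mono v (ℕP.<⇒≤ x<y))) h)
Gt-swp (there a) (there g) = there (Gt-swp a g)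

code-swp-there : ∀ {n} i x (v : Vec ℕ n) → code (swp (suc i) (x ∷ v)) ≡ below x v ∷ code (swp i v)
code-swp-there i x v = cong (_∷ code (swp i v)) (below-swp x i v)

-- Let c ≤ c′ be the code entries of v at j and j + 1, and b > c′ the entry of α at j + 1. After the
-- swap the code entry at j is c′ + 1. If the first entry of β exceeds b, it exceeds c′ + 1; if the
-- second does, the degree leaves at most c for the first.
Line-Gt : ∀ {n j} {v α β : Vec ℕ n} → Asc j v → Gt (suc j) (code v) α → Line j (swp j α) β →
          Gt j (code (swp j v)) β ⊎ Lt j (code (swp j v)) β
Line-Gt {α = c₀ ∷ b ∷ _} (here {x = x} {y} {u} x<y) (there (here h)) (here {p′ = p} {q′ = q} e o)
  rewrite ind-no (ℕP.<-asym x<y) | ind-yes x<y with o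
... | inj₁ b<p = inj₁ (here (ℕP.≤-<-trans h b<p))
... | inj₂ b<q = inj₂ (here (s≤s (ℕP.≤-trans p≤ (below-mono u (ℕP.<⇒≤ x<y)))))
  where
  p≤ : p ≤ below x u
  p≤ = ℕP.+-cancelʳ-≤ (suc b) p _ (ℕP.≤-trans (ℕP.+-monoʳ-≤ p b<q)
         (ℕP.≤-reflexive (trans e (trans (cong suc (ℕP.+-comm b _)) (sym (ℕP.+-suc (below x u) b))))))
Line-Gt (there {i = i} {x} {v} a) (there g) (there {β′ = β′} l) with Line-Gt a g l
... | inj₁ r = inj₁ (subst (λ c → Gt (suc i) c (below x v ∷ β′)) (sym (code-swp-there i x v)) (there r))
... | inj₂ r = inj₂ (subst (λ c → Lt (suc i) c (below x v ∷ β′)) (sym (code-swp-there i x v)) (there r))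

-- The start of the pattern moves right until the transposed code serves; k bounds the positions
-- left. If the word stays, symmetry moves the exponent back. If it was swapped, `D j f` belongs to
-- the new word, and the exponent is lifted to one of f; the outcome `Lt` would contradict the
-- dominance of the code.
132-supp-bounded : ∀ {n} k {v : Vec ℕ n} {f j} → n ≤ j + k → IsS v f → Unique v → Pat132 j v →
                   ∃[ α ] f α ≢ 0ℤ × Gt j (code v) α
132-supp-bounded zero {j = j} h s u t =
  contradiction (ℕP.<-≤-trans (Pat132-bound t) (ℕP.≤-trans h (ℕP.≤-reflexive (ℕP.+-identityʳ j)))) (ℕP.<-irrefl refl)
132-supp-bounded (suc k) {v} {f} {j} h s u t with 132-step t u
... | inj₁ (a , g) = swp j (code v) , (λ z → IsS-code s u (trans (sym (IsS-symmetric s a (code v))) z)) , g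
... | inj₂ (inj₁ (a , t′))
  with α , nz , g ← 132-supp-bounded k (ℕP.≤-trans h (ℕP.≤-reflexive (ℕP.+-suc j k))) s u t′
  = swp j α , (λ z → nz (trans (sym (IsS-symmetric s a α)) z)) , Gt-swp a g
... | inj₂ (inj₂ (a , t′))
  with α , nz , g ← 132-supp-bounded k (ℕP.≤-trans h (ℕP.≤-reflexive (ℕP.+-suc j k)))
                      (step a (subst (λ w → IsS w f) (sym (swp-invol j v)) s)) (Unique-swp j u) t′
  with β , l , nz′ ← D-supp′ j f α nz
  with Line-Gt a g l
... | inj₁ r = β , nz′ , subst (λ w → Gt j (code w) β) (swp-invol j v) r
... | inj₂ r = contradiction (IsS-dominance s u (suc j) β nz′)
                 (Lt-absurd (subst (λ w → Lt j (code w) β) (swp-invol j v) r) (IsS-homogeneous s u β nz′))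

132-supp : ∀ {n} {v : Vec ℕ n} {f j} → IsS v f → Unique v → Pat132 j v → ∃[ α ] f α ≢ 0ℤ × Gt j (code v) α
132-supp {n} {j = j} = 132-supp-bounded n (ℕP.m≤n+m n j)

data Wide : ∀ {n} → ℕ → Vec ℕ n → Set where
  here  : ∀ {n p q} {γ : Vec ℕ n} → suc (suc p) ≤ q → Wide 0 (p ∷ q ∷ γ)
  there : ∀ {n i x} {γ : Vec ℕ n} → Wide i γ → Wide (suc i) (x ∷ γ)

-- With `two` the code itself is wide at i. With `one` it may fall short by one, and the larger
-- exponent at i + 1 from `132-supp` makes up for that.
data Gap : ∀ {n} → ℕ → Vec ℕ n → Set where
  two   : ∀ {n x y} {v : Vec ℕ n} → suc (suc (below x v)) ≤ below y v → x < y → Gap 0 (x ∷ y ∷ v)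
  one   : ∀ {n x y} {v : Vec ℕ n} → below x v < below y v → Inv21 y v → x < y → Gap 0 (x ∷ y ∷ v)
  there : ∀ {n i x} {v : Vec ℕ n} → Gap i v → Gap (suc i) (x ∷ v)

Gap-Asc : ∀ {n i} {v : Vec ℕ n} → Gap i v → Asc i v
Gap-Asc (two _ h)   = here h
Gap-Asc (one _ _ h) = here h
Gap-Asc (there g)   = there (Gap-Asc g)

Gap-cases : ∀ {n i} {v : Vec ℕ n} → Gap i v →
            Wide i (code v) ⊎ (Pat132 (suc i) v × (∀ {α} → Gt (suc i) (code v) α → Wide i α))
Gap-cases (two {x = x} {v = v} h x<y) =
  inj₁ (here (ℕP.≤-trans (ℕP.≤-reflexive (cong (λ t → suc (suc (t + below x v))) (ind-no (ℕP.<-asym x<y)))) h))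
Gap-cases (one {x = x} {v = v} h p x<y) = inj₂ (there (here p) , λ { (there (here k)) → here
  (ℕP.≤-trans (s≤s (ℕP.≤-trans (ℕP.≤-reflexive (cong (λ t → suc (t + below x v)) (ind-no (ℕP.<-asym x<y)))) h)) k) })
Gap-cases (there g) with Gap-cases g
... | inj₁ w       = inj₁ (there w)
... | inj₂ (t , f) = inj₂ (there t , λ { (there k) → there (f k) })

Gap-Wide : ∀ {n i} {v : Vec ℕ n} {f} → IsS v f → Unique v → Gap i v → ∃[ α ] f α ≢ 0ℤ × Wide i α
Gap-Wide s u g with Gap-cases g
... | inj₁ w = _ , IsS-code s u , w
... | inj₂ (t , w) with α , nz , k ← 132-supp s u t = α , nz , w k

-- Compare the entry s after a with c and e. Below both, s replaces a and the walk continues. Above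
-- both, c and e lie between a and s. Otherwise one of them does, and b with the other is a 21 above
-- s.
gap-14 : ∀ {n a b c e} (v : Vec ℕ n) → Unique v → Sub (b ∷ c ∷ e ∷ []) v → a < c → c < b → a < e → e < b →
         ∃[ i ] Gap i (a ∷ v)
gap-14 (s ∷ v) u (take p) a<c c<b a<e e<b = 0 , two (below-gap₂ p a<c c<b a<e e<b) (ℕP.<-trans a<c c<b)
gap-14 {c = c} {e} (s ∷ v) (s∉ ∷ u) (skip p) a<c c<b a<e e<b
  with ℕP.<-cmp s c | ℕP.<-cmp s e
... | tri≈ _ s≡c _ | _ = contradiction s≡c (sub-fresh (sub-init (sub-tail p)) s∉)
... | _ | tri≈ _ s≡e _ = contradiction s≡e (sub-fresh (sub-tail (sub-tail p)) s∉)
... | tri< s<c _ _ | tri< s<e _ _ with i , g ← gap-14 v u p s<c c<b s<e e<b = suc i , there g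
... | tri> _ _ c<s | tri> _ _ e<s = 0 , two (below-gap₂ (sub-tail p) a<c c<s a<e e<s) (ℕP.<-trans a<c c<s)
... | tri> _ _ c<s | tri< s<e _ _ =
  0 , one (below-gap₁ (sub-init (sub-tail p)) a<c c<s) (_ , _ , sub-keep p , s<e , e<b) (ℕP.<-trans a<c c<s)
... | tri< s<c _ _ | tri> _ _ e<s =
  0 , one (below-gap₁ (sub-tail (sub-tail p)) a<e e<s) (_ , _ , sub-init₂ p , s<c , c<b) (ℕP.<-trans a<e e<s)

-- The same walk, steered by c and m. If s is b or lies between c and m, then c lies between a and
-- s, and l, m is a 21 above s. If s is above m, both c and m lie between a and s.
gap-13254 : ∀ {n a b c l m} (v : Vec ℕ n) → Unique v → Sub (b ∷ c ∷ l ∷ m ∷ []) v →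
            a < c → c < b → b < m → m < l → ∃[ i ] Gap i (a ∷ v)
gap-13254 (s ∷ v) u (take p) a<c c<b b<m m<l =
  0 , one (below-gap₁ (sub-init p) a<c c<b) (_ , _ , sub-tail p , b<m , m<l) (ℕP.<-trans a<c c<b)
gap-13254 {c = c} {m = m} (s ∷ v) (s∉ ∷ u) (skip p) a<c c<b b<m m<l
  with ℕP.<-cmp s c | ℕP.<-cmp s m
... | tri≈ _ s≡c _ | _ = contradiction s≡c (sub-fresh (sub-init (sub-tail p)) s∉)
... | _ | tri≈ _ s≡m _ = contradiction s≡m (sub-fresh (sub-tail (sub-tail (sub-tail p))) s∉)
... | tri< s<c _ _ | _ with i , g ← gap-13254 v u p s<c c<b b<m m<l = suc i , there g
... | tri> _ _ c<s | tri< s<m _ _ =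
  0 , one (below-gap₁ (sub-init (sub-tail p)) a<c c<s) (_ , _ , sub-tail (sub-tail p) , s<m , m<l) (ℕP.<-trans a<c c<s)
... | tri> _ _ c<s | tri> _ _ m<s =
  0 , two (below-gap₂ (sub-keep (sub-tail p)) a<c c<s (ℕP.<-trans a<c (ℕP.<-trans c<b b<m)) m<s) (ℕP.<-trans a<c c<s)

sub-gap : ∀ {n a xs} {v : Vec ℕ n} → (∀ {m} (w : Vec ℕ m) → Unique w → Sub xs w → ∃[ i ] Gap i (a ∷ w)) →
          Unique v → Sub (a ∷ xs) v → ∃[ i ] Gap i v
sub-gap h (_ ∷ u) (take s) = h _ u s
sub-gap h (_ ∷ u) (skip s) with i , g ← sub-gap h u s = suc i , there g

-- Coefficients of term lists: `∂` acts as `D`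

coeff-++ : ∀ {n} (p q : Poly n) α → coeff (p ++ q) α ≡ coeff p α ℤ.+ coeff q α
coeff-++ []            q α = sym (ℤP.+-identityˡ _)
coeff-++ ((c , β) ∷ p) q α with ≡-dec ℕ._≟_ β α
... | yes _ = trans (cong (ℤ._+_ c) (coeff-++ p q α)) (sym (ℤP.+-assoc c _ _))
... | no  _ = coeff-++ p q α

coeff-∷ : ∀ {n} (t : ℤ × Vec ℕ n) p α → coeff (t ∷ p) α ≡ coeff (t ∷ []) α ℤ.+ coeff p α
coeff-∷ t p α = coeff-++ (t ∷ []) p α

coeff-yes : ∀ {n} c {β α : Vec ℕ n} → β ≡ α → coeff ((c , β) ∷ []) α ≡ c
coeff-yes c {β} {α} e with ≡-dec ℕ._≟_ β α
... | yes _ = ℤP.+-identityʳ c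
... | no ¬e = contradiction e ¬e

coeff-no : ∀ {n} c {β α : Vec ℕ n} → β ≢ α → coeff ((c , β) ∷ []) α ≡ 0ℤ
coeff-no c {β} {α} ¬e with ≡-dec ℕ._≟_ β α
... | yes e = contradiction e ¬e
... | no _  = refl

push : ∀ {n} → ℕ → ℤ × Vec ℕ n → ℤ × Vec ℕ (suc n)
push b = map₂ (b ∷_)

coeff-push-yes : ∀ {n} b (p : Poly n) α → coeff (List.map (push b) p) (b ∷ α) ≡ coeff p α
coeff-push-yes b []            α = refl
coeff-push-yes b ((c , β) ∷ p) α = trans (coeff-∷ (c , b ∷ β) (List.map (push b) p) (b ∷ α))
  (trans (cong₂ ℤ._+_ (single (≡-dec ℕ._≟_ β α)) (coeff-push-yes b p α)) (sym (coeff-∷ (c , β) p α)))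
  where
  single : Dec (β ≡ α) → coeff ((c , b ∷ β) ∷ []) (b ∷ α) ≡ coeff ((c , β) ∷ []) α
  single (yes e) = trans (coeff-yes c (cong (b ∷_) e)) (sym (coeff-yes c e))
  single (no ¬e) = trans (coeff-no c {b ∷ β} {b ∷ α} (¬e ∘ ∷-injectiveʳ)) (sym (coeff-no c ¬e))

coeff-push-no : ∀ {n a b} (p : Poly n) α → b ≢ a → coeff (List.map (push b) p) (a ∷ α) ≡ 0ℤ
coeff-push-no []                    α h = refl
coeff-push-no {a = a} {b} ((c , β) ∷ p) α h = trans (coeff-∷ (c , b ∷ β) (List.map (push b) p) (a ∷ α))
  (cong₂ ℤ._+_ (coeff-no c (h ∘ ∷-injectiveˡ)) (coeff-push-no p α h))

∂term-push : ∀ {n} i c b (β : Vec ℕ n) → ∂term (suc i) (c , b ∷ β) ≡ List.map (push b) (∂term i (c , β))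
∂term-push i c b β = trans
  (cong₂ _++_ (ListP.map-∘ (upTo (getE β i ∸ getE β (suc i)))) (ListP.map-∘ (upTo (getE β (suc i) ∸ getE β i))))
  (sym (ListP.map-++ (push b) (List.map _ (upTo (getE β i ∸ getE β (suc i)))) _))

-- The terms of (x^(l+m) y^q - x^l y^(q+m)) / (x - y), times c and the monomial β. Keeping q apart
-- from l makes the tail of the list an instance of the same form.
tele : ∀ {n} → ℤ → Vec ℕ n → ℕ → ℕ → ℕ → Poly (suc (suc n))
tele c β l zero    q = []
tele c β l (suc m) q = (c , l + m ∷ q ∷ β) ∷ tele c β l m (suc q)

applyUpTo-cong : ∀ {A : Set} {f g : ℕ → A} → f ≗ g → ∀ m → applyUpTo f m ≡ applyUpTo g m
applyUpTo-cong e zero    = refl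
applyUpTo-cong e (suc m) = cong₂ _∷_ (e 0) (applyUpTo-cong (e ∘ suc) m)

applyUpTo-tele : ∀ {n} c (β : Vec ℕ n) l m q →
                 applyUpTo (λ k → c , (l + m ∸ 1 ∸ k) ∷ q + k ∷ β) m ≡ tele c β l m q
applyUpTo-tele c β l zero    q = refl
applyUpTo-tele c β l (suc m) q = cong₂ _∷_
  (cong₂ (λ a b → c , a ∷ b ∷ β) (cong (_∸ 1) (ℕP.+-suc l m)) (ℕP.+-identityʳ q))
  (trans (applyUpTo-cong (λ k → cong₂ (λ a b → c , a ∷ b ∷ β)
           (trans (cong (λ t → t ∸ 1 ∸ suc k) (ℕP.+-suc l m)) (sym (ℕP.∸-+-assoc (l + m) 1 k)))
           (ℕP.+-suc q k)) m)
         (applyUpTo-tele c β l m (suc q)))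

upTo-tele : ∀ {n} c (β : Vec ℕ n) l m →
            List.map (λ k → c , (l + m ∸ 1 ∸ k) ∷ l + k ∷ β) (upTo m) ≡ tele c β l m l
upTo-tele c β l m = trans (ListP.map-applyUpTo id _ m) (applyUpTo-tele c β l m l)

-- Coefficient at (p , q) of κ·xᵃyᵇ
kron : ℤ → ℕ → ℕ → ℕ → ℕ → ℤ
kron κ a b p q = if (a ≡ᵇ p) ∧ (b ≡ᵇ q) then κ else 0ℤ

kron-zero : ∀ κ a b p → kron κ a (suc b) p 0 ≡ 0ℤ
kron-zero κ a b p = cong (if_then κ else 0ℤ) (∧-zeroʳ (a ≡ᵇ p))

kron-comm : ∀ κ a b p q → kron κ a b p q ≡ kron κ b a q p
kron-comm κ a b p q = cong (if_then κ else 0ℤ) (∧-comm (a ≡ᵇ p) (b ≡ᵇ q))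

≡ᵇ-refl : ∀ a → (a ≡ᵇ a) ≡ true
≡ᵇ-refl zero    = refl
≡ᵇ-refl (suc a) = ≡ᵇ-refl a

≢⇒≡ᵇ : ∀ a p → a ≢ p → (a ≡ᵇ p) ≡ false
≢⇒≡ᵇ zero    zero    h = contradiction refl h
≢⇒≡ᵇ zero    (suc p) h = refl
≢⇒≡ᵇ (suc a) zero    h = refl
≢⇒≡ᵇ (suc a) (suc p) h = ≢⇒≡ᵇ a p (h ∘ cong suc)

kron-self : ∀ κ a b → kron κ a b a b ≡ κ
kron-self κ a b rewrite ≡ᵇ-refl a | ≡ᵇ-refl b = refl

kron-no₁ : ∀ κ {a p} b q → a ≢ p → kron κ a b p q ≡ 0ℤ
kron-no₁ κ {a} {p} b q h rewrite ≢⇒≡ᵇ a p h = refl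

kron-no₂ : ∀ κ {b q} a p → b ≢ q → kron κ a b p q ≡ 0ℤ
kron-no₂ κ {b} {q} a p h = trans (kron-comm κ a b p q) (kron-no₁ κ a p h)

coeff-kron : ∀ {n} c a b (β : Vec ℕ n) p q α →
             coeff ((c , a ∷ b ∷ β) ∷ []) (p ∷ q ∷ α) ≡ kron (coeff ((c , β) ∷ []) α) a b p q
coeff-kron c a b β p q α = by (a ℕ.≟ p) (b ℕ.≟ q)
  where
  κ = coeff ((c , β) ∷ []) α
  by : Dec (a ≡ p) → Dec (b ≡ q) → coeff ((c , a ∷ b ∷ β) ∷ []) (p ∷ q ∷ α) ≡ kron κ a b p q
  by (no a≢p) _          = trans (coeff-no c {a ∷ b ∷ β} {p ∷ q ∷ α} (a≢p ∘ ∷-injectiveˡ)) (sym (kron-no₁ κ b q a≢p))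
  by (yes _)  (no b≢q)   = trans (coeff-no c {a ∷ b ∷ β} {p ∷ q ∷ α} (b≢q ∘ ∷-injectiveˡ ∘ ∷-injectiveʳ)) (sym (kron-no₂ κ a p b≢q))
  by (yes refl) (yes refl) = trans (coeff-push-yes a ((c , b ∷ β) ∷ []) (b ∷ α))
    (trans (coeff-push-yes b ((c , β) ∷ []) α) (sym (kron-self κ a b)))

module _ {n} (c : ℤ) (β α : Vec ℕ n) where
  private
    κ : ℤ
    κ = coeff ((c , β) ∷ []) α

    g : ℕ → ℕ → ℕ → ℕ → ℕ → ℤ
    g l m q₀ p q = coeff (tele c β l m q₀) (p ∷ q ∷ α)

    g-suc : ∀ l m q₀ p q → g l (suc m) q₀ p q ≡ kron κ (l + m) q₀ p q ℤ.+ g l m (suc q₀) p q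
    g-suc l m q₀ p q = trans (coeff-∷ (c , l + m ∷ q₀ ∷ β) (tele c β l m (suc q₀)) (p ∷ q ∷ α))
      (cong (λ z → z ℤ.+ g l m (suc q₀) p q) (coeff-kron c (l + m) q₀ β p q α))

    -- Together with `g-step` this is (x - y) · `tele` = x^(l+m) y^q₀ - x^l y^(q₀+m), coefficient by
    -- coefficient and in the shape of the recursion of `d`.
    g-zero : ∀ l m q₀ p → g l m q₀ p 0 ≡ kron κ (l + m) q₀ (suc p) 0 ℤ.- kron κ l (q₀ + m) (suc p) 0
    g-zero l zero    q₀ p = sym (trans (cong₂ (λ a b → kron κ a q₀ (suc p) 0 ℤ.- kron κ l b (suc p) 0) (ℕP.+-identityʳ l) (ℕP.+-identityʳ q₀)) (ℤP.+-inverseʳ (kron κ l q₀ (suc p) 0)))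
    g-zero l (suc m) q₀ p = begin
      g l (suc m) q₀ p 0
        ≡⟨ g-suc l m q₀ p 0 ⟩
      kron κ (l + m) q₀ p 0 ℤ.+ g l m (suc q₀) p 0
        ≡⟨ cong (ℤ._+_ (kron κ (l + m) q₀ p 0)) (trans (g-zero l m (suc q₀) p) (cong (λ z → z ℤ.- kron κ l (suc q₀ + m) (suc p) 0) (kron-zero κ (l + m) q₀ (suc p)))) ⟩
      kron κ (l + m) q₀ p 0 ℤ.+ (0ℤ ℤ.- kron κ l (suc q₀ + m) (suc p) 0)
        ≡⟨ cong (ℤ._+_ (kron κ (l + m) q₀ p 0)) (ℤP.+-identityˡ _) ⟩
      -- Raising both x-exponents of the first `kron` by one is definitional, since `≡ᵇ` computes on
      -- successors.
      kron κ (suc (l + m)) q₀ (suc p) 0 ℤ.- kron κ l (suc q₀ + m) (suc p) 0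
        ≡⟨ cong₂ (λ a b → kron κ a q₀ (suc p) 0 ℤ.- kron κ l b (suc p) 0) (sym (ℕP.+-suc l m)) (sym (ℕP.+-suc q₀ m)) ⟩
      kron κ (l + suc m) q₀ (suc p) 0 ℤ.- kron κ l (q₀ + suc m) (suc p) 0 ∎
      where open ≡-Reasoning

    g-step : ∀ l m q₀ p q → g l m q₀ p (suc q) ≡
      (kron κ (l + m) q₀ (suc p) (suc q) ℤ.- kron κ l (q₀ + m) (suc p) (suc q)) ℤ.+ g l m q₀ (suc p) q
    g-step l zero    q₀ p q = sym (trans (ℤP.+-identityʳ _) (trans (cong₂ (λ a b → kron κ a q₀ (suc p) (suc q) ℤ.- kron κ l b (suc p) (suc q)) (ℕP.+-identityʳ l) (ℕP.+-identityʳ q₀)) (ℤP.+-inverseʳ (kron κ l q₀ (suc p) (suc q)))))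
    g-step l (suc m) q₀ p q = begin
      g l (suc m) q₀ p (suc q)
        ≡⟨ g-suc l m q₀ p (suc q) ⟩
      kron κ (l + m) q₀ p (suc q) ℤ.+ g l m (suc q₀) p (suc q)
        ≡⟨ cong (ℤ._+_ (kron κ (l + m) q₀ p (suc q))) (g-step l m (suc q₀) p q) ⟩
      kron κ (l + m) q₀ p (suc q) ℤ.+ ((kron κ (l + m) q₀ (suc p) q ℤ.- kron κ l (suc q₀ + m) (suc p) (suc q)) ℤ.+ g l m (suc q₀) (suc p) q)
        ≡⟨ regroup (kron κ (l + m) q₀ p (suc q)) (kron κ (l + m) q₀ (suc p) q) (kron κ l (suc q₀ + m) (suc p) (suc q)) (g l m (suc q₀) (suc p) q) ⟩
      (kron κ (suc (l + m)) q₀ (suc p) (suc q) ℤ.- kron κ l (suc q₀ + m) (suc p) (suc q)) ℤ.+ (kron κ (l + m) q₀ (suc p) q ℤ.+ g l m (suc q₀) (suc p) q)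
        ≡⟨ cong₂ ℤ._+_ (cong₂ (λ a b → kron κ a q₀ (suc p) (suc q) ℤ.- kron κ l b (suc p) (suc q)) (sym (ℕP.+-suc l m)) (sym (ℕP.+-suc q₀ m))) (sym (g-suc l m q₀ (suc p) q)) ⟩
      _ ∎
      where
      open ≡-Reasoning
      regroup : ∀ a b e f → a ℤ.+ ((b ℤ.- e) ℤ.+ f) ≡ (a ℤ.- e) ℤ.+ (b ℤ.+ f)
      regroup = solve-∀

  coeff-tele : ∀ l m p q → coeff (tele c β l m l) (p ∷ q ∷ α) ≡ d (kron κ (l + m) l) p q
  coeff-tele l m p zero    = trans (g-zero l m l p)
    (cong (λ z → kron κ (l + m) l (suc p) 0 ℤ.- z) (kron-comm κ l (l + m) (suc p) 0))
  coeff-tele l m p (suc q) = trans (g-step l m l p q)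
    (cong₂ ℤ._+_ (cong (λ z → kron κ (l + m) l (suc p) (suc q) ℤ.- z) (kron-comm κ l (l + m) (suc p) (suc q)))
                 (coeff-tele l m (suc p) q))

coeff-neg : ∀ {n} c (β α : Vec ℕ n) → coeff ((ℤ.- c , β) ∷ []) α ≡ ℤ.- coeff ((c , β) ∷ []) α
coeff-neg c β α with ≡-dec ℕ._≟_ β α
... | yes _ = trans (ℤP.+-identityʳ (ℤ.- c)) (cong ℤ.-_ (sym (ℤP.+-identityʳ c)))
... | no  _ = refl

kron-neg : ∀ κ a b p q → kron (ℤ.- κ) a b p q ≡ ℤ.- kron κ a b p q
kron-neg κ a b p q with (a ≡ᵇ p) ∧ (b ≡ᵇ q)
... | true  = refl
... | false = refl

-- Reduces monomials with the larger exponent on the right to those with it on the left.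
d-flip : ∀ f p q → d (λ a b → ℤ.- f b a) p q ≡ d f p q
d-flip f p zero    = lem (f 0 (suc p)) (f (suc p) 0)
  where lem : ∀ x y → ℤ.- x ℤ.- ℤ.- y ≡ y ℤ.- x
        lem = solve-∀
d-flip f p (suc q) = cong₂ ℤ._+_ (lem (f (suc q) (suc p)) (f (suc p) (suc q))) (d-flip f (suc p) q)
  where lem : ∀ x y → ℤ.- x ℤ.- ℤ.- y ≡ y ℤ.- x
        lem = solve-∀

∂term-≥ : ∀ {n} c (β : Vec ℕ n) l m → ∂term 0 (c , l + m ∷ l ∷ β) ≡ tele c β l m l
∂term-≥ c β l m rewrite ℕP.m+n∸m≡n l m | ℕP.m≤n⇒m∸n≡0 (ℕP.m≤m+n l m) =
  trans (ListP.++-identityʳ _) (upTo-tele c β l m)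

∂term-≤ : ∀ {n} c (β : Vec ℕ n) l m → ∂term 0 (c , l ∷ l + m ∷ β) ≡ tele (ℤ.- c) β l m l
∂term-≤ c β l m rewrite ℕP.m+n∸m≡n l m | ℕP.m≤n⇒m∸n≡0 (ℕP.m≤m+n l m) = upTo-tele (ℤ.- c) β l m

coeff-∂term-here : ∀ {n} c x y (β : Vec ℕ n) p q α →
  coeff (∂term 0 (c , x ∷ y ∷ β)) (p ∷ q ∷ α) ≡ d (λ a b → coeff ((c , x ∷ y ∷ β) ∷ []) (a ∷ b ∷ α)) p q
coeff-∂term-here c x y β p q α with ℕP.≤-total y x
... | inj₁ y≤x with m , refl ← ℕP.m≤n⇒∃[o]m+o≡n y≤x
  = trans (cong (λ l → coeff l (p ∷ q ∷ α)) (∂term-≥ c β y m))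
      (trans (coeff-tele c β α y m p q) (d-cong (λ a b → sym (coeff-kron c (y + m) y β a b α)) p q))
... | inj₂ x≤y with m , refl ← ℕP.m≤n⇒∃[o]m+o≡n x≤y
  = trans (cong (λ l → coeff l (p ∷ q ∷ α)) (∂term-≤ c β x m))
      (trans (coeff-tele (ℤ.- c) β α x m p q)
      (trans (d-cong (λ a b → trans (cong (λ κ → kron κ (x + m) x a b) (coeff-neg c β α))
               (trans (kron-neg (coeff ((c , β) ∷ []) α) (x + m) x a b)
                 (cong ℤ.-_ (trans (kron-comm (coeff ((c , β) ∷ []) α) (x + m) x a b) (sym (coeff-kron c x (x + m) β b a α)))))) p q)
      (d-flip (λ a b → coeff ((c , x ∷ x + m ∷ β) ∷ []) (a ∷ b ∷ α)) p q)))

-- The range condition matters: for the last variable `getE` reads a missing exponent as 0, and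
-- `∂term` may list terms although `D` vanishes.
coeff-∂term : ∀ {n} i c (β α : Vec ℕ n) → suc i < n → coeff (∂term i (c , β)) α ≡ D i (coeff ((c , β) ∷ [])) α
coeff-∂term zero    c (x ∷ y ∷ β) (p ∷ q ∷ α) h = coeff-∂term-here c x y β p q α
coeff-∂term zero    c (x ∷ [])    (p ∷ [])    (s≤s ())
coeff-∂term (suc i) c (b ∷ β) (a ∷ α) (s≤s h) = trans (cong (λ l → coeff l (a ∷ α)) (∂term-push i c b β)) (by (b ℕ.≟ a))
  where
  by : Dec (b ≡ a) → coeff (List.map (push b) (∂term i (c , β))) (a ∷ α) ≡ D i (λ u → coeff ((c , b ∷ β) ∷ []) (a ∷ u)) α
  by (yes refl) = trans (coeff-push-yes b (∂term i (c , β)) α) (trans (coeff-∂term i c β α h)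
                    (D-cong i (λ u → sym (coeff-push-yes b ((c , β) ∷ []) u)) α))
  by (no b≢a)   = trans (coeff-push-no (∂term i (c , β)) α b≢a)
                    (sym (trans (D-cong i (λ u → coeff-push-no ((c , β) ∷ []) u b≢a) α) (D-zero i α)))

coeff-∂ : ∀ {n} i (p : Poly n) α → suc i < n → coeff (∂ i p) α ≡ D i (coeff p) α
coeff-∂ i []            α h = sym (D-zero i α)
coeff-∂ i ((c , β) ∷ p) α h = trans (coeff-++ (∂term i (c , β)) (∂ i p) α)
  (trans (cong₂ ℤ._+_ (coeff-∂term i c β α h) (coeff-∂ i p α h))
    (trans (sym (D-+ i (coeff ((c , β) ∷ [])) (coeff p) α))
      (D-cong i (λ u → sym (coeff-∷ (c , β) p u)) α)))

-- Multiplication by 1 - xⱼ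

up : ∀ {n} → ℕ → Vec ℕ n → Vec ℕ n
up j α = setE α j (suc (getE α j))

up-injective : ∀ {n} j {α β : Vec ℕ n} → up j α ≡ up j β → α ≡ β
up-injective j       {[]}    {[]}    e = refl
up-injective zero    {a ∷ α} {b ∷ β} e = cong₂ _∷_ (ℕP.suc-injective (∷-injectiveˡ e)) (∷-injectiveʳ e)
up-injective (suc j) {a ∷ α} {b ∷ β} e = cong₂ _∷_ (∷-injectiveˡ e) (up-injective j (∷-injectiveʳ e))

up-preimage : ∀ {n} j (β : Vec ℕ n) → j < n →
              (∃[ γ ] up j γ ≡ β × tailSum 0 β ≡ suc (tailSum 0 γ)) ⊎ (∀ α → up j α ≢ β)
up-preimage zero    (zero ∷ β)  h = inj₂ λ { (a ∷ α) () }
up-preimage zero    (suc b ∷ β) h = inj₁ (b ∷ β , refl , refl)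
up-preimage (suc j) (b ∷ β) (s≤s h) with up-preimage j β h
... | inj₁ (γ , e , s) = inj₁ (b ∷ γ , cong (b ∷_) e , trans (cong (b +_) s) (ℕP.+-suc b _))
... | inj₂ none        = inj₂ λ { (a ∷ α) e → none α (∷-injectiveʳ e) }

-- The map is a parameter known by its values because the one inside `oneMinusX` is anonymous.
module _ {n} (j : ℕ) (f : ℤ × Vec ℕ n → ℤ × Vec ℕ n) (f≡ : ∀ c α → f (c , α) ≡ (ℤ.- c , up j α)) where

  coeff-map-up : ∀ p γ → coeff (List.map f p) (up j γ) ≡ ℤ.- coeff p γ
  coeff-map-up []            γ = refl
  coeff-map-up ((c , β) ∷ p) γ rewrite f≡ c β = trans (coeff-∷ (ℤ.- c , up j β) (List.map f p) (up j γ))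
    (trans (cong₂ ℤ._+_ (single (≡-dec ℕ._≟_ β γ)) (coeff-map-up p γ))
    (trans (sym (ℤP.neg-distrib-+ (coeff ((c , β) ∷ []) γ) (coeff p γ)))
           (cong ℤ.-_ (sym (coeff-∷ (c , β) p γ)))))
    where
    single : Dec (β ≡ γ) → coeff ((ℤ.- c , up j β) ∷ []) (up j γ) ≡ ℤ.- coeff ((c , β) ∷ []) γ
    single (yes e) = trans (coeff-yes (ℤ.- c) (cong (up j) e)) (cong ℤ.-_ (sym (coeff-yes c e)))
    single (no ¬e) = trans (coeff-no (ℤ.- c) (¬e ∘ up-injective j)) (cong ℤ.-_ (sym (coeff-no c ¬e)))

  coeff-map-up-none : ∀ p β → (∀ α → up j α ≢ β) → coeff (List.map f p) β ≡ 0ℤ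
  coeff-map-up-none []            β h = refl
  coeff-map-up-none ((c , γ) ∷ p) β h rewrite f≡ c γ = trans (coeff-∷ (ℤ.- c , up j γ) (List.map f p) β)
    (cong₂ ℤ._+_ (coeff-no (ℤ.- c) (h γ)) (coeff-map-up-none p β h))

  coeff-map-up-low : ∀ {ℓ} p → j < n → (∀ α → tailSum 0 α < ℓ → coeff p α ≡ 0ℤ) →
                     ∀ β → tailSum 0 β ≤ ℓ → coeff (List.map f p) β ≡ 0ℤ
  coeff-map-up-low p j<n low β h with up-preimage j β j<n
  ... | inj₂ none         = coeff-map-up-none p β none
  ... | inj₁ (γ , refl , s) = trans (coeff-map-up p γ) (cong ℤ.-_ (low γ (subst (_≤ _) s h)))

-- The lowest-degree part of a Grothendieck polynomial

Lowest : ∀ {n} → ℕ → Poly n → Ser n → Set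
Lowest ℓ p f = (∀ α → tailSum 0 α < ℓ → coeff p α ≡ 0ℤ) × (∀ α → tailSum 0 α ≡ ℓ → coeff p α ≡ f α)

-- A nonzero difference at α would come from an exponent of f - g exactly one degree higher.
D-local : ∀ {n} i (f g : Ser n) α → (∀ β → tailSum 0 β ≡ suc (tailSum 0 α) → f β ≡ g β) → D i f α ≡ D i g α
D-local i f g α h with D i (λ u → f u ℤ.- g u) α ℤ.≟ 0ℤ
... | yes z = ℤP.i-j≡0⇒i≡j _ _ (trans (sym (D-- i f g α)) z)
... | no nz with β , l , nz′ ← D-supp i _ α nz = contradiction (ℤP.i≡j⇒i-j≡0 (h β (tailSum-line l z≤n))) nz′

-- The product with xᵢ₊₁ starts in degree ℓ + 2, so 1 - xᵢ₊₁ leaves degree ℓ + 1 alone, and only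
-- that degree feeds degree ℓ of the divided difference.
Lowest-∂ : ∀ {n i ℓ} {p : Poly n} {f} → suc i < n → Lowest (suc ℓ) p f → Lowest ℓ (∂ i (oneMinusX (suc i) p)) (D i f)
Lowest-∂ {n} {i} {ℓ} {p} {f} v (low , eq) = low′ , eq′
  where
  reduce : ∀ β → tailSum 0 β ≤ suc ℓ → coeff (oneMinusX (suc i) p) β ≡ coeff p β
  reduce β h = trans (coeff-++ p _ β)
    (trans (cong (ℤ._+_ (coeff p β)) (coeff-map-up-low (suc i) _ (λ _ _ → refl) p v low β h)) (ℤP.+-identityʳ _))
  low′ : ∀ α → tailSum 0 α < ℓ → coeff (∂ i (oneMinusX (suc i) p)) α ≡ 0ℤ
  low′ α h = trans (coeff-∂ i (oneMinusX (suc i) p) α v) (trans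
    (D-local i _ (λ _ → 0ℤ) α λ β e → trans (reduce β (subst (_≤ suc ℓ) (sym e) (s≤s (ℕP.<⇒≤ h)))) (low β (subst (_< suc ℓ) (sym e) (s≤s h))))
    (D-zero i α))
  eq′ : ∀ α → tailSum 0 α ≡ ℓ → coeff (∂ i (oneMinusX (suc i) p)) α ≡ D i f α
  eq′ α h = trans (coeff-∂ i (oneMinusX (suc i) p) α v)
    (D-local i _ f α λ β e → trans (reduce β (ℕP.≤-reflexive (trans e (cong suc h)))) (eq β (trans e (cong suc h))))

FirstAsc : ∀ {n} → ℕ → Vec ℕ n → Set
FirstAsc i v = Asc i v × (∀ k → k < i → ¬ Asc k v)

-- Keeps the very term lists of `grothF`, so that it serves both for coefficients and for bounds on
-- all listed terms.
data IsG {n} : Vec ℕ n → Poly n → Set where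
  top  : ∀ {v} → NoAscFrom 0 v → IsG v ((1ℤ , rho n) ∷ [])
  step : ∀ {v i p} → FirstAsc i v → IsG (swp i v) p → IsG v (∂ i (oneMinusX (suc i) p))

Asc-bound : ∀ {n i} {v : Vec ℕ n} → Asc i v → suc i < n
Asc-bound (here _)  = s≤s (s≤s z≤n)
Asc-bound (there a) = s≤s (Asc-bound a)

IsG-lowest : ∀ {n} {v : Vec ℕ n} {p} → IsG v p → Unique v → ∃[ f ] IsS v f × Lowest (tailSum 0 (code v)) p f
IsG-lowest {n} {v} (top na) u = _ , top na , low , λ _ _ → refl
  where
  low : ∀ α → tailSum 0 α < tailSum 0 (code v) → coeff ((1ℤ , rho n) ∷ []) α ≡ 0ℤ
  low α h = coeff-no 1ℤ {rho n} {α} λ { refl → ℕP.<-irrefl (cong (tailSum 0) (sym (code-noAsc na u))) h }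
IsG-lowest (step {i = i} {p} (a , _) g) u with f , s , l ← IsG-lowest g (Unique-swp i u) =
  D i f , step a s , Lowest-∂ {p = p} (Asc-bound a) (subst (λ ℓ → Lowest ℓ p f) (tailSum-code a z≤n) l)

-- One-line notation and the recursion on permutations

vals : ∀ {n} → Permutation′ n → Vec ℕ n
vals w = tabulate (toℕ ∘ (w ⟨$⟩ʳ_))

Asc-tabulate⁺ : ∀ {n} {h : Fin n → ℕ} i j → toℕ j ≡ suc (toℕ i) → h i < h j → Asc (toℕ i) (tabulate h)
Asc-tabulate⁺ zero    (suc zero) e l = here l
Asc-tabulate⁺ (suc i) (suc j)    e l = there (Asc-tabulate⁺ i j (ℕP.suc-injective e) l)

Asc-tabulate⁻ : ∀ {n} {h : Fin n → ℕ} i j → toℕ j ≡ suc (toℕ i) → Asc (toℕ i) (tabulate h) → h i < h j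
Asc-tabulate⁻ zero    (suc zero) e (here l)  = l
Asc-tabulate⁻ (suc i) (suc j)    e (there a) = Asc-tabulate⁻ i j (ℕP.suc-injective e) a

swp-tabulate : ∀ {n} {g h : Fin n → ℕ} i j → toℕ j ≡ suc (toℕ i) → g i ≡ h j → g j ≡ h i →
               (∀ x → x ≢ i → x ≢ j → g x ≡ h x) → tabulate g ≡ swp (toℕ i) (tabulate h)
swp-tabulate zero (suc zero) e gi gj rest =
  cong₂ _∷_ gi (cong₂ _∷_ gj (tabulate-cong λ x → rest (suc (suc x)) (λ ()) (λ ())))
swp-tabulate (suc i) (suc j) e gi gj rest =
  cong₂ _∷_ (rest zero (λ ()) (λ ()))
    (swp-tabulate i j (ℕP.suc-injective e) gi gj λ x a b → rest (suc x) (a ∘ FinP.suc-injective) (b ∘ FinP.suc-injective))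

transpose-left : ∀ {n} (i j : Fin n) → PC.transpose i j i ≡ j
transpose-left i j rewrite dec-true (i Fin.≟ i) refl = refl

transpose-right : ∀ {n} {i j : Fin n} → j ≢ i → PC.transpose i j j ≡ i
transpose-right {i = i} {j} h rewrite dec-false (j Fin.≟ i) h | dec-true (j Fin.≟ j) refl = refl

transpose-other : ∀ {n} {i j k : Fin n} → k ≢ i → k ≢ j → PC.transpose i j k ≡ k
transpose-other {i = i} {j} {k} h h′ rewrite dec-false (k Fin.≟ i) h | dec-false (k Fin.≟ j) h′ = refl

vals-transpose : ∀ {n} (w : Permutation′ n) i j → toℕ j ≡ suc (toℕ i) →
                 vals (transpose i j ∘ₚ w) ≡ swp (toℕ i) (vals w)
vals-transpose w i j e = swp-tabulate i j e
  (cong (λ x → toℕ (w ⟨$⟩ʳ x)) (transpose-left i j))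
  (cong (λ x → toℕ (w ⟨$⟩ʳ x)) (transpose-right {i = i} {j} λ { refl → ℕP.1+n≢n (sym e) }))
  (λ x a b → cong (λ x → toℕ (w ⟨$⟩ʳ x)) (transpose-other a b))

-- The omitted bodies are solved by unification with the where-bound functions of
-- firstAscent and adjPairs, which have no name outside Defs.
mutual
  ascentIn : ∀ {n} → Permutation′ n → List (Fin n × Fin n) → Maybe (Fin n × Fin n)
  ascentIn = _

  firstAscent-unfold : ∀ {n} (w : Permutation′ n) → firstAscent w ≡ ascentIn w (adjPairs n)
  firstAscent-unfold {n} w with adjPairs n
  ... | ps = refl

mutual
  adjPair : (n : ℕ) → ℕ → Maybe (Fin n × Fin n)
  adjPair = _

  adjPairs-unfold : ∀ n → adjPairs n ≡ List.mapMaybe (adjPair n) (upTo n)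
  adjPairs-unfold n with upTo n
  ... | ks = refl

ascentIn-no : ∀ {n} (w : Permutation′ n) i j ps → ¬ ((w ⟨$⟩ʳ i) Fin.< (w ⟨$⟩ʳ j)) →
              ascentIn w ((i , j) ∷ ps) ≡ ascentIn w ps
ascentIn-no w i j ps h with (w ⟨$⟩ʳ i) Fin.<? (w ⟨$⟩ʳ j)
... | yes p = contradiction p h
... | no _  = refl

ascentIn-yes : ∀ {n} (w : Permutation′ n) i j ps → (w ⟨$⟩ʳ i) Fin.< (w ⟨$⟩ʳ j) →
               ascentIn w ((i , j) ∷ ps) ≡ just (i , j)
ascentIn-yes w i j ps h with (w ⟨$⟩ʳ i) Fin.<? (w ⟨$⟩ʳ j)
... | yes p = refl
... | no ¬p = contradiction h ¬p

FirstAscentSpec : ∀ {n} → Permutation′ n → Maybe (Fin n × Fin n) → Set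
FirstAscentSpec w nothing        = NoAscFrom 0 (vals w)
FirstAscentSpec w (just (i , j)) = toℕ j ≡ suc (toℕ i) × FirstAsc (toℕ i) (vals w)

none-suc : ∀ {k} {P : ℕ → Set} → (∀ l → l < k → ¬ P l) → ¬ P k → ∀ l → l < suc k → ¬ P l
none-suc none ¬Pk l l<1+k with ℕP.m≤n⇒m<n∨m≡n (s≤s⁻¹ l<1+k)
... | inj₁ l<k  = none l l<k
... | inj₂ refl = ¬Pk

-- `upTo` unfolds into shifts of its index function, hence the general f with f r = k + r.
firstAscent-walk : ∀ {n} (w : Permutation′ n) k m (f : ℕ → ℕ) → (∀ r → f r ≡ k + r) → k + m ≡ n →
                   (∀ l → l < k → ¬ Asc l (vals w)) →
                   FirstAscentSpec w (ascentIn w (List.mapMaybe (adjPair n) (applyUpTo f m)))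
firstAscent-walk w k zero f f≡ e none i _ a =
  none i (ℕP.<-≤-trans (ℕP.<-trans (ℕP.n<1+n i) (Asc-bound a)) (ℕP.≤-reflexive (trans (sym e) (ℕP.+-identityʳ k)))) a
firstAscent-walk {n} w k (suc m) f f≡ e none rewrite trans (f≡ 0) (ℕP.+-identityʳ k) with suc k ℕ.<? n
... | no ≮n = firstAscent-walk w (suc k) m (f ∘ suc) (λ r → trans (f≡ (suc r)) (ℕP.+-suc k r)) (trans (sym (ℕP.+-suc k m)) e)
                (none-suc none (≮n ∘ Asc-bound))
... | yes p = by (toℕ (w ⟨$⟩ʳ i) ℕ.<? toℕ (w ⟨$⟩ʳ j))
  where
  i j : Fin n
  i = fromℕ< (ℕP.<-trans (ℕP.n<1+n k) p)
  j = fromℕ< p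
  ps : List (Fin n × Fin n)
  ps = List.mapMaybe (adjPair n) (applyUpTo (f ∘ suc) m)
  i≡k : toℕ i ≡ k
  i≡k = FinP.toℕ-fromℕ< _
  j≡ : toℕ j ≡ suc (toℕ i)
  j≡ = trans (FinP.toℕ-fromℕ< p) (cong suc (sym i≡k))
  by : Dec (toℕ (w ⟨$⟩ʳ i) < toℕ (w ⟨$⟩ʳ j)) → FirstAscentSpec w (ascentIn w ((i , j) ∷ ps))
  by (yes l) = subst (FirstAscentSpec w) (sym (ascentIn-yes w i j ps l))
    (j≡ , Asc-tabulate⁺ i j j≡ l , λ l l<i → none l (subst (l <_) i≡k l<i))
  by (no ¬l) = subst (FirstAscentSpec w) (sym (ascentIn-no w i j ps ¬l))
    (firstAscent-walk w (suc k) m (f ∘ suc) (λ r → trans (f≡ (suc r)) (ℕP.+-suc k r)) (trans (sym (ℕP.+-suc k m)) e)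
      (none-suc none λ a → ¬l (Asc-tabulate⁻ i j j≡ (subst (λ t → Asc t (vals w)) (sym i≡k) a))))

firstAscent-spec : ∀ {n} (w : Permutation′ n) → FirstAscentSpec w (firstAscent w)
firstAscent-spec {n} w = subst (FirstAscentSpec w)
  (sym (trans (firstAscent-unfold w) (cong (ascentIn w) (adjPairs-unfold n))))
  (firstAscent-walk w 0 n id (λ _ → refl) refl λ _ ())

rho-tabulate : ∀ n → tabulate {n = n} (λ j → n ∸ 1 ∸ toℕ j) ≡ rho n
rho-tabulate zero    = refl
rho-tabulate (suc n) = cong (n ∷_) (trans (tabulate-cong (λ j → sym (ℕP.∸-+-assoc n 1 (toℕ j)))) (rho-tabulate n))

-- Each step removes one non-inversion, so the fuel never runs out and the default `[]` is not
-- reached.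
grothF-IsG : ∀ {n} k (w : Permutation′ n) → nasc (vals w) < k → IsG (vals w) (grothF k w)
grothF-IsG {n} (suc k) w h with firstAscent w | firstAscent-spec w
... | nothing      | na = subst (λ r → IsG (vals w) ((1ℤ , r) ∷ [])) (sym (rho-tabulate n)) (top na)
... | just (i , j) | e , fa@(a , _) rewrite e =
  step fa (subst (λ v → IsG v (grothF k (transpose i j ∘ₚ w))) (vals-transpose w i j e)
    (grothF-IsG k (transpose i j ∘ₚ w)
      (subst (_< k) (sym (cong nasc (vals-transpose w i j e)))
        (ℕP.≤-trans (ℕP.≤-reflexive (sym (nasc-swp a))) (s≤s⁻¹ h)))))

above-≤ : ∀ {n} a (v : Vec ℕ n) → above a v ≤ n
above-≤ a []      = z≤n
above-≤ a (x ∷ v) with a ℕ.<? x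
... | yes _ = s≤s (above-≤ a v)
... | no  _ = ℕP.m≤n⇒m≤1+n (above-≤ a v)

nasc-≤ : ∀ {n} (v : Vec ℕ n) → nasc v ≤ n * n
nasc-≤ []              = z≤n
nasc-≤ {suc n} (x ∷ v) = ℕP.+-mono-≤ (ℕP.m≤n⇒m≤1+n (above-≤ x v)) (ℕP.≤-trans (nasc-≤ v) (ℕP.*-monoʳ-≤ n (ℕP.n≤1+n n)))

groth-IsG : ∀ {n} (w : Permutation′ n) → IsG (vals w) (groth w)
groth-IsG {n} w = grothF-IsG (suc (n * n)) w (s≤s (nasc-≤ (vals w)))

⟨$⟩ʳ-injective : ∀ {n} (w : Permutation′ n) {i j} → toℕ (w ⟨$⟩ʳ i) ≡ toℕ (w ⟨$⟩ʳ j) → i ≡ j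
⟨$⟩ʳ-injective w {i} {j} e = trans (sym (inverseˡ w)) (trans (cong (w ⟨$⟩ˡ_) (FinP.toℕ-injective e)) (inverseˡ w))

vals-Unique : ∀ {n} (w : Permutation′ n) → Unique (vals w)
vals-Unique w = tabulate⁺ (⟨$⟩ʳ-injective w)

vals-cover : ∀ {n} (w : Permutation′ n) c → c < n → c ∈ vals w
vals-cover w c h = subst (_∈ vals w) (trans (cong toℕ (inverseʳ w)) (FinP.toℕ-fromℕ< h))
  (∈-tabulate⁺ (toℕ ∘ (w ⟨$⟩ʳ_)) (w ⟨$⟩ˡ fromℕ< h))

-- Pattern containment as subsequences of the one-line notation

Increasing : ∀ {k n} → (Fin k → Fin n) → Set
Increasing ι = ∀ a b → a Fin.< b → ι a Fin.< ι b

private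
  below-suc : ∀ {n k} {h : Fin (suc n) → ℕ} →
              (∀ (ι : Fin k → Fin n) → Increasing ι → Sub (List.tabulate (h ∘ suc ∘ ι)) (tabulate (h ∘ suc))) →
              (ι : Fin k → Fin (suc n)) → Increasing ι → (∀ a → 0 < toℕ (ι a)) →
              Sub (List.tabulate (h ∘ ι)) (tabulate (h ∘ suc))
  below-suc {n} {k} {h} ih ι inc pos = subst (λ xs → Sub xs (tabulate (h ∘ suc)))
    (ListP.tabulate-cong (λ a → cong h (sym (proj₂ (lower a)))))
    (ih (proj₁ ∘ lower) (λ a b l → s≤s⁻¹ (subst₂ Fin._<_ (proj₂ (lower a)) (proj₂ (lower b)) (inc a b l))))
    where
    lower : ∀ a → ∃[ b ] ι a ≡ suc b
    lower a with ι a | pos a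
    ... | suc b | _ = b , refl

Sub-tabulate⁺ : ∀ {n k} (h : Fin n → ℕ) (ι : Fin k → Fin n) → Increasing ι → Sub (List.tabulate (h ∘ ι)) (tabulate h)
Sub-tabulate⁺ {n}     {zero}  h ι inc = done
Sub-tabulate⁺ {zero}  {suc k} h ι inc with () ← ι zero
Sub-tabulate⁺ {suc n} {suc k} h ι inc = by (ι zero) refl
  where
  by : ∀ z → ι zero ≡ z → Sub (List.tabulate (h ∘ ι)) (tabulate h)
  by zero    e = subst (λ x → Sub (h x ∷ List.tabulate (h ∘ ι ∘ suc)) (tabulate h)) (sym e)
    (take (below-suc {h = h} (Sub-tabulate⁺ (h ∘ suc)) (ι ∘ suc) (λ a b l → inc (suc a) (suc b) (s≤s l))
      (λ a → ℕP.≤-<-trans z≤n (inc zero (suc a) (s≤s z≤n)))))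
  by (suc z) e = skip (below-suc {h = h} (Sub-tabulate⁺ (h ∘ suc)) ι inc pos)
    where
    pos : ∀ a → 0 < toℕ (ι a)
    pos zero    = subst (λ x → 0 < toℕ x) (sym e) (s≤s z≤n)
    pos (suc a) = ℕP.≤-<-trans z≤n (inc zero (suc a) (s≤s z≤n))

Sub-tabulate⁻ : ∀ {n} (h : Fin n → ℕ) {xs} → Sub xs (tabulate h) →
                ∃[ ι ] Increasing ι × (∀ a → h (ι a) ≡ List.lookup xs a)
Sub-tabulate⁻ h done = (λ ()) , (λ ()) , λ ()
Sub-tabulate⁻ {suc n} h (take {xs = xs} s) with ι , inc , e ← Sub-tabulate⁻ (h ∘ suc) s = ι′ , inc′ , e′
  where
  ι′ : Fin (suc (List.length xs)) → Fin (suc n)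
  ι′ zero    = zero
  ι′ (suc a) = suc (ι a)
  inc′ : Increasing ι′
  inc′ zero    (suc b) l = s≤s z≤n
  inc′ (suc a) (suc b) l = s≤s (inc a b (s≤s⁻¹ l))
  e′ : ∀ a → h (ι′ a) ≡ List.lookup (h zero ∷ xs) a
  e′ zero    = refl
  e′ (suc a) = e a
Sub-tabulate⁻ {suc n} h (skip s) with ι , inc , e ← Sub-tabulate⁻ (h ∘ suc) s =
  suc ∘ ι , (λ a b l → s≤s (inc a b l)) , e

Contains-vals⁺ : ∀ {n k} {w : Permutation′ n} {τ : Fin k → Fin k} → Contains w τ →
  ∃[ h ] Sub (List.tabulate {n = k} h) (vals w) × (∀ a b → τ a Fin.< τ b → h a < h b)
Contains-vals⁺ {w = w} (ι , inc , ord) =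
  (λ a → toℕ (w ⟨$⟩ʳ ι a)) , Sub-tabulate⁺ (toℕ ∘ (w ⟨$⟩ʳ_)) ι inc , λ a b l → proj₂ (ord a b) l

-- r lists the entries of xs in increasing order
Contains-vals⁻ : ∀ {n} {w : Permutation′ n} {xs} {τ : Fin (List.length xs) → Fin (List.length xs)} →
  Sub xs (vals w) → ∀ r → Linked _<_ r → (∀ a → List.lookup xs a ≡ Vec.lookup r (τ a)) → Contains w τ
Contains-vals⁻ {w = w} {xs} {τ} s r sorted eq with ι , inc , e ← Sub-tabulate⁻ (toℕ ∘ (w ⟨$⟩ʳ_)) s =
  ι , inc , λ a b → (λ l → down a b (subst₂ _<_ (val a) (val b) l)) ,
                    (λ l → subst₂ _<_ (sym (val a)) (sym (val b)) (lookup⁺ ℕP.<-trans sorted l))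
  where
  val : ∀ a → toℕ (w ⟨$⟩ʳ ι a) ≡ Vec.lookup r (τ a)
  val a = trans (e a) (eq a)
  down : ∀ a b → Vec.lookup r (τ a) < Vec.lookup r (τ b) → τ a Fin.< τ b
  down a b l with ℕP.<-cmp (toℕ (τ a)) (toℕ (τ b))
  ... | tri< τ< _ _ = τ<
  ... | tri≈ _ τ≡ _ = contradiction l (ℕP.<-irrefl (cong (Vec.lookup r) (FinP.toℕ-injective τ≡)))
  ... | tri> _ _ τ> = contradiction l (ℕP.<-asym (lookup⁺ ℕP.<-trans sorted τ>))

module _ {n} {w : Permutation′ n} where

  contains-1432 : ∀ {a b c e} → Sub (a ∷ b ∷ c ∷ e ∷ []) (vals w) → a < e → e < c → c < b → Contains w p1432
  contains-1432 s x y z = Contains-vals⁻ {w = w} {τ = p1432} s _ (x ∷ y ∷ z ∷ [-])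
    λ { zero → refl ; (suc zero) → refl ; (suc (suc zero)) → refl ; (suc (suc (suc zero))) → refl }

  contains-1423 : ∀ {a b c e} → Sub (a ∷ b ∷ c ∷ e ∷ []) (vals w) → a < c → c < e → e < b → Contains w p1423
  contains-1423 s x y z = Contains-vals⁻ {w = w} {τ = p1423} s _ (x ∷ y ∷ z ∷ [-])
    λ { zero → refl ; (suc zero) → refl ; (suc (suc zero)) → refl ; (suc (suc (suc zero))) → refl }

  contains-13254 : ∀ {a b c l m} → Sub (a ∷ b ∷ c ∷ l ∷ m ∷ []) (vals w) → a < c → c < b → b < m → m < l → Contains w p13254
  contains-13254 s x y z t = Contains-vals⁻ {w = w} {τ = p13254} s _ (x ∷ y ∷ z ∷ t ∷ [-])
    λ { zero → refl ; (suc zero) → refl ; (suc (suc zero)) → refl ; (suc (suc (suc zero))) → refl ; (suc (suc (suc (suc zero)))) → refl }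

  gap-of-pattern : Contains w p1432 ⊎ Contains w p1423 ⊎ Contains w p13254 → ∃[ i ] Gap i (vals w)
  gap-of-pattern (inj₁ p) with h , s , o ← Contains-vals⁺ {w = w} p =
    sub-gap (λ v u s → gap-14 v u s
      -- `o` takes positions of the pattern; the numerals compare its values there.
      (o (# 0) (# 2) (toWitness {a? = 0 ℕ.<? 2} _)) (o (# 2) (# 1) (toWitness {a? = 2 ℕ.<? 3} _))
      (o (# 0) (# 3) (toWitness {a? = 0 ℕ.<? 1} _)) (o (# 3) (# 1) (toWitness {a? = 1 ℕ.<? 3} _))) (vals-Unique w) s
  gap-of-pattern (inj₂ (inj₁ p)) with h , s , o ← Contains-vals⁺ {w = w} p =
    sub-gap (λ v u s → gap-14 v u s
      (o (# 0) (# 2) (toWitness {a? = 0 ℕ.<? 1} _)) (o (# 2) (# 1) (toWitness {a? = 1 ℕ.<? 3} _))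
      (o (# 0) (# 3) (toWitness {a? = 0 ℕ.<? 2} _)) (o (# 3) (# 1) (toWitness {a? = 2 ℕ.<? 3} _))) (vals-Unique w) s
  gap-of-pattern (inj₂ (inj₂ p)) with h , s , o ← Contains-vals⁺ {w = w} p =
    sub-gap (λ v u s → gap-13254 v u s
      (o (# 0) (# 2) (toWitness {a? = 0 ℕ.<? 1} _)) (o (# 2) (# 1) (toWitness {a? = 1 ℕ.<? 2} _))
      (o (# 1) (# 4) (toWitness {a? = 2 ℕ.<? 3} _)) (o (# 4) (# 3) (toWitness {a? = 3 ℕ.<? 4} _))) (vals-Unique w) s

-- Exponents occurring in ∂term i and oneMinusX

data Between : ∀ {n} → ℕ → Vec ℕ n → Vec ℕ n → Set where
  ge    : ∀ {n p q p′ q′} {γ : Vec ℕ n} → q′ ≤ p → p < p′ → q′ ≤ q → q < p′ → Between 0 (p′ ∷ q′ ∷ γ) (p ∷ q ∷ γ)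
  le    : ∀ {n p q p′ q′} {γ : Vec ℕ n} → p′ ≤ p → p < q′ → p′ ≤ q → q < q′ → Between 0 (p′ ∷ q′ ∷ γ) (p ∷ q ∷ γ)
  there : ∀ {n i x} {β′ β : Vec ℕ n} → Between i β′ β → Between (suc i) (x ∷ β′) (x ∷ β)

tele-All : ∀ {n} c (β : Vec ℕ n) l m q {P : ℤ × Vec ℕ (suc (suc n)) → Set} →
           (∀ p q′ → l ≤ p → p < l + m → q ≤ q′ → q′ < q + m → P (c , p ∷ q′ ∷ β)) → All P (tele c β l m q)
tele-All c β l zero    q h = []
tele-All c β l (suc m) q h =
  h (l + m) q (ℕP.m≤m+n l m) (ℕP.+-monoʳ-< l ℕP.≤-refl) ℕP.≤-refl (ℕP.m<m+n q (s≤s z≤n)) ∷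
  tele-All c β l m (suc q) λ p q′ a b e f →
    h p q′ a (ℕP.<-trans b (ℕP.+-monoʳ-< l ℕP.≤-refl)) (ℕP.<⇒≤ e) (ℕP.<-≤-trans f (ℕP.≤-reflexive (sym (ℕP.+-suc q m))))

∂term-between : ∀ {n} i c (β : Vec ℕ n) → suc i < n → All (λ t → Between i β (proj₂ t)) (∂term i (c , β))
∂term-between zero    c (x ∷ []) (s≤s ())
∂term-between zero    c (x ∷ y ∷ β) h with ℕP.≤-total y x
... | inj₁ y≤x with m , refl ← ℕP.m≤n⇒∃[o]m+o≡n y≤x =
  subst (All _) (sym (∂term-≥ c β y m)) (tele-All c β y m y λ _ _ → ge)
... | inj₂ x≤y with m , refl ← ℕP.m≤n⇒∃[o]m+o≡n x≤y =
  subst (All _) (sym (∂term-≤ c β x m)) (tele-All (ℤ.- c) β x m x λ _ _ → le)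
∂term-between (suc i) c (x ∷ β) (s≤s h) =
  subst (All _) (sym (∂term-push i c x β)) (LAllP.map⁺ (LAll.map there (∂term-between i c β h)))

-- Works on listed terms: cancellation can only shrink the support, so no coefficient is computed.
∂-All : ∀ {n} i {P Q : Vec ℕ n → Set} → suc i < n →
        (∀ β′ β″ β → P β′ → β″ ≡ β′ ⊎ β″ ≡ up (suc i) β′ → Between i β″ β → Q β) →
        ∀ p → All (P ∘ proj₂) p → All (Q ∘ proj₂) (∂ i (oneMinusX (suc i) p))
∂-All {n} i {P} {Q} v h p ps = LAllP.concat⁺ (LAllP.map⁺ (LAllP.++⁺ (LAll.map first ps) (LAllP.map⁺ (LAll.map second ps))))
  where
  first : ∀ {t} → P (proj₂ t) → All (Q ∘ proj₂) (∂term i t)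
  first {c , β′} pβ = LAll.map (h β′ β′ _ pβ (inj₁ refl)) (∂term-between i c β′ v)
  second : ∀ {t} → P (proj₂ t) → All (Q ∘ proj₂) (∂term i (ℤ.- proj₁ t , up (suc i) (proj₂ t)))
  second {c , β′} pβ = LAll.map (h β′ _ _ pβ (inj₂ refl)) (∂term-between i (ℤ.- c) (up (suc i) β′) v)

-- Avoidance

-- `no-14` merges 1432 and 1423 by leaving the order of the last two entries open.
record Avoids {n} (v : Vec ℕ n) : Set where
  field
    no-14    : ∀ {a b c e} → Sub (a ∷ b ∷ c ∷ e ∷ []) v → a < c → c < b → a < e → e < b → ⊥
    no-13254 : ∀ {a b c l m} → Sub (a ∷ b ∷ c ∷ l ∷ m ∷ []) v → a < c → c < b → b < m → m < l → ⊥
open Avoids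

Avoids-tail : ∀ {n x} {v : Vec ℕ n} → Avoids (x ∷ v) → Avoids v
Avoids-tail av = record { no-14 = λ s → no-14 av (skip s) ; no-13254 = λ s → no-13254 av (skip s) }

FirstAsc-tail : ∀ {n i x} {v : Vec ℕ n} → FirstAsc (suc i) (x ∷ v) → FirstAsc i v
FirstAsc-tail (there a , na) = a , λ k h b → na (suc k) (s≤s h) (there b)

descend : ∀ {n i x y} {v : Vec ℕ n} → FirstAsc (suc i) (x ∷ y ∷ v) → Unique (x ∷ y ∷ v) → y < x
descend (_ , na) ((x≢y ∷ _) ∷ _) = ℕP.≤∧≢⇒< (ℕP.≮⇒≥ (λ h → na 0 (s≤s z≤n) (here h))) (x≢y ∘ sym)

-- The word decreases from g to the ascent, so these entries are below x. Hence y is at the earliest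
-- the larger swapped entry, z comes after the pair, and undoing the swap keeps the subsequence.
sub-swp-above : ∀ {n i g x y z xs} {v : Vec ℕ n} → FirstAsc i (g ∷ v) → Unique (g ∷ v) → g < x → x < y → x < z →
                Sub (y ∷ z ∷ xs) (swp i (g ∷ v)) → Sub (y ∷ z ∷ xs) (g ∷ v)
sub-swp-above {i = zero} {v = b ∷ v} fa u g<x x<y x<z (take (take s)) = contradiction x<z (ℕP.<-asym g<x)
sub-swp-above {i = zero} {v = b ∷ v} fa u g<x x<y x<z (take (skip s)) = skip (take s)
sub-swp-above {i = zero} {v = b ∷ v} fa u g<x x<y x<z (skip (take s)) = take (skip s)
sub-swp-above {i = zero} {v = b ∷ v} fa u g<x x<y x<z (skip (skip s)) = skip (skip s)
sub-swp-above {i = suc i} {v = h ∷ v} fa u g<x x<y x<z (take s) = contradiction g<x (ℕP.<-asym x<y)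
sub-swp-above {i = suc i} {v = h ∷ v} fa u@(_ ∷ u′) g<x x<y x<z (skip s) =
  skip (sub-swp-above (FirstAsc-tail fa) u′ (ℕP.<-trans (descend fa u) g<x) x<y x<z s)
sub-swp-above {i = suc i} {v = []} (there () , _)

-- If x is in the swapped pair, the only new order is a descent, excluded by x < y. If x stands
-- earlier, the decreasing prefix puts the lower swapped entry below x.
sub-swp-firstAsc : ∀ {n i x y z xs} {v : Vec ℕ n} → FirstAsc i v → Unique v → x < y → x < z →
                   Sub (x ∷ y ∷ z ∷ xs) (swp i v) → Sub (x ∷ y ∷ z ∷ xs) v
sub-swp-firstAsc {v = a ∷ b ∷ v} (here a<b , _) u x<y x<z (take (take s)) = contradiction x<y (ℕP.<-asym a<b)
sub-swp-firstAsc {v = a ∷ b ∷ v} (here a<b , _) u x<y x<z (take (skip s)) = skip (take s)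
sub-swp-firstAsc {v = a ∷ b ∷ v} (here a<b , _) u x<y x<z (skip (take s)) = take (skip s)
sub-swp-firstAsc {v = a ∷ b ∷ v} (here a<b , _) u x<y x<z (skip (skip s)) = skip (skip s)
sub-swp-firstAsc {v = h ∷ g ∷ v} fa@(there _ , _) u@(_ ∷ u′) x<y x<z (take s) =
  take (sub-swp-above (FirstAsc-tail fa) u′ (descend fa u) x<y x<z s)
sub-swp-firstAsc {v = h ∷ v} fa@(there _ , _) (_ ∷ u) x<y x<z (skip s) = skip (sub-swp-firstAsc (FirstAsc-tail fa) u x<y x<z s)

Avoids-swp : ∀ {n i} {v : Vec ℕ n} → FirstAsc i v → Unique v → Avoids v → Avoids (swp i v)
Avoids-swp fa u av = record
  { no-14    = λ s a<c c<b → no-14 av (sub-swp-firstAsc fa u (ℕP.<-trans a<c c<b) a<c s) a<c c<b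
  ; no-13254 = λ s a<c c<b → no-13254 av (sub-swp-firstAsc fa u (ℕP.<-trans a<c c<b) a<c s) a<c c<b
  }

-- With M the running minimum, every smaller value of the permutation still lies ahead.
Covers : ∀ {n} → ℕ → Vec ℕ n → Set
Covers M v = ∀ c → c < M → c ∈ v

∈-swp : ∀ {n c} i {v : Vec ℕ n} → c ∈ v → c ∈ swp i v
∈-swp i       {[]}        ()
∈-swp zero    {x ∷ []}    p                             = p
∈-swp zero    {x ∷ y ∷ v} (VAny.here e)                 = VAny.there (VAny.here e)
∈-swp zero    {x ∷ y ∷ v} (VAny.there (VAny.here e))    = VAny.here e
∈-swp zero    {x ∷ y ∷ v} (VAny.there (VAny.there p))   = VAny.there (VAny.there p)
∈-swp (suc i) {x ∷ v}     (VAny.here e)                 = VAny.here e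
∈-swp (suc i) {x ∷ v}     (VAny.there p)                = VAny.there (∈-swp i p)

∈-∷⁻ : ∀ {n c x} {v : Vec ℕ n} → c ∈ x ∷ v → c ≢ x → c ∈ v
∈-∷⁻ (VAny.here e)  h = contradiction e h
∈-∷⁻ (VAny.there p) h = p

∈⇒Sub : ∀ {n c} {v : Vec ℕ n} → c ∈ v → Sub (c ∷ []) v
∈⇒Sub (VAny.here refl) = take done
∈⇒Sub (VAny.there p)   = skip (∈⇒Sub p)

sub-two : ∀ {n x y} {v : Vec ℕ n} → x ≢ y → Sub (x ∷ []) v → Sub (y ∷ []) v → Sub (x ∷ y ∷ []) v ⊎ Sub (y ∷ x ∷ []) v
sub-two h (take _) (take _) = contradiction refl h
sub-two h (take _) (skip t) = inj₁ (take t)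
sub-two h (skip s) (take _) = inj₂ (take s)
sub-two h (skip s) (skip t) with sub-two h s t
... | inj₁ r = inj₁ (skip r)
... | inj₂ r = inj₂ (skip r)

sub-insert : ∀ {n e x y} {v : Vec ℕ n} → e ≢ x → e ≢ y → Sub (e ∷ []) v → Sub (x ∷ y ∷ []) v →
             Sub (e ∷ x ∷ y ∷ []) v ⊎ Sub (x ∷ e ∷ y ∷ []) v ⊎ Sub (x ∷ y ∷ e ∷ []) v
sub-insert h h′ (take _) (take _) = contradiction refl h
sub-insert h h′ (take _) (skip t) = inj₁ (take t)
sub-insert h h′ (skip s) (take t) with sub-two h′ s t
... | inj₁ r = inj₂ (inj₁ (take r))
... | inj₂ r = inj₂ (inj₂ (take r))
sub-insert h h′ (skip s) (skip t) with sub-insert h h′ s t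
... | inj₁ r        = inj₁ (skip r)
... | inj₂ (inj₁ r) = inj₂ (inj₁ (skip r))
... | inj₂ (inj₂ r) = inj₂ (inj₂ (skip r))

up-here : ∀ {n p q p′ q′} {γ γ′ : Vec ℕ n} → p Vec.∷ q ∷ γ ≡ p′ ∷ q′ ∷ γ′ ⊎ p Vec.∷ q ∷ γ ≡ up 1 (p′ ∷ q′ ∷ γ′) →
          p ≡ p′ × (q ≡ q′ ⊎ q ≡ suc q′) × γ ≡ γ′
up-here (inj₁ refl) = refl , inj₁ refl , refl
up-here (inj₂ refl) = refl , inj₂ refl , refl

up-there : ∀ {n b b′} {γ γ′ : Vec ℕ n} j → b Vec.∷ γ ≡ b′ ∷ γ′ ⊎ b Vec.∷ γ ≡ up (suc j) (b′ ∷ γ′) → b ≡ b′ × (γ ≡ γ′ ⊎ γ ≡ up j γ′)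
up-there j (inj₁ refl) = refl , inj₁ refl
up-there j (inj₂ refl) = refl , inj₂ refl

-- With m the minimum of M and the entries of v up to position k, the exponent
-- β_k is m or m + 1, and it can be m + 1 only if some later 21 lies above m.
Inv : ∀ {n} → ℕ → Vec ℕ n → Vec ℕ n → Set
Inv M []      []      = ⊤
Inv M (a ∷ u) (b ∷ β) = M ⊓ a ≤ b × (b ≤ M ⊓ a ⊎ Inv21 (M ⊓ a) (a ∷ u) × b ≤ suc (M ⊓ a)) × Inv (M ⊓ a) u β

module _ {n a b M} {u : Vec ℕ n} (a<b : a < b) (a<M : a < M) (cov : Covers M (a ∷ b ∷ u))
         (uniq : Unique (a ∷ b ∷ u)) (av : Avoids (a ∷ b ∷ u)) where
  private
    inside : ∀ {c} → a < c → c < M → c < b → Sub (c ∷ []) u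
    inside a<c c<M c<b = ∈⇒Sub (∈-∷⁻ (∈-∷⁻ (cov _ c<M) (λ e → ℕP.<-irrefl (sym e) a<c)) (λ e → ℕP.<-irrefl e c<b))

    twice : ∀ {c e} → a < c → c < b → a < e → e < b → c ≢ e → Sub (c ∷ []) u → Sub (e ∷ []) u → ⊥
    twice a<c c<b a<e e<b c≢e s t with sub-two c≢e s t
    ... | inj₁ r = no-14 av (take (take r)) a<c c<b a<e e<b
    ... | inj₂ r = no-14 av (take (take r)) a<e e<b a<c c<b

    -- A 21 above m would complete 13254 if it lies above b and e precedes it. In all other cases a,
    -- a larger entry and two later entries between them are forbidden by `no-14`.
    no-21 : ∀ {e m} → a < e → e < b → e < m → Sub (e ∷ []) u → ¬ Inv21 m (b ∷ a ∷ u)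
    no-21 a<e e<b e<m s (x , y , take (take _) , m<y , y<x) = ℕP.<-asym a<e (ℕP.<-trans e<m m<y)
    no-21 a<e e<b e<m s (x , y , take (skip t) , m<y , y<x) =
      twice a<e e<b (ℕP.<-trans a<e (ℕP.<-trans e<m m<y)) y<x (ℕP.<⇒≢ (ℕP.<-trans e<m m<y)) s t
    no-21 a<e e<b e<m s (x , y , skip (take _) , m<y , y<x) = ℕP.<-asym a<e (ℕP.<-trans e<m (ℕP.<-trans m<y y<x))
    no-21 {e} a<e e<b e<m s (x , y , skip (skip t) , m<y , y<x) with ℕP.<-cmp y b
    ... | tri< y<b _ _ = twice a<e e<b (ℕP.<-trans a<e e<y) y<b (ℕP.<⇒≢ e<y) s (sub-tail t)
      where e<y = ℕP.<-trans e<m m<y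
    ... | tri≈ _ y≡b _ = sub-fresh (sub-tail t) (second uniq) (sym y≡b)
      where
      second : Unique (a ∷ b ∷ u) → VAll.All (b ≢_) u
      second (_ ∷ b∉ ∷ _) = b∉
    ... | tri> _ _ b<y with sub-insert (ℕP.<⇒≢ (ℕP.<-trans e<b (ℕP.<-trans b<y y<x))) (ℕP.<⇒≢ (ℕP.<-trans e<b b<y)) s t
    ...   | inj₁ r        = no-13254 av (take (take r)) a<e e<b b<y y<x
    ...   | inj₂ (inj₁ r) = no-14 av (take (skip r)) a<e (ℕP.<-trans e<b (ℕP.<-trans b<y y<x)) (ℕP.<-trans a<b b<y) y<x
    ...   | inj₂ (inj₂ r) = no-14 av (take (skip r)) (ℕP.<-trans a<b b<y) y<x a<e (ℕP.<-trans e<b (ℕP.<-trans b<y y<x))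

    drop-a : ∀ {m} → a < m → Inv21 m (b ∷ a ∷ u) → Inv21 a (b ∷ u)
    drop-a a<m (x , y , take (take _) , m<y , y<x) = contradiction m<y (ℕP.<-asym a<m)
    drop-a a<m (x , y , take (skip t) , m<y , y<x) = x , y , take t , ℕP.<-trans a<m m<y , y<x
    drop-a a<m (x , y , skip (take _) , m<y , y<x) = contradiction (ℕP.<-trans m<y y<x) (ℕP.<-asym a<m)
    drop-a a<m (x , y , skip (skip t) , m<y , y<x) = x , y , skip t , ℕP.<-trans a<m m<y , y<x

    -- p and q are the exponents of 𝔊_{w sᵢ} at the first ascent i, i+1 of w
    Early : ℕ → ℕ → Set
    Early p q = (p ≡ suc a × q ≡ a) ⊎ (Inv21 a (b ∷ u) × p ≤ suc (suc a) × q ≤ suc a)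

    -- m is the running minimum at i in w sᵢ. Values strictly between a and m lie in u by `Covers`,
    -- so m ≥ a + 3 is excluded by `no-14`. If m = a + 2, the value a + 1 excludes a 21 above m,
    -- which caps p at a + 2. If m = a + 1, the pair is exact unless a 21 lies above a.
    early : ∀ {p q} m → a < m → m ≤ M → m ≤ b → m ≤ p → p ≤ m ⊎ Inv21 m (b ∷ a ∷ u) × p ≤ suc m →
            a ≤ q → q ≤ a ⊎ Inv21 a (a ∷ u) × q ≤ suc a → Early p q
    early {p} {q} m a<m m≤M m≤b m≤p ph a≤q qh with ℕP.m≤n⇒∃[o]m+o≡n a<m
    ... | suc (suc k) , refl = ⊥-elim (twice ℕP.≤-refl (ℕP.<-≤-trans <m m≤b) (ℕP.m≤n⇒m≤1+n ℕP.≤-refl) (ℕP.<-≤-trans <m′ m≤b) (ℕP.<⇒≢ ℕP.≤-refl)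
        (inside ℕP.≤-refl (ℕP.<-≤-trans <m m≤M) (ℕP.<-≤-trans <m m≤b))
        (inside (ℕP.m≤n⇒m≤1+n ℕP.≤-refl) (ℕP.<-≤-trans <m′ m≤M) (ℕP.<-≤-trans <m′ m≤b)))
      where
      <m : suc a < suc a + suc (suc k)
      <m = ℕP.m<m+n (suc a) (s≤s z≤n)
      <m′ : suc (suc a) < suc a + suc (suc k)
      <m′ = ℕP.≤-trans (ℕP.m<m+n (suc (suc a)) (s≤s z≤n)) (ℕP.≤-reflexive (sym (ℕP.+-suc (suc a) (suc k))))
    ... | suc zero , refl = inj₂ ((b , suc a , take mid , ℕP.≤-refl , <b) , p≤ ph , q≤ qh)
      where
      <m : suc a < suc a + 1
      <m = ℕP.m<m+n (suc a) (s≤s z≤n)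
      <b = ℕP.<-≤-trans <m m≤b
      mid : Sub (suc a ∷ []) u
      mid = inside ℕP.≤-refl (ℕP.<-≤-trans <m m≤M) <b
      p≤ : p ≤ suc a + 1 ⊎ Inv21 (suc a + 1) (b ∷ a ∷ u) × p ≤ suc (suc a + 1) → p ≤ suc (suc a)
      p≤ (inj₁ h)       = ℕP.≤-trans h (ℕP.≤-reflexive (ℕP.+-comm (suc a) 1))
      p≤ (inj₂ (t , _)) = contradiction t (no-21 ℕP.≤-refl <b <m mid)
      q≤ : q ≤ a ⊎ Inv21 a (a ∷ u) × q ≤ suc a → q ≤ suc a
      q≤ (inj₁ h)       = ℕP.m≤n⇒m≤1+n h
      q≤ (inj₂ (_ , h)) = h
    ... | zero , refl rewrite ℕP.+-identityʳ a with ph | qh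
    ...   | inj₂ (t , h) | inj₁ k       = inj₂ (drop-a ℕP.≤-refl t , h , ℕP.m≤n⇒m≤1+n k)
    ...   | inj₂ (t , h) | inj₂ (_ , k) = inj₂ (drop-a ℕP.≤-refl t , h , k)
    ...   | inj₁ h       | inj₁ k       = inj₁ (ℕP.≤-antisym h m≤p , ℕP.≤-antisym k a≤q)
    ...   | inj₁ h       | inj₂ ((x , y , take t , a<y , y<x) , k) = contradiction y<x (ℕP.<-asym a<y)
    ...   | inj₁ h       | inj₂ ((x , y , skip t , a<y , y<x) , k) = inj₂ ((x , y , skip t , a<y , y<x) , ℕP.m≤n⇒m≤1+n h , k)

    -- ∂ᵢ sends the exact pair (a + 1, a) to (a, a) and kills its shift (a + 1, a + 1). In the other
    -- case all exponents lie in [a, a + 2] and ∂ᵢ stays strictly below the larger one; the 21 above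
    -- a permits a + 1.
    late : ∀ {p q p′ q′ q″} {γ γ′ : Vec ℕ n} → Early p′ q′ → suc a ≤ p′ → a ≤ q′ → q″ ≡ q′ ⊎ q″ ≡ suc q′ →
           Between 0 (p′ ∷ q″ ∷ γ′) (p ∷ q ∷ γ) →
           (a ≤ p × (p ≤ a ⊎ Inv21 a (b ∷ u) × p ≤ suc a)) × (a ≤ q × (q ≤ a ⊎ Inv21 a (b ∷ u) × q ≤ suc a)) × γ′ ≡ γ
    late (inj₁ (refl , refl)) _ _ (inj₁ refl) (ge x y z w) = (x , inj₁ (s≤s⁻¹ y)) , (z , inj₁ (s≤s⁻¹ w)) , refl
    late (inj₁ (refl , refl)) _ _ (inj₁ refl) (le x y z w) = contradiction y (ℕP.<-asym x)
    late (inj₁ (refl , refl)) _ _ (inj₂ refl) (ge x y z w) = contradiction x (ℕP.<⇒≱ y)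
    late (inj₁ (refl , refl)) _ _ (inj₂ refl) (le x y z w) = contradiction x (ℕP.<⇒≱ y)
    late (inj₂ (t , p′≤ , q′≤)) a<p′ a≤q′ q″≡ bt with bt
    ... | ge x y z w = (ℕP.≤-trans (lower q″≡ a≤q′) x , inj₂ (t , s≤s⁻¹ (ℕP.≤-trans y p′≤))) ,
                       (ℕP.≤-trans (lower q″≡ a≤q′) z , inj₂ (t , s≤s⁻¹ (ℕP.≤-trans w p′≤))) , refl
      where
      lower : ∀ {q″ q′} → q″ ≡ q′ ⊎ q″ ≡ suc q′ → a ≤ q′ → a ≤ q″
      lower (inj₁ refl) h = h
      lower (inj₂ refl) h = ℕP.m≤n⇒m≤1+n h
    ... | le x y z w = (ℕP.≤-trans (ℕP.<⇒≤ a<p′) x , inj₂ (t , s≤s⁻¹ (ℕP.≤-trans y (upper q″≡)))) ,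
                       (ℕP.≤-trans (ℕP.<⇒≤ a<p′) z , inj₂ (t , s≤s⁻¹ (ℕP.≤-trans w (upper q″≡)))) , refl
      where
      upper : ∀ {q″} → q″ ≡ _ ⊎ q″ ≡ suc _ → q″ ≤ suc (suc a)
      upper (inj₁ refl) = ℕP.m≤n⇒m≤1+n q′≤
      upper (inj₂ refl) = s≤s q′≤

  Inv-step-here : ∀ {β′ β″ β : Vec ℕ (suc (suc n))} → Inv M (b ∷ a ∷ u) β′ → β″ ≡ β′ ⊎ β″ ≡ up 1 β′ → Between 0 β″ β → Inv M (a ∷ b ∷ u) β
  Inv-step-here {p′ ∷ q′ ∷ γ′} {p″ ∷ q″ ∷ γ″} {p ∷ q ∷ γ} (x , y , z , w , r) β″≡ bt
    rewrite ℕP.m≥n⇒m⊓n≡n (ℕP.<⇒≤ a<M) | ℕP.m≤n⇒m⊓n≡m (ℕP.<⇒≤ a<b)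
          | ℕP.m≥n⇒m⊓n≡n (ℕP.<⇒≤ (ℕP.⊓-glb a<M a<b))
    with up-here β″≡
  ... | refl , q″≡ , refl
    with late (early (M ⊓ b) (ℕP.⊓-glb a<M a<b) (ℕP.m⊓n≤m M b) (ℕP.m⊓n≤n M b) x y z w)
              (ℕP.≤-trans (ℕP.⊓-glb a<M a<b) x) z q″≡ bt
  ... | (a≤p , ph) , (a≤q , qh) , refl = a≤p , widen ph , a≤q , qh , r
    where
    widen : ∀ {p} → p ≤ a ⊎ Inv21 a (b ∷ u) × p ≤ suc a → p ≤ a ⊎ Inv21 a (a ∷ b ∷ u) × p ≤ suc a
    widen (inj₁ h)                          = inj₁ h
    widen (inj₂ ((b , c , s , i , j) , h)) = inj₂ ((b , c , skip s , i , j) , h)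

-- Before the first ascent the word decreases, so the running minimum is the entry just passed and x
-- replaces M in the recursion.
Inv-step : ∀ {n i M x} {u : Vec ℕ n} {β′ β″ β} → FirstAsc i (x ∷ u) → x < M → Covers M (x ∷ u) → Unique (x ∷ u) → Avoids (x ∷ u) →
           Inv M (swp i (x ∷ u)) β′ → β″ ≡ β′ ⊎ β″ ≡ up (suc i) β′ → Between i β″ β → Inv M (x ∷ u) β
Inv-step {i = zero} {u = b ∷ u} (here x<b , _) x<M cov uq av = Inv-step-here x<b x<M cov uq av
Inv-step {i = suc i} {M} {x} {y ∷ u} {b′ ∷ γ′} {β = b ∷ γ} fa@(there _ , _) x<M cov uq@(_ ∷ uq′) av (lo , hi , r) β″≡ (there {β′ = γ″} bt)
  rewrite ℕP.m≥n⇒m⊓n≡n (ℕP.<⇒≤ x<M) with up-there (suc i) β″≡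
... | refl , γ″≡ = lo , upper hi , Inv-step (FirstAsc-tail fa) y<x cov′ uq′ (Avoids-tail av) r γ″≡ bt
  where
  y<x : y < x
  y<x = descend fa uq
  cov′ : Covers x (y ∷ u)
  cov′ c c<x = ∈-∷⁻ (cov c (ℕP.<-trans c<x x<M)) (λ e → ℕP.<-irrefl e c<x)
  upper : b ≤ x ⊎ Inv21 x (x ∷ swp i (y ∷ u)) × b ≤ suc x → b ≤ x ⊎ Inv21 x (x ∷ y ∷ u) × b ≤ suc x
  upper (inj₁ h) = inj₁ h
  upper (inj₂ ((p , q , take s , x<q , q<p) , h)) = contradiction q<p (ℕP.<-asym x<q)
  upper (inj₂ ((p , q , skip s , x<q , q<p) , h)) =
    inj₂ ((p , q , skip (sub-swp-above (FirstAsc-tail fa) uq′ y<x (ℕP.<-trans x<q q<p) x<q s) , x<q , q<p) , h)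

noAsc-rho : ∀ {n} {v : Vec ℕ n} → NoAscFrom 0 v → Unique v → Covers n v → VAll.All (_< n) v → v ≡ rho n
noAsc-rho {v = []} na uq cov lt = refl
noAsc-rho {suc n} {x ∷ v} na uq@(_ ∷ uq′) cov (x<n ∷ _) with cov n ℕP.≤-refl | noAsc-below na uq
... | VAny.here refl | small = cong (n ∷_) (noAsc-rho (λ i _ a → na (suc i) z≤n (there a)) uq′
    (λ c c<n → ∈-∷⁻ (cov c (ℕP.m≤n⇒m≤1+n c<n)) (λ e → ℕP.<-irrefl e c<n)) small)
... | VAny.there n∈v | small = contradiction (ℕP.≤-trans (VAll.lookup small n∈v) (s≤s⁻¹ x<n)) (ℕP.<-irrefl refl)

Inv-rho : ∀ M n → n ≤ M → Inv M (rho n) (rho n)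
Inv-rho M zero    h = tt
Inv-rho M (suc n) h rewrite ℕP.m≥n⇒m⊓n≡n (ℕP.<⇒≤ h) = ℕP.≤-refl , inj₁ ℕP.≤-refl , Inv-rho n n ℕP.≤-refl

IsG-Inv : ∀ {n} {v : Vec ℕ n} {p} → IsG v p → Unique v → Covers n v → VAll.All (_< n) v → Avoids v →
          All (Inv n v ∘ proj₂) p
IsG-Inv {n} (top na) uq cov lt av rewrite noAsc-rho na uq cov lt = Inv-rho n n ℕP.≤-refl ∷ []
IsG-Inv {n} (step {v = x ∷ u} {i} {p} fa@(a , _) g) uq cov lt@(x<n ∷ _) av =
  ∂-All i (Asc-bound a) (λ β′ β″ β → Inv-step fa x<n cov uq av) p
    (IsG-Inv g (Unique-swp i uq) (λ c h → ∈-swp i (cov c h)) (All-swp i lt) (Avoids-swp fa uq av))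

-- Convex combinations over ℚ and vertices of Newton polytopes

private
  int : ℤ → ℚ
  int z = mkℚ z 0 (Coprime.sym (Coprime.1-coprimeTo ℤ.∣ z ∣))

  /1≡int : ∀ z → z / 1 ≡ int z
  /1≡int z = ℚP.↥p/↧p≡p (int z)

/1-mono : ∀ {a b} → a ℤ.≤ b → a / 1 ℚ.≤ b / 1
/1-mono {a} {b} h = subst₂ ℚ._≤_ (sym (/1≡int a)) (sym (/1≡int b)) (ℚ.*≤* (ℤP.*-monoʳ-≤-nonNeg 1ℤ h))

/1-cancel : ∀ {a b} → a / 1 ℚ.≤ b / 1 → a ℤ.≤ b
/1-cancel {a} {b} h = subst₂ ℤ._≤_ (ℤP.*-identityʳ a) (ℤP.*-identityʳ b)
  (ℚP.drop-*≤* (subst₂ ℚ._≤_ (/1≡int a) (/1≡int b) h))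

/1-injective : ∀ {a b} → a / 1 ≡ b / 1 → a ≡ b
/1-injective e = ℤP.≤-antisym (/1-cancel (ℚP.≤-reflexive e)) (/1-cancel (ℚP.≤-reflexive (sym e)))

/1-+ : ∀ a b → (a ℤ.+ b) / 1 ≡ a / 1 ℚ.+ b / 1
/1-+ a b = trans (cong (_/ 1) (sym (cong₂ ℤ._+_ (ℤP.*-identityʳ a) (ℤP.*-identityʳ b))))
                 (sym (cong₂ ℚ._+_ (/1≡int a) (/1≡int b)))

ι : ℕ → ℚ
ι m = ℤ.+ m / 1

lookup-ext : ∀ {n} {x y : Vec ℚ n} → (∀ k → Vec.lookup x k ≡ Vec.lookup y k) → x ≡ y
lookup-ext {x = x} {y} h = trans (sym (VecP.tabulate∘lookup x)) (trans (VecP.tabulate-cong h) (VecP.tabulate∘lookup y))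

lookup-mix : ∀ {n} t s (y z : Vec ℚ n) k →
  Vec.lookup (Vec.zipWith ℚ._+_ (Vec.map (t ℚ.*_) y) (Vec.map (s ℚ.*_) z)) k ≡ t ℚ.* Vec.lookup y k ℚ.+ s ℚ.* Vec.lookup z k
lookup-mix t s y z k = trans (VecP.lookup-zipWith ℚ._+_ k (Vec.map (t ℚ.*_) y) (Vec.map (s ℚ.*_) z))
  (cong₂ ℚ._+_ (VecP.lookup-map k (t ℚ.*_) y) (VecP.lookup-map k (s ℚ.*_) z))

lookup-combo : ∀ {n} t (β : Vec ℕ n) cs k →
  Vec.lookup (combo ((t , β) ∷ cs)) k ≡ t ℚ.* ι (Vec.lookup β k) ℚ.+ Vec.lookup (combo cs) k
lookup-combo t β cs k = trans (VecP.lookup-zipWith ℚ._+_ k (Vec.map (t ℚ.*_) (toℚv β)) (combo cs))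
  (cong (ℚ._+ Vec.lookup (combo cs) k) (trans (VecP.lookup-map k (t ℚ.*_) (toℚv β)) (cong (t ℚ.*_) (VecP.lookup-map k ι β))))

data Weighted {n} (f : Poly n) : ℚ × Vec ℕ n → Set where
  weighted : ∀ {t β} → 0ℚ ℚ.≤ t → coeff f β ≢ 0ℤ → Weighted f (t , β)

toWeighted : ∀ {n} {f : Poly n} {cs} → All (λ { (t , β) → 0ℚ ℚ.≤ t × coeff f β ≢ 0ℤ }) cs → All (Weighted f) cs
toWeighted = LAll.map λ { {t , β} (0≤t , nz) → weighted 0≤t nz }

fromWeighted : ∀ {n} {f : Poly n} {cs} → All (Weighted f) cs → All (λ { (t , β) → 0ℚ ℚ.≤ t × coeff f β ≢ 0ℤ }) cs
fromWeighted = LAll.map λ { (weighted 0≤t nz) → 0≤t , nz }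

sumW-nonneg : ∀ {n} {f : Poly n} {cs} → All (Weighted f) cs → 0ℚ ℚ.≤ sumW cs
sumW-nonneg []                       = ℚP.≤-refl
sumW-nonneg {cs = (t , β) ∷ cs} (weighted 0≤t _ ∷ ws) = ℚP.+-mono-≤ 0≤t (sumW-nonneg ws)

lookup-combo-[] : ∀ {n} (k : Fin n) → Vec.lookup (combo []) k ≡ 0ℚ
lookup-combo-[] k = VecP.lookup-replicate k 0ℚ

combo-zero : ∀ {n} {f : Poly n} {cs} → All (Weighted f) cs → sumW cs ≡ 0ℚ → ∀ k → Vec.lookup (combo cs) k ≡ 0ℚ
combo-zero [] e k = lookup-combo-[] k
combo-zero {cs = (t , β) ∷ cs} (weighted 0≤t _ ∷ ws) e k = begin
  Vec.lookup (combo ((t , β) ∷ cs)) k                    ≡⟨ lookup-combo t β cs k ⟩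
  t ℚ.* ι (Vec.lookup β k) ℚ.+ Vec.lookup (combo cs) k   ≡⟨ cong₂ (λ a b → a ℚ.* ι (Vec.lookup β k) ℚ.+ b) t≡0 (combo-zero ws s≡0 k) ⟩
  0ℚ ℚ.* ι (Vec.lookup β k) ℚ.+ 0ℚ                       ≡⟨ trans (ℚP.+-identityʳ (0ℚ ℚ.* ι (Vec.lookup β k))) (ℚP.*-zeroˡ (ι (Vec.lookup β k))) ⟩
  0ℚ ∎
  where
  open ≡-Reasoning
  t≡0 : t ≡ 0ℚ
  t≡0 = ℚP.≤-antisym (ℚP.≤-trans (ℚP.≤-reflexive (sym (ℚP.+-identityʳ t)))
          (ℚP.≤-trans (ℚP.+-monoʳ-≤ t (sumW-nonneg ws)) (ℚP.≤-reflexive e))) 0≤t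
  s≡0 : sumW cs ≡ 0ℚ
  s≡0 = trans (sym (ℚP.+-identityˡ _)) (trans (cong (ℚ._+ sumW cs) (sym t≡0)) e)

scale : ∀ {n} → ℚ → List (ℚ × Vec ℕ n) → List (ℚ × Vec ℕ n)
scale r = List.map (λ (t , β) → r ℚ.* t , β)

sumW-scale : ∀ {n} r (cs : List (ℚ × Vec ℕ n)) → sumW (scale r cs) ≡ r ℚ.* sumW cs
sumW-scale r []             = sym (ℚP.*-zeroʳ r)
sumW-scale r ((t , _) ∷ cs) = trans (cong ((r ℚ.* t) ℚ.+_) (sumW-scale r cs)) (sym (ℚP.*-distribˡ-+ r t (sumW cs)))

combo-scale : ∀ {n} r (cs : List (ℚ × Vec ℕ n)) k → Vec.lookup (combo (scale r cs)) k ≡ r ℚ.* Vec.lookup (combo cs) k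
combo-scale r [] k = trans (lookup-combo-[] k) (trans (sym (ℚP.*-zeroʳ r)) (cong (r ℚ.*_) (sym (lookup-combo-[] k))))
combo-scale r ((t , β) ∷ cs) k = begin
  Vec.lookup (combo (scale r ((t , β) ∷ cs))) k
    ≡⟨ lookup-combo (r ℚ.* t) β (scale r cs) k ⟩
  r ℚ.* t ℚ.* b ℚ.+ Vec.lookup (combo (scale r cs)) k
    ≡⟨ cong₂ ℚ._+_ (ℚP.*-assoc r t b) (combo-scale r cs k) ⟩
  r ℚ.* (t ℚ.* b) ℚ.+ r ℚ.* Vec.lookup (combo cs) k
    ≡⟨ ℚP.*-distribˡ-+ r (t ℚ.* b) _ ⟨
  r ℚ.* (t ℚ.* b ℚ.+ Vec.lookup (combo cs) k)
    ≡⟨ cong (r ℚ.*_) (lookup-combo t β cs k) ⟨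
  r ℚ.* Vec.lookup (combo ((t , β) ∷ cs)) k ∎
  where
  open ≡-Reasoning
  b = ι (Vec.lookup β k)

scale-weighted : ∀ {n} {f : Poly n} r {cs} → 0ℚ ℚ.≤ r → All (Weighted f) cs → All (Weighted f) (scale r cs)
scale-weighted r h [] = []
scale-weighted r {(t , β) ∷ cs} h (weighted 0≤t nz ∷ ws) =
  weighted (ℚP.≤-trans (ℚP.≤-reflexive (sym (ℚP.*-zeroʳ r))) (ℚP.*-monoˡ-≤-nonNeg r {{ℚ.nonNegative h}} 0≤t)) nz ∷ scale-weighted r h ws

Newton-exponent : ∀ {n} {f : Poly n} {β} → coeff f β ≢ 0ℤ → Newton f (toℚv β)
Newton-exponent {f = f} {β} nz = (1ℚ , β) ∷ [] , fromWeighted (weighted {f = f} (ℚ.*≤* (ℤ.+≤+ z≤n)) nz ∷ []) , refl ,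
  lookup-ext λ k → trans (lookup-combo 1ℚ β [] k) (trans (cong₂ ℚ._+_ (ℚP.*-identityˡ (ι (Vec.lookup β k))) (lookup-combo-[] k))
    (trans (ℚP.+-identityʳ (ι (Vec.lookup β k))) (sym (VecP.lookup-map k ι β))))

toℚv-integral : ∀ {n} (β : Vec ℕ n) → IsIntegral (toℚv β)
toℚv-integral []      = []
toℚv-integral (b ∷ β) = (ℤ.+ b , refl) ∷ toℚv-integral β

mix-self : ∀ t y → t ℚ.* y ℚ.+ (1ℚ ℚ.- t) ℚ.* y ≡ y
mix-self = solve 2 (λ t y → t :* y :+ (con 1ℚ :- t) :* y := y) refl
  where open +-*-Solver

-- A vertex is an exponent: otherwise split off one exponent β with weight
-- 0 < t < 1; the rest, rescaled by 1/(1 - t), would have to equal β.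
vertex-integral : ∀ {n} (f : Poly n) x → IsVertex (Newton f) x →
  ∀ cs → All (Weighted f) cs → sumW cs ≡ 1ℚ → combo cs ≡ x → IsIntegral x
vertex-integral f x v [] ws () e
vertex-integral f x v ((t , β) ∷ cs) (weighted 0≤t nz ∷ ws) sum≡1 e with ℚP.<-cmp 0ℚ (sumW cs)
... | tri> _ _ s<0 = contradiction (ℚP.≤-<-trans (sumW-nonneg ws) s<0) (ℚP.<-irrefl refl)
... | tri≈ _ 0≡s _ = subst IsIntegral (trans (lookup-ext eq) e) (toℚv-integral β)
  where
  t≡1 : t ≡ 1ℚ
  t≡1 = trans (sym (ℚP.+-identityʳ t)) (trans (cong (t ℚ.+_) 0≡s) sum≡1)
  eq : ∀ k → Vec.lookup (toℚv β) k ≡ Vec.lookup (combo ((t , β) ∷ cs)) k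
  eq k = trans (VecP.lookup-map k ι β) (sym (trans (lookup-combo t β cs k)
    (trans (cong₂ (λ a b → a ℚ.* ι (Vec.lookup β k) ℚ.+ b) t≡1 (combo-zero ws (sym 0≡s) k))
      (trans (ℚP.+-identityʳ (1ℚ ℚ.* ι (Vec.lookup β k))) (ℚP.*-identityˡ (ι (Vec.lookup β k)))))))
... | tri< 0<s _ _ with ℚP.<-cmp 0ℚ t
...   | tri> _ _ t<0 = contradiction (ℚP.≤-<-trans 0≤t t<0) (ℚP.<-irrefl refl)
...   | tri≈ _ refl _ = vertex-integral f x v cs ws (trans (sym (ℚP.+-identityˡ _)) sum≡1)
  (trans (lookup-ext (λ k → sym (trans (lookup-combo 0ℚ β cs k) (trans (cong (ℚ._+ Vec.lookup (combo cs) k) (ℚP.*-zeroˡ (ι (Vec.lookup β k)))) (ℚP.+-identityˡ (Vec.lookup (combo cs) k)))))) e)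
...   | tri< 0<t _ _ = subst IsIntegral (sym x≡y) (toℚv-integral β)
  where
  open ≡-Reasoning
  s = sumW cs
  instance
    s-pos : ℚ.Positive s
    s-pos = ℚ.positive 0<s
    s-nonZero : ℚ.NonZero s
    s-nonZero = ℚP.pos⇒nonZero s
  r = ℚ.1/ s
  z = combo (scale r cs)
  0≤r : 0ℚ ℚ.≤ r
  0≤r = ℚP.<⇒≤ (ℚP.positive⁻¹ r {{ℚP.1/pos⇒pos s}})
  z∈ : Newton f z
  z∈ = scale r cs , fromWeighted (scale-weighted r 0≤r ws) , trans (sumW-scale r cs) (ℚP.*-inverseˡ s) , refl
  s≡ : s ≡ 1ℚ ℚ.- t
  s≡ = trans (lem t s) (cong (ℚ._- t) sum≡1)
    where
    open +-*-Solver
    lem : ∀ t s → s ≡ (t ℚ.+ s) ℚ.- t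
    lem = solve 2 (λ t s → s := (t :+ s) :- t) refl
  t<1 : t ℚ.< 1ℚ
  t<1 = subst₂ ℚ._<_ (ℚP.+-identityʳ t) sum≡1 (ℚP.+-monoʳ-< t 0<s)
  mix : ∀ k → Vec.lookup x k ≡ t ℚ.* Vec.lookup (toℚv β) k ℚ.+ (1ℚ ℚ.- t) ℚ.* Vec.lookup z k
  mix k = begin
    Vec.lookup x k ≡⟨ cong (λ w → Vec.lookup w k) e ⟨
    Vec.lookup (combo ((t , β) ∷ cs)) k ≡⟨ lookup-combo t β cs k ⟩
    t ℚ.* ι (Vec.lookup β k) ℚ.+ c ≡⟨ cong (t ℚ.* ι (Vec.lookup β k) ℚ.+_) (ℚP.*-identityˡ c) ⟨
    t ℚ.* ι (Vec.lookup β k) ℚ.+ 1ℚ ℚ.* c ≡⟨ cong (λ w → t ℚ.* ι (Vec.lookup β k) ℚ.+ w ℚ.* c) (ℚP.*-inverseʳ s) ⟨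
    t ℚ.* ι (Vec.lookup β k) ℚ.+ s ℚ.* r ℚ.* c ≡⟨ cong (t ℚ.* ι (Vec.lookup β k) ℚ.+_) (ℚP.*-assoc s r c) ⟩
    t ℚ.* ι (Vec.lookup β k) ℚ.+ s ℚ.* (r ℚ.* c) ≡⟨ cong₂ (λ a b → t ℚ.* a ℚ.+ s ℚ.* b) (sym (VecP.lookup-map k ι β)) (sym (combo-scale r cs k)) ⟩
    t ℚ.* Vec.lookup (toℚv β) k ℚ.+ s ℚ.* Vec.lookup z k ≡⟨ cong (λ w → t ℚ.* Vec.lookup (toℚv β) k ℚ.+ w ℚ.* Vec.lookup z k) s≡ ⟩
    t ℚ.* Vec.lookup (toℚv β) k ℚ.+ (1ℚ ℚ.- t) ℚ.* Vec.lookup z k ∎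
    where c = Vec.lookup (combo cs) k
  y≡z : toℚv β ≡ z
  y≡z = proj₂ v (toℚv β) z t (Newton-exponent {f = f} nz) z∈ 0<t t<1
    (lookup-ext λ k → trans (mix k) (sym (lookup-mix t (1ℚ ℚ.- t) (toℚv β) z k)))
  x≡y : x ≡ toℚv β
  x≡y = lookup-ext λ k → trans (mix k) (trans (cong (λ w → t ℚ.* Vec.lookup (toℚv β) k ℚ.+ (1ℚ ℚ.- t) ℚ.* Vec.lookup w k) (sym y≡z))
    (mix-self t (Vec.lookup (toℚv β) k)))

-- Unit boxes

InBox : ∀ {n} → Vec ℕ n → Vec ℕ n → Set
InBox {n} l α = ∀ (k : Fin n) → Vec.lookup l k ℕ.≤ Vec.lookup α k × Vec.lookup α k ℕ.≤ suc (Vec.lookup l k)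

module _ {n} {f : Poly n} {l : Vec ℕ n} (box : ∀ α → coeff f α ≢ 0ℤ → InBox l α) (k : Fin n) where

  combo-lower : ∀ {cs} → All (Weighted f) cs → sumW cs ℚ.* ι (Vec.lookup l k) ℚ.≤ Vec.lookup (combo cs) k
  combo-lower [] = ℚP.≤-reflexive (trans (ℚP.*-zeroˡ (ι (Vec.lookup l k))) (sym (lookup-combo-[] k)))
  combo-lower {(t , β) ∷ cs} (weighted 0≤t nz ∷ ws) =
    subst₂ ℚ._≤_ (sym (ℚP.*-distribʳ-+ (ι (Vec.lookup l k)) t (sumW cs))) (sym (lookup-combo t β cs k))
      (ℚP.+-mono-≤ (ℚP.*-monoˡ-≤-nonNeg t {{ℚ.nonNegative 0≤t}} (/1-mono (ℤ.+≤+ (proj₁ (box β nz k))))) (combo-lower ws))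

  combo-upper : ∀ {cs} → All (Weighted f) cs → Vec.lookup (combo cs) k ℚ.≤ sumW cs ℚ.* ι (suc (Vec.lookup l k))
  combo-upper [] = ℚP.≤-reflexive (sym (trans (ℚP.*-zeroˡ (ι (suc (Vec.lookup l k)))) (sym (lookup-combo-[] k))))
  combo-upper {(t , β) ∷ cs} (weighted 0≤t nz ∷ ws) =
    subst₂ ℚ._≤_ (sym (lookup-combo t β cs k)) (sym (ℚP.*-distribʳ-+ (ι (suc (Vec.lookup l k))) t (sumW cs)))
      (ℚP.+-mono-≤ (ℚP.*-monoˡ-≤-nonNeg t {{ℚ.nonNegative 0≤t}} (/1-mono (ℤ.+≤+ (proj₂ (box β nz k))))) (combo-upper ws))

  Newton-box : ∀ {x} → Newton f x → ι (Vec.lookup l k) ℚ.≤ Vec.lookup x k × Vec.lookup x k ℚ.≤ ι (suc (Vec.lookup l k))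
  Newton-box (cs , ws , e , refl) =
    ℚP.≤-trans (ℚP.≤-reflexive (trans (sym (ℚP.*-identityˡ _)) (cong (ℚ._* _) (sym e)))) (combo-lower (toWeighted ws)) ,
    ℚP.≤-trans (combo-upper (toWeighted ws)) (ℚP.≤-reflexive (trans (cong (ℚ._* _) e) (ℚP.*-identityˡ _)))

module _ {t s : ℚ} (0<t : 0ℚ ℚ.< t) (0<s : 0ℚ ℚ.< s) where
  private instance
    t-pos : ℚ.Positive t
    t-pos = ℚ.positive 0<t
    s-nonNeg : ℚ.NonNegative s
    s-nonNeg = ℚ.nonNegative (ℚP.<⇒≤ 0<s)

  squeeze-lower : ∀ {l y z} → l ℚ.≤ z → t ℚ.* y ℚ.+ s ℚ.* z ℚ.≤ t ℚ.* l ℚ.+ s ℚ.* l → y ℚ.≤ l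
  squeeze-lower l≤z h = ℚP.≮⇒≥ λ l<y → ℚP.<-irrefl refl
    (ℚP.<-≤-trans (ℚP.+-mono-<-≤ (ℚP.*-monoʳ-<-pos t l<y) (ℚP.*-monoˡ-≤-nonNeg s l≤z)) h)

  squeeze-upper : ∀ {u y z} → z ℚ.≤ u → t ℚ.* u ℚ.+ s ℚ.* u ℚ.≤ t ℚ.* y ℚ.+ s ℚ.* z → u ℚ.≤ y
  squeeze-upper z≤u h = ℚP.≮⇒≥ λ y<u → ℚP.<-irrefl refl
    (ℚP.≤-<-trans h (ℚP.+-mono-<-≤ (ℚP.*-monoʳ-<-pos t y<u) (ℚP.*-monoˡ-≤-nonNeg s z≤u)))

-- x is an endpoint of [l, l + 1], so y and z equal the same endpoint.
mix-pinned : ∀ {t y z x} l m → 0ℚ ℚ.< t → t ℚ.< 1ℚ → ι l ℚ.≤ y → y ℚ.≤ ι (suc l) → ι l ℚ.≤ z → z ℚ.≤ ι (suc l) →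
             x ≡ m / 1 → x ≡ t ℚ.* y ℚ.+ (1ℚ ℚ.- t) ℚ.* z → y ≡ z
mix-pinned {t} {y} {z} {x} l m 0<t t<1 l≤y y≤u l≤z z≤u x≡m x≡mix with m ℤ.≤? ℤ.+ l
... | yes m≤l = trans (ℚP.≤-antisym (squeeze-lower 0<t 0<s l≤z h) l≤y)
                      (ℚP.≤-antisym l≤z (squeeze-lower 0<s 0<t l≤y (subst₂ ℚ._≤_ (ℚP.+-comm (t ℚ.* y) ((1ℚ ℚ.- t) ℚ.* z)) (ℚP.+-comm (t ℚ.* ι l) ((1ℚ ℚ.- t) ℚ.* ι l)) h)))
  where
  0<s : 0ℚ ℚ.< 1ℚ ℚ.- t
  0<s = subst (ℚ._< 1ℚ ℚ.- t) (ℚP.+-inverseʳ t) (ℚP.+-monoˡ-< (ℚ.- t) t<1)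
  h : t ℚ.* y ℚ.+ (1ℚ ℚ.- t) ℚ.* z ℚ.≤ t ℚ.* ι l ℚ.+ (1ℚ ℚ.- t) ℚ.* ι l
  h = subst₂ ℚ._≤_ (trans (sym x≡m) x≡mix) (sym (mix-self t (ι l))) (/1-mono m≤l)
... | no m≰l = trans (ℚP.≤-antisym y≤u (squeeze-upper 0<t 0<s z≤u h))
                     (ℚP.≤-antisym (squeeze-upper 0<s 0<t y≤u (subst₂ ℚ._≤_ (ℚP.+-comm (t ℚ.* ι (suc l)) ((1ℚ ℚ.- t) ℚ.* ι (suc l))) (ℚP.+-comm (t ℚ.* y) ((1ℚ ℚ.- t) ℚ.* z)) h)) z≤u)
  where
  0<s : 0ℚ ℚ.< 1ℚ ℚ.- t
  0<s = subst (ℚ._< 1ℚ ℚ.- t) (ℚP.+-inverseʳ t) (ℚP.+-monoˡ-< (ℚ.- t) t<1)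
  h : t ℚ.* ι (suc l) ℚ.+ (1ℚ ℚ.- t) ℚ.* ι (suc l) ℚ.≤ t ℚ.* y ℚ.+ (1ℚ ℚ.- t) ℚ.* z
  h = subst₂ ℚ._≤_ (sym (mix-self t (ι (suc l)))) (trans (sym x≡m) x≡mix) (/1-mono (ℤP.i<j⇒suc[i]≤j (ℤP.≰⇒> m≰l)))

box-latticeFree : ∀ {n} (f : Poly n) l → (∀ α → coeff f α ≢ 0ℤ → InBox l α) → LatticeFree (Newton f)
box-latticeFree f l box x =
  (λ (Px , int) → Px , λ y z t Py Pz 0<t t<1 e → lookup-ext λ k →
    let (m , x≡m)  = VAllP.lookup⁺ int k
        (l≤y , y≤u) = Newton-box {f = f} {l} box k Py
        (l≤z , z≤u) = Newton-box {f = f} {l} box k Pz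
    in mix-pinned {t} {Vec.lookup y k} {Vec.lookup z k} (Vec.lookup l k) m 0<t t<1 l≤y y≤u l≤z z≤u x≡m
         (trans (cong (λ w → Vec.lookup w k) e) (lookup-mix t (1ℚ ℚ.- t) y z k))) ,
  λ v@((cs , ws , s , e) , _) → proj₁ v , vertex-integral f x v cs (toWeighted ws) s e

-- Lattice points between an exponent and its transpose

ι-+ : ∀ a b → ι (a + b) ≡ ι a ℚ.+ ι b
ι-+ a b = /1-+ (ℤ.+ a) (ℤ.+ b)

ι-< : ∀ {a b} → a < b → ι a ℚ.< ι b
ι-< h = ℚP.≰⇒> λ k → ℕP.<⇒≱ h (ℤP.drop‿+≤+ (/1-cancel k))

toℚv-injective : ∀ {n} {α β : Vec ℕ n} → toℚv α ≡ toℚv β → α ≡ β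
toℚv-injective {α = []}    {[]}    e = refl
toℚv-injective {α = a ∷ α} {b ∷ β} e =
  cong₂ _∷_ (ℤP.+-injective (/1-injective (VecP.∷-injectiveˡ e))) (toℚv-injective (VecP.∷-injectiveʳ e))

-- For α = (… , p , q , …) with q ≥ p + 2 the point (… , p + 1 , q − 1 , …) lies
-- strictly between α and its transpose, at ratio 1/(q − p).
wide-interior : ∀ {n i} {α : Vec ℕ n} → Wide i α →
  ∃[ s ] ∃[ μ ] 0ℚ ℚ.< s × s ℚ.< 1ℚ ×
    (∀ k → ι (Vec.lookup μ k) ≡ s ℚ.* ι (Vec.lookup α k) ℚ.+ (1ℚ ℚ.- s) ℚ.* ι (Vec.lookup (swp i α) k))
wide-interior (there {x = x} w) with s , μ , 0<s , s<1 , e ← wide-interior w =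
  s , x ∷ μ , 0<s , s<1 , λ { zero → sym (mix-self s (ι x)) ; (suc k) → e k }
wide-interior (here {p = p} {γ = γ} h) with e , refl ← ℕP.m≤n⇒∃[o]m+o≡n h =
  -- α has weight 1 - t and its transpose t = 1/(q - p), where q - p = e + 2.
  1ℚ ℚ.- t , suc p ∷ suc p + e ∷ γ , 0<s , s<1 , eq
  where
  open ≡-Reasoning
  open +-*-Solver
  d′ = ι (suc (suc e))
  instance
    d-pos : ℚ.Positive d′
    d-pos = ℚ.positive (ι-< {0} {suc (suc e)} (s≤s z≤n))
    d-nonZero : ℚ.NonZero d′
    d-nonZero = ℚP.pos⇒nonZero d′
  t = ℚ.1/ d′
  instance
    t-pos : ℚ.Positive t
    t-pos = ℚP.1/pos⇒pos d′
  td : t ℚ.* d′ ≡ 1ℚ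
  td = ℚP.*-inverseˡ d′
  0<t : 0ℚ ℚ.< t
  0<t = ℚP.positive⁻¹ t
  t<1 : t ℚ.< 1ℚ
  t<1 = subst₂ ℚ._<_ (ℚP.*-identityʳ t) td (ℚP.*-monoʳ-<-pos t (ι-< {1} {suc (suc e)} (s≤s (s≤s z≤n))))
  0<s : 0ℚ ℚ.< 1ℚ ℚ.- t
  0<s = subst (ℚ._< 1ℚ ℚ.- t) (ℚP.+-inverseʳ t) (ℚP.+-monoˡ-< (ℚ.- t) t<1)
  s<1 : 1ℚ ℚ.- t ℚ.< 1ℚ
  s<1 = subst (1ℚ ℚ.- t ℚ.<_) (ℚP.+-identityʳ 1ℚ) (ℚP.+-monoʳ-< 1ℚ (ℚP.neg-antimono-< 0<t))
  ι-q : ι (suc (suc p) + e) ≡ ι p ℚ.+ d′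
  ι-q = trans (cong ι (trans (cong suc (sym (ℕP.+-suc p e))) (sym (ℕP.+-suc p (suc e))))) (ι-+ p (suc (suc e)))
  lower : ∀ t P d → (1ℚ ℚ.- t) ℚ.* P ℚ.+ (1ℚ ℚ.- (1ℚ ℚ.- t)) ℚ.* (P ℚ.+ d) ≡ t ℚ.* d ℚ.+ P
  lower = solve 3 (λ t P d → (con 1ℚ :- t) :* P :+ (con 1ℚ :- (con 1ℚ :- t)) :* (P :+ d) := t :* d :+ P) refl
  upper : ∀ t P E → (1ℚ ℚ.- t) ℚ.* (P ℚ.+ (1ℚ ℚ.+ E)) ℚ.+ (1ℚ ℚ.- (1ℚ ℚ.- t)) ℚ.* P ≡ (P ℚ.+ (1ℚ ℚ.+ E)) ℚ.- t ℚ.* (1ℚ ℚ.+ E)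
  upper = solve 3 (λ t P E → (con 1ℚ :- t) :* (P :+ (con 1ℚ :+ E)) :+ (con 1ℚ :- (con 1ℚ :- t)) :* P := (P :+ (con 1ℚ :+ E)) :- t :* (con 1ℚ :+ E)) refl
  drop-one : ∀ P E → (P ℚ.+ (1ℚ ℚ.+ E)) ℚ.- 1ℚ ≡ P ℚ.+ E
  drop-one = solve 2 (λ P E → (P :+ (con 1ℚ :+ E)) :- con 1ℚ := P :+ E) refl
  d≡ : d′ ≡ 1ℚ ℚ.+ ι (suc e)
  d≡ = ι-+ 1 (suc e)
  eq : ∀ k → ι (Vec.lookup (suc p ∷ suc p + e ∷ γ) k) ≡
       (1ℚ ℚ.- t) ℚ.* ι (Vec.lookup (p ∷ suc (suc p) + e ∷ γ) k) ℚ.+ (1ℚ ℚ.- (1ℚ ℚ.- t)) ℚ.* ι (Vec.lookup (suc (suc p) + e ∷ p ∷ γ) k)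
  eq zero = begin
    ι (suc p)            ≡⟨ ι-+ 1 p ⟩
    1ℚ ℚ.+ ι p           ≡⟨ cong (ℚ._+ ι p) td ⟨
    t ℚ.* d′ ℚ.+ ι p     ≡⟨ lower t (ι p) d′ ⟨
    (1ℚ ℚ.- t) ℚ.* ι p ℚ.+ (1ℚ ℚ.- (1ℚ ℚ.- t)) ℚ.* (ι p ℚ.+ d′)
      ≡⟨ cong (λ w → (1ℚ ℚ.- t) ℚ.* ι p ℚ.+ (1ℚ ℚ.- (1ℚ ℚ.- t)) ℚ.* w) ι-q ⟨
    (1ℚ ℚ.- t) ℚ.* ι p ℚ.+ (1ℚ ℚ.- (1ℚ ℚ.- t)) ℚ.* ι (suc (suc p) + e) ∎
  eq (suc zero) = begin
    ι (suc p + e)        ≡⟨ cong ι (sym (ℕP.+-suc p e)) ⟩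
    ι (p + suc e)        ≡⟨ ι-+ p (suc e) ⟩
    ι p ℚ.+ E            ≡⟨ drop-one (ι p) E ⟨
    (ι p ℚ.+ (1ℚ ℚ.+ E)) ℚ.- 1ℚ  ≡⟨ cong (λ w → (ι p ℚ.+ (1ℚ ℚ.+ E)) ℚ.- w) (trans (cong (t ℚ.*_) (sym d≡)) td) ⟨
    (ι p ℚ.+ (1ℚ ℚ.+ E)) ℚ.- t ℚ.* (1ℚ ℚ.+ E)  ≡⟨ upper t (ι p) E ⟨
    (1ℚ ℚ.- t) ℚ.* (ι p ℚ.+ (1ℚ ℚ.+ E)) ℚ.+ (1ℚ ℚ.- (1ℚ ℚ.- t)) ℚ.* ι p
      ≡⟨ cong (λ w → (1ℚ ℚ.- t) ℚ.* w ℚ.+ (1ℚ ℚ.- (1ℚ ℚ.- t)) ℚ.* ι p) (trans ι-q (cong (ι p ℚ.+_) d≡)) ⟨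
    (1ℚ ℚ.- t) ℚ.* ι (suc (suc p) + e) ℚ.+ (1ℚ ℚ.- (1ℚ ℚ.- t)) ℚ.* ι p ∎
    where E = ι (suc e)
  eq (suc (suc k)) = sym (mix-self (1ℚ ℚ.- t) (ι (Vec.lookup γ k)))

Wide-swp : ∀ {n i} {α : Vec ℕ n} → Wide i α → α ≢ swp i α
Wide-swp (here h)  e = ℕP.<⇒≢ (ℕP.<-trans ℕP.≤-refl h) (VecP.∷-injectiveˡ e)
Wide-swp (there w) e = Wide-swp w (VecP.∷-injectiveʳ e)

Newton-segment : ∀ {n} {f : Poly n} {α β} s → 0ℚ ℚ.≤ s → 0ℚ ℚ.≤ 1ℚ ℚ.- s → coeff f α ≢ 0ℤ → coeff f β ≢ 0ℤ → ∀ x →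
  (∀ k → Vec.lookup x k ≡ s ℚ.* ι (Vec.lookup α k) ℚ.+ (1ℚ ℚ.- s) ℚ.* ι (Vec.lookup β k)) → Newton f x
Newton-segment {f = f} {α} {β} s 0≤s 0≤1-s nα nβ x e =
  (s , α) ∷ (1ℚ ℚ.- s , β) ∷ [] , fromWeighted (weighted {f = f} 0≤s nα ∷ weighted {f = f} 0≤1-s nβ ∷ []) , total s ,
  lookup-ext λ k → trans (lookup-combo s α ((1ℚ ℚ.- s , β) ∷ []) k) (trans (cong (s ℚ.* ι (Vec.lookup α k) ℚ.+_)
    (trans (lookup-combo (1ℚ ℚ.- s) β [] k) (trans (cong ((1ℚ ℚ.- s) ℚ.* ι (Vec.lookup β k) ℚ.+_) (lookup-combo-[] k)) (ℚP.+-identityʳ ((1ℚ ℚ.- s) ℚ.* ι (Vec.lookup β k))))))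
    (sym (e k)))
  where
  open +-*-Solver
  total : ∀ s → s ℚ.+ ((1ℚ ℚ.- s) ℚ.+ 0ℚ) ≡ 1ℚ
  total = solve 1 (λ s → s :+ ((con 1ℚ :- s) :+ con 0ℚ) := con 1ℚ) refl

wide-not-latticeFree : ∀ {n i} {f : Poly n} {α} → Wide i α → coeff f α ≢ 0ℤ → coeff f (swp i α) ≢ 0ℤ → ¬ LatticeFree (Newton f)
wide-not-latticeFree {i = i} {f} {α} w nα nβ lf with s , μ , 0<s , s<1 , e ← wide-interior w =
  Wide-swp w (toℚv-injective (proj₂ vertex (toℚv α) (toℚv (swp i α)) s (Newton-exponent {f = f} nα) (Newton-exponent {f = f} nβ) 0<s s<1
    (lookup-ext λ k → trans (coord k) (sym (trans (lookup-mix s (1ℚ ℚ.- s) (toℚv α) (toℚv (swp i α)) k)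
      (cong₂ (λ a b → s ℚ.* a ℚ.+ (1ℚ ℚ.- s) ℚ.* b) (VecP.lookup-map k ι α) (VecP.lookup-map k ι (swp i α))))))))
  where
  coord : ∀ k → Vec.lookup (toℚv μ) k ≡ s ℚ.* ι (Vec.lookup α k) ℚ.+ (1ℚ ℚ.- s) ℚ.* ι (Vec.lookup (swp i α) k)
  coord k = trans (VecP.lookup-map k ι μ) (e k)
  0<1-s : 0ℚ ℚ.< 1ℚ ℚ.- s
  0<1-s = subst (ℚ._< 1ℚ ℚ.- s) (ℚP.+-inverseʳ s) (ℚP.+-monoˡ-< (ℚ.- s) s<1)
  vertex : IsVertex (Newton f) (toℚv μ)
  vertex = proj₁ (lf (toℚv μ)) (Newton-segment {f = f} {α} {swp i α} s (ℚP.<⇒≤ 0<s) (ℚP.<⇒≤ 0<1-s) nα nβ (toℚv μ) coord , toℚv-integral μ)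

-- Assembling both directions

gap-not-latticeFree : ∀ {n} (w : Permutation′ n) {i} → Gap i (vals w) → ¬ LatticeFree (Newton (groth w))
gap-not-latticeFree w {i} g
  with f , s , _ , lowest ← IsG-lowest (groth-IsG w) (vals-Unique w)
  with α , nz , wide ← Gap-Wide s (vals-Unique w) g
  = wide-not-latticeFree {f = groth w} wide (occurs α nz) (occurs (swp i α) λ z → nz (trans (sym (IsS-symmetric s (Gap-Asc g) α)) z))
  where
  -- By homogeneity β has the lowest degree, where 𝔊_w and f have equal coefficients.
  occurs : ∀ β → f β ≢ 0ℤ → coeff (groth w) β ≢ 0ℤ
  occurs β h z = h (trans (sym (lowest β (IsS-homogeneous s (vals-Unique w) β h))) z)

sub-distinct : ∀ {n x y} {v : Vec ℕ n} → Unique v → Sub (x ∷ y ∷ []) v → x ≢ y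
sub-distinct (p ∷ _) (take s) = sub-fresh s p
sub-distinct (_ ∷ u) (skip s) = sub-distinct u s

vals-Avoids : ∀ {n} (w : Permutation′ n) → ¬ Contains w p1432 → ¬ Contains w p1423 → ¬ Contains w p13254 → Avoids (vals w)
vals-Avoids w h₁ h₂ h₃ = record { no-14 = no-14′ ; no-13254 = λ s x y z t → h₃ (contains-13254 {w = w} s x y z t) }
  where
  no-14′ : ∀ {a b c e} → Sub (a ∷ b ∷ c ∷ e ∷ []) (vals w) → a < c → c < b → a < e → e < b → ⊥
  no-14′ {c = c} {e} s a<c c<b a<e e<b with ℕP.<-cmp c e
  ... | tri< c<e _ _ = h₂ (contains-1423 {w = w} s a<c c<e e<b)
  ... | tri≈ _ c≡e _ = sub-distinct (vals-Unique w) (sub-tail (sub-tail s)) c≡e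
  ... | tri> _ _ e<c = h₁ (contains-1432 {w = w} s a<e e<c c<b)

runningMin : ∀ {n} → ℕ → Vec ℕ n → Vec ℕ n
runningMin M []      = []
runningMin M (a ∷ u) = M ⊓ a ∷ runningMin (M ⊓ a) u

Inv-box : ∀ {n} M {v α : Vec ℕ n} → Inv M v α → InBox (runningMin M v) α
Inv-box M {a ∷ u} {b ∷ α} (lo , hi , r) zero = lo , upper hi
  where
  upper : b ≤ M ⊓ a ⊎ Inv21 (M ⊓ a) (a ∷ u) × b ≤ suc (M ⊓ a) → b ≤ suc (M ⊓ a)
  upper (inj₁ h)       = ℕP.m≤n⇒m≤1+n h
  upper (inj₂ (_ , h)) = h
Inv-box M {a ∷ u} {b ∷ α} (lo , hi , r) (suc k) = Inv-box (M ⊓ a) r k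

coeff-All : ∀ {n} {P : Vec ℕ n → Set} {p : Poly n} → All (P ∘ proj₂) p → ∀ α → coeff p α ≢ 0ℤ → P α
coeff-All [] α nz = contradiction refl nz
coeff-All {P = P} {(c , β) ∷ p} (h ∷ hs) α nz with VecP.≡-dec ℕ._≟_ β α
... | yes β≡α = subst P β≡α h
... | no _    = coeff-All hs α nz

theorem5p4 : (n : ℕ) (w : Permutation′ n) →
    (LatticeFree (Newton (groth w)) →
    (¬ Contains w p1432) × (¬ Contains w p1423) × (¬ Contains w p13254))
    × ((¬ Contains w p1432) × (¬ Contains w p1423) × (¬ Contains w p13254) →
    LatticeFree (Newton (groth w)))
theorem5p4 n w =
  (λ lf → (λ c → refute lf (inj₁ c)) , (λ c → refute lf (inj₂ (inj₁ c))) , (λ c → refute lf (inj₂ (inj₂ c)))) ,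
  -- The starting bound n exceeds every value, so the first running minimum is v₀.
  λ (h₁ , h₂ , h₃) → box-latticeFree (groth w) (runningMin n (vals w)) λ α nz →
    Inv-box n (coeff-All (IsG-Inv (groth-IsG w) (vals-Unique w) (vals-cover w)
      (VAllP.tabulate⁺ (λ k → FinP.toℕ<n (w ⟨$⟩ʳ k))) (vals-Avoids w h₁ h₂ h₃)) α nz)
  where
  refute : LatticeFree (Newton (groth w)) → ¬ (Contains w p1432 ⊎ Contains w p1423 ⊎ Contains w p13254)
  refute lf p with i , g ← gap-of-pattern {w = w} p = gap-not-latticeFree w g lf
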